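{- For any positive integers $k$, $\Delta$ and $s$ there is a constant $C=C(k,\Delta,s)$ such that for every positive integer $n$ and every $n$-vertex tree $T$ with maximum degree $\Delta(T)\leq \Delta$ we have $\hat{r}_s(T^k)\leq Cn$; that is, $\hat{r}_s(T^k)=O_{k,\Delta,s}(n)$.
   Context: For graphs $G,H$ and a positive integer $s$, $G\to(H)_s$ means that every colouring of the edges of $G$ with $s$ colours contains a monochromatic copy of $H$. The $s$-colour size-Ramsey number of $H$ is $\hat{r}_s(H)=\min\{e(G)\colon G\to(H)_s\}$. For a graph $H$ and a positive integer $k$, the $k$th power $H^k$ is the graph on $V(H)$ in which distinct vertices $u,v$ are adjacent if and only if their distance in $H$ is at most $k$. -}

module Defs where

open import Data.Nat using (ℕ; zero; suc; _≤_; _<_; _+_)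
open import Data.Fin using (Fin; zero; suc; inject₁; fromℕ) renaming (_<_ to _<ᶠ_; _<?_ to _<ᶠ?_)
open import Data.Fin.Properties using ()
open import Data.List using (List; length; filter; allFin; cartesianProduct)
open import Data.Product using (Σ; ∃; ∃-syntax; _×_; _,_; proj₁; proj₂)
open import Relation.Nullary using (¬_)
open import Relation.Nullary.Decidable using (_×-dec_)
open import Relation.Binary.PropositionalEquality using (_≡_)
open import Function.Definitions using (Injective)

record SimpleGraph (n : ℕ) : Set₁ where
  field
    Adj   : Fin n → Fin n → Set
    sym   : ∀ {u v} → Adj u v → Adj v u
    irr   : ∀ {u} → ¬ Adj u u
    dec   : ∀ u v → Relation.Nullary.Dec (Adj u v)
open SimpleGraph public

edges : ∀ {n} → SimpleGraph n → ℕ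
edges {n} G = length (filter (λ p → (proj₁ p <ᶠ? proj₂ p) ×-dec dec G (proj₁ p) (proj₂ p))
                             (cartesianProduct (allFin n) (allFin n)))

degree : ∀ {n} → SimpleGraph n → Fin n → ℕ
degree {n} G v = length (filter (λ u → dec G v u) (allFin n))

MaxDegreeAtMost : ∀ {n} → SimpleGraph n → ℕ → Set
MaxDegreeAtMost {n} G D = ∀ (v : Fin n) → degree G v ≤ D

Walk : ∀ {n} → (Fin n → Fin n → Set) → ℕ → Fin n → Fin n → Set
Walk {n} A ℓ u v =
  Σ (Fin (suc ℓ) → Fin n) λ p →
    (p zero ≡ u) × (p (fromℕ ℓ) ≡ v) × (∀ (i : Fin ℓ) → A (p (inject₁ i)) (p (suc i)))

Connected : ∀ {n} → SimpleGraph n → Set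
Connected {n} G = ∀ (u v : Fin n) → ∃[ ℓ ] Walk (Adj G) ℓ u v

HasCycle : ∀ {n} → SimpleGraph n → Set
HasCycle {n} G =
  ∃[ m ] Σ (Fin (suc (suc (suc m))) → Fin n) λ f →
    Injective _≡_ _≡_ f
    × (∀ (i : Fin (suc (suc m))) → Adj G (f (inject₁ i)) (f (suc i)))
    × Adj G (f (fromℕ (suc (suc m)))) (f zero)

IsTree : ∀ {n} → SimpleGraph n → Set
IsTree G = Connected G × ¬ HasCycle G

-- k-th power: distinct u, v adjacent iff dist(u,v) ≤ k, i.e. there is a
-- walk of length at most k from u to v.
PowerAdj : ∀ {n} → SimpleGraph n → ℕ → Fin n → Fin n → Set
PowerAdj G k u v = ¬ (u ≡ v) × ∃[ ℓ ] (ℓ ≤ k × Walk (Adj G) ℓ u v)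

-- An s-edge-colouring of G: a colour for each (ordered) pair, symmetric on edges
-- (so each edge receives exactly one colour).
EdgeColouring : ∀ {m} → SimpleGraph m → ℕ → Set
EdgeColouring {m} G s =
  Σ (Fin m → Fin m → Fin s) λ c → ∀ u v → Adj G u v → c u v ≡ c v u

MonoCopy : ∀ {n m s} (HA : Fin n → Fin n → Set) (G : SimpleGraph m)
           → (Fin m → Fin m → Fin s) → Fin s → Set
MonoCopy {n} {m} HA G c i =
  Σ (Fin n → Fin m) λ f →
    Injective _≡_ _≡_ f
    × (∀ u v → HA u v → Adj G (f u) (f v) × c (f u) (f v) ≡ i)

Arrows : ∀ {n m} → SimpleGraph m → (Fin n → Fin n → Set) → ℕ → Set
Arrows G HA s = ∀ (col : EdgeColouring G s) → ∃[ i ] MonoCopy HA G (proj₁ col) i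

{-# OPTIONS --safe #-}
module Submission where

-- Root T and send v to the ancestor of v that lies k + (depth v mod k) levels above it.  Vertices at distance at most k
-- are then sent to vertices that are equal or k levels apart on a branch, so T^k is contained in T′ ⊠ K_t, where T′ is
-- again a tree of bounded degree (v is joined to its k-th ancestor) and t is bounded.
--
-- A host for s colours is a bounded degree graph on O(n) vertices such that every s-colouring of any half of it contains
-- a monochromatic T′ ⊠ K_t.  Hosts are built by induction on s.  Given a host F for s colours, take a sparse bipartite
-- graph E between V(F) and a set V of size O(n) that meets every product of two linear sized sets, join v, w ∈ V when they
-- are E-attached to adjacent vertices of F, and replace every vertex of V by a large clique.  In an (s+1)-colouring,
-- Ramsey's theorem shrinks the cliques to bags that are monochromatic, in a common colour "blue" for a positive
-- proportion of V, and such that any two joined bags see only blue or no blue.  Either the blue graph on the bags expands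
-- somewhere, and then contains T′ by the Friedman–Pippenger theorem, or peeling off non-expanding sets yields many linear
-- sized sets X_i of bags without blue edges between them.  In the second case colour F properly and match the i-th colour
-- class into X_i along E: this embeds at least half of F without using blue, and induction applies.

open import Defs hiding (sym; irr; dec)
open import Level using (Level)
open import Data.Bool using (Bool; true; false; _∧_; _∨_; not; if_then_else_)
open import Data.Bool.ListAction using (any)
open import Data.Bool.Properties as Boolₚ using (not-injective; T-≡)
open import Data.Empty using (⊥; ⊥-elim)
open import Data.Fin using (Fin; zero; suc; toℕ; fromℕ; fromℕ<; inject₁; remQuot; combine; _<?_)
open import Data.Fin.Properties using (_≟_; all?; combine-remQuot; toℕ-injective; toℕ-fromℕ<; toℕ<n)
open import Data.Fin.Subset.Properties using (anySubset?)
open import Data.List using (List; []; _∷_; length; map; filter; allFin; cartesianProduct; _++_; lookup)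
open import Data.List.Membership.Propositional using (_∈_)
open import Data.List.Membership.Propositional.Properties using (∈-allFin; ∈-lookup; ∈-map⁺; ∈-map⁻; ∈-++⁺ˡ; ∈-++⁺ʳ; ∈-filter⁺; ∈-filter⁻; ∈-cartesianProduct⁺)
import Data.List.Membership.DecPropositional as DecMembership
open import Data.List.Properties as Listₚ using (length-tabulate; length-map; length-++; filter-notAll)
open import Data.List.Relation.Binary.Sublist.Propositional using (_⊆_; []; _∷_; _∷ʳ_; ⊆-refl; ⊆-trans) renaming (lookup to ⊆-lookup)
open import Data.List.Relation.Binary.Sublist.Propositional.Properties using (All-resp-⊆) renaming (map⁺ to ⊆-map)
open import Data.List.Relation.Unary.All as All using (All; []; _∷_)
import Data.List.Relation.Unary.All.Properties as Allₚ
open import Data.List.Relation.Unary.AllPairs using (AllPairs; []; _∷_)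
import Data.List.Relation.Unary.AllPairs.Properties as AllPairsₚ
open import Data.List.Relation.Unary.Any as Any using (here; there; index)
open import Data.List.Relation.Unary.Any.Properties using (lookup-index)
open import Data.List.Relation.Unary.Unique.Propositional using (Unique)
import Data.List.Relation.Unary.Unique.Propositional.Properties as Uniq
open import Data.Nat hiding (_≟_; _/_; _%_; _<?_)
open import Data.Nat.DivMod using (_%_; _/_; m≡m%n+[m/n]*n; m%n<n; m<n⇒m%n≡m; [m+n]%n≡m%n; [m+kn]%n≡m%n)
open import Data.Nat.Properties hiding (_≟_; _<?_)
open import Data.Nat.Tactic.RingSolver using (solve-∀)
open import Data.Product using (Σ; ∃; ∃-syntax; _×_; _,_; proj₁; proj₂)
open import Data.Sum using (_⊎_; inj₁; inj₂; [_,_]′)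
open import Data.Vec as Vec using (Vec; tabulate; []; _∷_)
open import Data.Vec.Properties using (lookup∘tabulate)
open import Function using (_∘_; id; case_of_)
open import Function.Bundles using (Equivalence)
open import Relation.Binary.PropositionalEquality
open import Relation.Nullary using (¬_; Dec; yes; no; does)
open import Relation.Nullary.Decidable using (dec-true; dec-false; ¬?; _×-dec_; _⊎-dec_; _→-dec_)

-- The `k` extra levels of the shift lift the image of a vertex to or above each of its ancestors at
-- most `k` levels up. Without them, close vertices in different branches could be sent to different
-- branches; with them, both images are among two vertices determined by the common ancestor alone.
--
-- The clique size can be chosen last. The size of `V` depends on the order and degree of `F`, the
-- degrees of `E` depend on these, and the joined graph on `V` takes its degree from `E` and `F`.
-- Only then are the cliques made so large that homogenising the bags, which costs a tower in that
-- degree, leaves enough of them. Nothing fixed earlier refers to the clique size, so no constant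
-- depends on `n`.
--
-- Finite sets are Boolean predicates. Whether some set fails to expand is then decided by search,
-- and the graph `E`, usually found at random, comes from a greedy covering argument: each new edge
-- meets at least a fixed proportion of the rectangles not yet met.

private variable
  a b : Level
  A : Set a
  B : Set b
  N n m : ℕ

-- Booleans

∧-intro : ∀ {x y} → x ≡ true → y ≡ true → x ∧ y ≡ true
∧-intro refl refl = refl

∧-fst : ∀ {x y} → x ∧ y ≡ true → x ≡ true
∧-fst {true} _ = refl

∧-snd : ∀ {x y} → x ∧ y ≡ true → y ≡ true
∧-snd {true} p = p

∨-elim : ∀ {x y} → x ∨ y ≡ true → (x ≡ true) ⊎ (y ≡ true)
∨-elim {true}  _ = inj₁ refl
∨-elim {false} p = inj₂ p

∨-introˡ : ∀ {x} y → x ≡ true → x ∨ y ≡ true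
∨-introˡ _ refl = refl

∨-introʳ : ∀ x {y} → y ≡ true → x ∨ y ≡ true
∨-introʳ true  _ = refl
∨-introʳ false p = p

not-true : ∀ {x} → not x ≡ true → x ≡ false
not-true {false} _ = refl

true≢false : ∀ {x} → x ≡ true → x ≡ false → ⊥
true≢false refl ()

not-intro : ∀ {x} → ¬ (x ≡ true) → not x ≡ true
not-intro {true}  h = ⊥-elim (h refl)
not-intro {false} h = refl

bool-≡ : ∀ {x y} → (x ≡ true → y ≡ true) → (y ≡ true → x ≡ true) → x ≡ y
bool-≡ {true}  {true}  _ _ = refl
bool-≡ {true}  {false} f _ = sym (f refl)
bool-≡ {false} {true}  _ g = g refl
bool-≡ {false} {false} _ _ = refl

bool? : (x : Bool) → (x ≡ true) ⊎ (x ≡ false)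
bool? true  = inj₁ refl
bool? false = inj₂ refl

infix 5 _==_
_==_ : Fin N → Fin N → Bool
x == y = does (x ≟ y)

==⇒≡ : {x y : Fin N} → (x == y) ≡ true → x ≡ y
==⇒≡ {x = x} {y} p with x ≟ y
... | yes e = e
==⇒≡ {x = x} {y} () | no _

==-refl : (x : Fin N) → (x == x) ≡ true
==-refl x = dec-true (x ≟ x) refl

≢⇒== : {x y : Fin N} → x ≢ y → (x == y) ≡ false
≢⇒== {x = x} {y} p = dec-false (x ≟ y) p

⟦_⟧ : Bool → ℕ
⟦ true  ⟧ = 1
⟦ false ⟧ = 0

⟦⟧-mono : ∀ {x y} → (x ≡ true → y ≡ true) → ⟦ x ⟧ ≤ ⟦ y ⟧
⟦⟧-mono {false} _ = z≤n
⟦⟧-mono {true} {y} h rewrite h refl = ≤-refl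

-- Finite sums

Σl : List A → (A → ℕ) → ℕ
Σl []       f = 0
Σl (x ∷ xs) f = f x + Σl xs f

Σl-mono∈ : ∀ (xs : List A) {f g : A → ℕ} → (∀ {x} → x ∈ xs → f x ≤ g x) → Σl xs f ≤ Σl xs g
Σl-mono∈ []       h = z≤n
Σl-mono∈ (x ∷ xs) h = +-mono-≤ (h (here refl)) (Σl-mono∈ xs (h ∘ there))

Σl-mono : ∀ (xs : List A) {f g : A → ℕ} → (∀ x → f x ≤ g x) → Σl xs f ≤ Σl xs g
Σl-mono xs h = Σl-mono∈ xs (λ {x} _ → h x)

Σl-cong : ∀ (xs : List A) {f g : A → ℕ} → (∀ x → f x ≡ g x) → Σl xs f ≡ Σl xs g
Σl-cong []       h = refl
Σl-cong (x ∷ xs) h = cong₂ _+_ (h x) (Σl-cong xs h)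

+-interchange : ∀ p q r s → (p + q) + (r + s) ≡ (p + r) + (q + s)
+-interchange = solve-∀

Σl-+ : ∀ (xs : List A) (f g : A → ℕ) → Σl xs (λ x → f x + g x) ≡ Σl xs f + Σl xs g
Σl-+ []       f g = refl
Σl-+ (x ∷ xs) f g = trans (cong ((f x + g x) +_) (Σl-+ xs f g)) (+-interchange (f x) (g x) _ _)

Σl-0 : ∀ (xs : List A) → Σl xs (λ _ → 0) ≡ 0
Σl-0 []       = refl
Σl-0 (x ∷ xs) = Σl-0 xs

Σl-swap : ∀ (xs : List A) (ys : List B) (f : A → B → ℕ) →
          Σl xs (λ x → Σl ys (f x)) ≡ Σl ys (λ y → Σl xs (λ x → f x y))
Σl-swap []       ys f = sym (Σl-0 ys)
Σl-swap (x ∷ xs) ys f =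
  trans (cong (Σl ys (f x) +_) (Σl-swap xs ys f)) (sym (Σl-+ ys (f x) _))

Σl-* : ∀ (xs : List A) (f : A → ℕ) c → Σl xs (λ x → f x * c) ≡ Σl xs f * c
Σl-* []       f c = refl
Σl-* (x ∷ xs) f c = trans (cong (f x * c +_) (Σl-* xs f c)) (sym (*-distribʳ-+ c (f x) _))

Σl-const : ∀ (xs : List A) c → Σl xs (λ _ → c) ≡ length xs * c
Σl-const []       c = refl
Σl-const (x ∷ xs) c = cong (c +_) (Σl-const xs c)

Σl-bound : ∀ (xs : List A) {f : A → ℕ} {c} → (∀ x → f x ≤ c) → Σl xs f ≤ length xs * c
Σl-bound xs {f} {c} h = ≤-trans (Σl-mono xs h) (≤-reflexive (Σl-const xs c))

Σl-∈ : ∀ {xs : List A} {x} (f : A → ℕ) → x ∈ xs → f x ≤ Σl xs f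
Σl-∈ f (here refl) = m≤m+n _ _
Σl-∈ f (there p)   = ≤-trans (Σl-∈ f p) (m≤n+m _ _)

Σl-map : ∀ (g : A → B) (xs : List A) (f : B → ℕ) → Σl (map g xs) f ≡ Σl xs (f ∘ g)
Σl-map g []       f = refl
Σl-map g (x ∷ xs) f = cong (f (g x) +_) (Σl-map g xs f)

Σl-++ : ∀ (xs ys : List A) (f : A → ℕ) → Σl (xs ++ ys) f ≡ Σl xs f + Σl ys f
Σl-++ []       ys f = refl
Σl-++ (x ∷ xs) ys f = trans (cong (f x +_) (Σl-++ xs ys f)) (sym (+-assoc (f x) _ _))

Σl-cartesianProduct : ∀ (xs : List A) (ys : List B) (f : A × B → ℕ) →
  Σl (cartesianProduct xs ys) f ≡ Σl xs (λ x → Σl ys (λ y → f (x , y)))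
Σl-cartesianProduct []       ys f = refl
Σl-cartesianProduct (x ∷ xs) ys f =
  trans (Σl-++ (map (x ,_) ys) (cartesianProduct xs ys) f)
        (cong₂ _+_ (Σl-map (x ,_) ys f) (Σl-cartesianProduct xs ys f))

Σl-average : ∀ (xs : List A) (f : A → ℕ) c → 0 < length xs → length xs * c ≤ Σl xs f →
             ∃[ x ] (x ∈ xs × c ≤ f x)
Σl-average (x ∷ xs) f c _ h with c ≤? f x
... | yes p = x , here refl , p
Σl-average (x ∷ [])      f c _ h | no q =
  ⊥-elim (q (≤-trans (m≤m+n c 0) (≤-trans h (≤-reflexive (+-identityʳ (f x))))))
Σl-average (x ∷ y ∷ xs) f c _ h | no q =
  let (z , z∈ , p) = Σl-average (y ∷ xs) f c (s≤s z≤n)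
                       (+-cancelˡ-≤ c _ _ (≤-trans h (+-monoˡ-≤ _ (<⇒≤ (≰⇒> q)))))
  in z , there z∈ , p

Σl-zero : ∀ (xs : List A) (f : A → ℕ) → Σl xs f < length xs → ∃[ x ] (x ∈ xs × f x ≡ 0)
Σl-zero (x ∷ xs) f h with f x in eq
... | zero  = x , here refl , eq
... | suc k = let (z , z∈ , p) = Σl-zero xs f (≤-trans (s≤s (m≤n+m _ k)) (s≤s⁻¹ h)) in z , there z∈ , p

length-filter : ∀ {p} {P : A → Set p} (P? : ∀ x → Dec (P x)) (xs : List A) →
                length (filter P? xs) ≡ Σl xs (λ x → ⟦ does (P? x) ⟧)
length-filter P? []       = refl
length-filter P? (x ∷ xs) with does (P? x)
... | true  = cong suc (length-filter P? xs)
... | false = length-filter P? xs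

∑ : (Fin N → ℕ) → ℕ
∑ {N} f = Σl (allFin N) f

length-allFin : ∀ N → length (allFin N) ≡ N
length-allFin N = length-tabulate {n = N} id

# : (Fin N → Bool) → ℕ
# P = ∑ (λ x → ⟦ P x ⟧)

∑-mono : {f g : Fin N → ℕ} → (∀ x → f x ≤ g x) → ∑ f ≤ ∑ g
∑-mono {N} = Σl-mono (allFin N)

∑-bound : {f : Fin N → ℕ} {c : ℕ} → (∀ x → f x ≤ c) → ∑ f ≤ N * c
∑-bound {N} {f} {c} h = ≤-trans (Σl-bound (allFin N) h) (≤-reflexive (cong (_* c) (length-allFin N)))

∑-const : ∀ c → ∑ {N} (λ _ → c) ≡ N * c
∑-const {N} c = trans (Σl-const (allFin N) c) (cong (_* c) (length-allFin N))

∑-≥ : (f : Fin N → ℕ) (x : Fin N) → f x ≤ ∑ f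
∑-≥ f x = Σl-∈ f (∈-allFin x)

#-mono : {P Q : Fin N → Bool} → (∀ x → P x ≡ true → Q x ≡ true) → # P ≤ # Q
#-mono h = ∑-mono (λ x → ⟦⟧-mono (h x))

#-cong : {P Q : Fin N → Bool} → (∀ x → P x ≡ Q x) → # P ≡ # Q
#-cong {N} h = Σl-cong (allFin N) (λ x → cong ⟦_⟧ (h x))

#-true : # {N} (λ _ → true) ≡ N
#-true {N} = trans (∑-const {N} 1) (*-identityʳ N)

#-split : (P Q : Fin N → Bool) → # P ≡ # (λ x → P x ∧ Q x) + # (λ x → P x ∧ not (Q x))
#-split {N} P Q = trans (Σl-cong (allFin N) (λ x → aux (P x) (Q x))) (Σl-+ (allFin N) _ _)
  where
  aux : ∀ p q → ⟦ p ⟧ ≡ ⟦ p ∧ q ⟧ + ⟦ p ∧ not q ⟧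
  aux true  true  = refl
  aux true  false = refl
  aux false _     = refl

#-∨ : (P Q : Fin N → Bool) → # (λ x → P x ∨ Q x) ≤ # P + # Q
#-∨ {N} P Q = ≤-trans (∑-mono (λ x → aux (P x) (Q x))) (≤-reflexive (Σl-+ (allFin N) _ _))
  where
  aux : ∀ p q → ⟦ p ∨ q ⟧ ≤ ⟦ p ⟧ + ⟦ q ⟧
  aux true  _ = s≤s z≤n
  aux false _ = ≤-refl

Σl-δ≤ : ∀ {xs : List (Fin N)} (x : Fin N) → Unique xs → Σl xs (λ y → ⟦ x == y ⟧) ≤ 1
Σl-δ≤ {xs = []}     x _        = z≤n
Σl-δ≤ {xs = y ∷ ys} x (py ∷ u) with x ≟ y
... | no  _    = Σl-δ≤ x u
... | yes refl = s≤s (≤-trans (Σl-mono∈ ys (λ {z} z∈ → ≤-reflexive (cong ⟦_⟧ (≢⇒== (All.lookup py z∈)))))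
                              (≤-reflexive (Σl-0 ys)))

#-δ : (x : Fin N) → # (x ==_) ≡ 1
#-δ {N} x = ≤-antisym (Σl-δ≤ x (Uniq.allFin⁺ N))
                     (≤-trans (≤-reflexive (cong ⟦_⟧ (sym (==-refl x)))) (∑-≥ (λ y → ⟦ x == y ⟧) x))

#-pos : (P : Fin N → Bool) → 0 < # P → ∃[ x ] (P x ≡ true)
#-pos {N} P h = go (allFin N) h
  where
  go : ∀ xs → 0 < Σl xs (λ x → ⟦ P x ⟧) → ∃[ x ] (P x ≡ true)
  go (x ∷ xs) h with P x in eq
  ... | true  = x , eq
  ... | false = go xs h

#-∈ : (P : Fin N → Bool) {x : Fin N} → P x ≡ true → 0 < # P
#-∈ P {x} p = ≤-trans (≤-reflexive (cong ⟦_⟧ (sym p))) (∑-≥ (λ y → ⟦ P y ⟧) x)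

some : (Fin N → Bool) → Bool
some {N} P = any P (allFin N)

some-intro : (P : Fin N → Bool) {x : Fin N} → P x ≡ true → some P ≡ true
some-intro {N} P {x} p = go (∈-allFin x)
  where
  go : ∀ {xs} → x ∈ xs → any P xs ≡ true
  go {y ∷ xs} (here refl) = ∨-introˡ _ p
  go {y ∷ xs} (there i)   = ∨-introʳ (P y) (go i)

some-elim : (P : Fin N → Bool) → some P ≡ true → ∃[ x ] (P x ≡ true)
some-elim {N} P = go (allFin N)
  where
  go : ∀ xs → any P xs ≡ true → ∃[ x ] (P x ≡ true)
  go (y ∷ xs) h with ∨-elim {P y} h
  ... | inj₁ p = y , p
  ... | inj₂ p = go xs p

some-≤ : (P : Fin N → Bool) → ⟦ some P ⟧ ≤ # P
some-≤ P with some P in eq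
... | false = z≤n
... | true  = #-∈ P (proj₂ (some-elim P eq))

#-some : (P : Fin N → Fin m → Bool) → # (λ y → some (λ x → P x y)) ≤ ∑ (λ x → # (P x))
#-some {N} {m} P = ≤-trans (∑-mono (λ y → some-≤ (λ x → P x y)))
                        (≤-reflexive (Σl-swap (allFin m) (allFin N) (λ y x → ⟦ P x y ⟧)))

none : (P : Fin N → Bool) → some P ≡ false → ∀ x → P x ≡ false
none P h x with P x in eq
... | false = refl
... | true  = ⊥-elim (true≢false (some-intro P eq) h)

_⊆ᵇ_ : (Fin N → Bool) → (Fin N → Bool) → Set
P ⊆ᵇ Q = ∀ x → P x ≡ true → Q x ≡ true

-- Subsets are enumerated as vectors of Booleans, and a predicate agrees with its table only
-- pointwise; hence the hypothesis that `P` respects pointwise equality. The search decides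
-- expansion and the Friedman-Pippenger invariant.
search-subset : {P : (Fin N → Bool) → Set} → (∀ X → Dec (P X)) →
                (∀ {X Y} → (∀ x → X x ≡ Y x) → P X → P Y) →
                (∃ P) ⊎ (∀ X → ¬ P X)
search-subset {P = P} P? resp with anySubset? (λ v → P? (Vec.lookup v))
... | yes (v , p) = inj₁ (Vec.lookup v , p)
... | no ¬p       = inj₂ (λ X pX → ¬p (tabulate X , resp (λ x → sym (lookup∘tabulate X x)) pX))

#-missing : (P : Fin N → Bool) {x : Fin N} → P x ≡ false → # P < N
#-missing {N} P {x} px = begin
    suc (# P)                       ≡⟨ +-comm 1 (# P) ⟩
    # P + 1                         ≡⟨ cong (# P +_) (sym (#-δ x)) ⟩
    # P + # (x ==_)                 ≡⟨ sym (Σl-+ (allFin N) _ _) ⟩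
    ∑ (λ y → ⟦ P y ⟧ + ⟦ x == y ⟧)  ≤⟨ ∑-bound aux ⟩
    N * 1                           ≡⟨ *-identityʳ N ⟩
    N                               ∎
  where
  open ≤-Reasoning
  aux : ∀ y → ⟦ P y ⟧ + ⟦ x == y ⟧ ≤ 1
  aux y with x ≟ y
  ... | yes refl rewrite px = ≤-refl
  ... | no _ with P y
  ...   | true  = ≤-refl
  ...   | false = z≤n

#-insert : (P : Fin N → Bool) (x : Fin N) → # (λ y → P y ∨ (x == y)) ≤ suc (# P)
#-insert P x = ≤-trans (#-∨ P (x ==_)) (≤-reflexive (trans (cong (# P +_) (#-δ x)) (+-comm (# P) 1)))

#-insert-new : (P : Fin N → Bool) {x : Fin N} → P x ≡ false → suc (# P) ≤ # (λ y → P y ∨ (x == y))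
#-insert-new {N} P {x} px = begin
    suc (# P)                       ≡⟨ +-comm 1 (# P) ⟩
    # P + 1                         ≡⟨ cong (# P +_) (sym (#-δ x)) ⟩
    # P + # (x ==_)                 ≡⟨ sym (Σl-+ (allFin N) _ _) ⟩
    ∑ (λ y → ⟦ P y ⟧ + ⟦ x == y ⟧)  ≤⟨ ∑-mono aux ⟩
    # (λ y → P y ∨ (x == y))        ∎
  where
  open ≤-Reasoning
  aux : ∀ y → ⟦ P y ⟧ + ⟦ x == y ⟧ ≤ ⟦ P y ∨ (x == y) ⟧
  aux y with x ≟ y
  ... | yes refl rewrite px = ≤-refl
  ... | no _ with P y
  ...   | true  = ≤-refl
  ...   | false = z≤n

-- The value of par at the root is irrelevant.
record RootedTree (n D : ℕ) : Set where
  field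
    root     : Fin n
    par      : Fin n → Fin n
    dep      : Fin n → ℕ
    dep-par  : ∀ {v} → v ≢ root → dep (par v) < dep v
    children : ∀ w → # (λ v → not (root == v) ∧ (par v == w)) ≤ D

-- Friedman–Pippenger embedding

module Expander {N : ℕ} (Γ : Fin N → Fin N → Bool) (R : Fin N → Bool) (D n : ℕ) where

  Nb : (Fin N → Bool) → Fin N → Bool
  Nb X y = R y ∧ some (λ x → X x ∧ Γ x y)

  Nb-intro : ∀ X {x y} → R y ≡ true → X x ≡ true → Γ x y ≡ true → Nb X y ≡ true
  Nb-intro X {y = y} r p q = ∧-intro r (some-intro (λ x → X x ∧ Γ x y) (∧-intro p q))

  Nb-elim : ∀ X {y} → Nb X y ≡ true → ∃[ x ] (X x ≡ true × Γ x y ≡ true)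
  Nb-elim X {y} h = let (x , p) = some-elim (λ x → X x ∧ Γ x y) (∧-snd {R y} h) in x , ∧-fst p , ∧-snd {X x} p

  Nb-mono : ∀ {X Y} → X ⊆ᵇ Y → Nb X ⊆ᵇ Nb Y
  Nb-mono {X} {Y} s y h = let (x , p , q) = Nb-elim X h in Nb-intro Y (∧-fst h) (s x p) q

  -- `Nb X` may overlap `X`. The bound `2 * n` leaves room for the union of two tight sets, and
  -- `suc D` exceeds the largest demand of a vertex by one, which is what bounds tight sets in
  -- `tight-small`.
  NonExpanding : (Fin N → Bool) → Set
  NonExpanding X = X ⊆ᵇ R × 0 < # X × # X ≤ 2 * n × # (Nb X) < suc D * # X

  nonExpanding? : (∃ NonExpanding) ⊎ (∀ X → ¬ NonExpanding X)
  nonExpanding? = search-subset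
    (λ X → all? (λ x → (X x Boolₚ.≟ true) →-dec (R x Boolₚ.≟ true)) ×-dec
           (1 ≤? # X) ×-dec (# X ≤? 2 * n) ×-dec (suc (# (Nb X)) ≤? suc D * # X))
    (λ {X} {Y} e (p₁ , p₂ , p₃ , p₄) →
      (λ x h → p₁ x (trans (e x) h)) ,
      subst (0 <_) (#-cong e) p₂ , subst (_≤ 2 * n) (#-cong e) p₃ ,
      ≤-<-trans (#-mono (Nb-mono (λ x h → trans (e x) h))) (subst (λ k → # (Nb X) < suc D * k) (#-cong e) p₄))

  -- `dem x` is the number of neighbours that must still be kept available for `x`.
  weight : (Fin N → ℕ) → (Fin N → Bool) → ℕ
  weight dem X = ∑ (λ x → ⟦ X x ⟧ * dem x)

  free : (Fin N → Bool) → (Fin N → Bool) → ℕ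
  free S X = # (λ y → Nb X y ∧ not (S y))

  -- The used vertices S leave every small set enough room for its outstanding demand.
  Extendable : (Fin N → Bool) → (Fin N → ℕ) → Set
  Extendable S dem = ∀ X → X ⊆ᵇ R → # X ≤ 2 * n → weight dem X ≤ free S X

  weight-mono : ∀ {d d′} X → (∀ x → d x ≤ d′ x) → weight d X ≤ weight d′ X
  weight-mono X h = ∑-mono (λ x → *-monoʳ-≤ ⟦ X x ⟧ (h x))

  extendable? : ∀ S dem → (∃[ X ] (X ⊆ᵇ R × # X ≤ 2 * n × free S X < weight dem X)) ⊎ Extendable S dem
  extendable? S dem with search-subset {P = λ X → X ⊆ᵇ R × # X ≤ 2 * n × free S X < weight dem X}
    (λ X → all? (λ x → (X x Boolₚ.≟ true) →-dec (R x Boolₚ.≟ true)) ×-dec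
           (# X ≤? 2 * n) ×-dec (suc (free S X) ≤? weight dem X))
    (λ {X} {Y} e (p₁ , p₂ , p₃) →
      (λ x h → p₁ x (trans (e x) h)) , subst (_≤ 2 * n) (#-cong e) p₂ ,
      ≤-<-trans (#-mono (λ y h → ∧-intro (Nb-mono (λ x → trans (e x)) y (∧-fst h)) (∧-snd {Nb Y y} h)))
        (<-≤-trans p₃ (≤-reflexive (Σl-cong (allFin N) (λ x → cong (λ b → ⟦ b ⟧ * dem x) (e x))))))
  ... | inj₁ p = inj₁ p
  ... | inj₂ q = inj₂ (λ X p₁ p₂ → ≮⇒≥ (λ lt → q X (p₁ , p₂ , lt)))

  module _ (expanding : ∀ X → ¬ NonExpanding X) where

    expand : ∀ X → X ⊆ᵇ R → 0 < # X → # X ≤ 2 * n → suc D * # X ≤ # (Nb X)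
    expand X p q r = ≮⇒≥ (λ lt → expanding X (p , q , r , lt))

    module Step (S : Fin N → Bool) (dem : Fin N → ℕ) (inv : Extendable S dem)
                (dem≤D : ∀ x → dem x ≤ D) (S<n : # S < n) where

      Tight : (Fin N → Bool) → Set
      Tight X = X ⊆ᵇ R × # X ≤ 2 * n × free S X ≤ weight dem X

      -- Expansion gives `X` at least `suc D * # X` neighbours, of which at most `# S` are used and,
      -- by tightness, at most `D * # X` are free.
      tight-small : ∀ {X} → Tight X → # X ≤ # S
      tight-small {X} (p , q , r) with # X in eq
      ... | zero  = z≤n
      ... | suc k = subst (_≤ # S) eq (+-cancelʳ-≤ (D * # X) _ _ (begin
          # X + D * # X                              ≤⟨ expand X p (subst (0 <_) (sym eq) z<s) (subst (_≤ 2 * n) (sym eq) q) ⟩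
          # (Nb X)                                   ≡⟨ #-split (Nb X) S ⟩
          # (λ y → Nb X y ∧ S y) + free S X          ≤⟨ +-mono-≤ (#-mono {Q = S} (λ y → ∧-snd {Nb X y})) r ⟩
          # S + weight dem X                         ≤⟨ +-monoʳ-≤ (# S) (weight-mono X dem≤D) ⟩
          # S + weight (λ _ → D) X                   ≡⟨ cong (# S +_) (trans (Σl-* (allFin N) (λ x → ⟦ X x ⟧) D) (*-comm (# X) D)) ⟩
          # S + D * # X                              ∎))
        where open ≤-Reasoning

      private
        ∪-size : ∀ {a b} → a ≤ # S → b ≤ # S → a + b ≤ 2 * n
        ∪-size {a} {b} p q = subst (a + b ≤_) (cong (n +_) (sym (+-identityʳ n)))
                               (+-mono-≤ (≤-trans p (<⇒≤ S<n)) (≤-trans q (<⇒≤ S<n)))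

        submodular : ∀ {a b c d} → (a ≡ true → (c ≡ true) ⊎ (d ≡ true)) → (b ≡ true → c ≡ true) →
                     (b ≡ true → d ≡ true) → ⟦ a ⟧ + ⟦ b ⟧ ≤ ⟦ c ⟧ + ⟦ d ⟧
        submodular {a} {true} {c} {d} _ g h rewrite g refl | h refl with a
        ... | true  = ≤-refl
        ... | false = s≤s z≤n
        submodular {false} {false} _ _ _ = z≤n
        submodular {true} {false} {true} _ _ _ = s≤s z≤n
        submodular {true} {false} {false} {d} f _ _ with f refl
        ... | inj₂ refl = ≤-refl

        modular : ∀ p q k → ⟦ p ⟧ * k + ⟦ q ⟧ * k ≡ ⟦ p ∨ q ⟧ * k + ⟦ p ∧ q ⟧ * k
        modular true  true  k = refl
        modular true  false k = refl
        modular false q     k = sym (+-identityʳ _)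

      -- `free` is submodular and `weight` is modular, so the invariant at the intersection forces
      -- tightness of the union. By `tight-small` the union stays within the bound `2 * n`.
      tight-∪ : ∀ {X Y} → Tight X → Tight Y → Tight (λ x → X x ∨ Y x)
      tight-∪ {X} {Y} tX@(pX , qX , rX) tY@(pY , qY , rY) =
        (λ x h → [ pX x , pY x ]′ (∨-elim h)) ,
        ≤-trans (#-∨ X Y) (∪-size (tight-small tX) (tight-small tY)) ,
        +-cancelʳ-≤ (weight dem X∩Y) _ _ (begin
          free S X∪Y + weight dem X∩Y        ≤⟨ +-monoʳ-≤ (free S X∪Y) (inv X∩Y (λ x h → pX x (∧-fst h)) (≤-trans (#-mono {P = X∩Y} {Q = X} (λ x → ∧-fst)) qX)) ⟩
          free S X∪Y + free S X∩Y            ≡⟨ sym (Σl-+ (allFin N) _ _) ⟩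
          ∑ (λ y → ⟦ Nb X∪Y y ∧ not (S y) ⟧ + ⟦ Nb X∩Y y ∧ not (S y) ⟧)
                                             ≤⟨ ∑-mono (λ y → submodular (un y) (inˡ y) (inʳ y)) ⟩
          ∑ (λ y → ⟦ Nb X y ∧ not (S y) ⟧ + ⟦ Nb Y y ∧ not (S y) ⟧)
                                             ≡⟨ Σl-+ (allFin N) _ _ ⟩
          free S X + free S Y                ≤⟨ +-mono-≤ rX rY ⟩
          weight dem X + weight dem Y        ≡⟨ sym (Σl-+ (allFin N) _ _) ⟩
          ∑ (λ x → ⟦ X x ⟧ * dem x + ⟦ Y x ⟧ * dem x)
                                             ≡⟨ Σl-cong (allFin N) (λ x → modular (X x) (Y x) (dem x)) ⟩
          ∑ (λ x → ⟦ X∪Y x ⟧ * dem x + ⟦ X∩Y x ⟧ * dem x)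
                                             ≡⟨ Σl-+ (allFin N) _ _ ⟩
          weight dem X∪Y + weight dem X∩Y    ∎)
        where
        open ≤-Reasoning
        X∪Y X∩Y : Fin N → Bool
        X∪Y x = X x ∨ Y x
        X∩Y x = X x ∧ Y x
        un : ∀ y → Nb X∪Y y ∧ not (S y) ≡ true → (Nb X y ∧ not (S y) ≡ true) ⊎ (Nb Y y ∧ not (S y) ≡ true)
        un y h with Nb-elim X∪Y (∧-fst h)
        ... | x , p , q with ∨-elim {X x} p
        ...   | inj₁ pX = inj₁ (∧-intro (Nb-intro X (∧-fst (∧-fst h)) pX q) (∧-snd {Nb X∪Y y} h))
        ...   | inj₂ pY = inj₂ (∧-intro (Nb-intro Y (∧-fst (∧-fst h)) pY q) (∧-snd {Nb X∪Y y} h))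
        inˡ : ∀ y → Nb X∩Y y ∧ not (S y) ≡ true → Nb X y ∧ not (S y) ≡ true
        inˡ y h = ∧-intro (Nb-mono (λ x → ∧-fst) y (∧-fst h)) (∧-snd {Nb X∩Y y} h)
        inʳ : ∀ y → Nb X∩Y y ∧ not (S y) ≡ true → Nb Y y ∧ not (S y) ≡ true
        inʳ y h = ∧-intro (Nb-mono (λ x → ∧-snd {X x}) y (∧-fst h)) (∧-snd {Nb X∩Y y} h)

      tight-∅ : Tight (λ _ → false)
      tight-∅ = (λ _ ()) , ≤-trans (≤-reflexive (Σl-0 (allFin N))) z≤n ,
        ≤-trans (≤-trans (#-mono {Q = λ _ → false} (λ y h → case proj₂ (Nb-elim (λ _ → false) (∧-fst {Nb (λ _ → false) y} h)) of λ ()))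
                 (≤-reflexive (Σl-0 (allFin N)))) z≤n

      module _ (v : Fin N) (Rv : R v ≡ true) (1≤dem : 1 ≤ dem v) where

        dem⁻ : Fin N → ℕ
        dem⁻ x = dem x ∸ ⟦ v == x ⟧

        S⁺ : Fin N → Fin N → Bool
        S⁺ y x = S x ∨ (y == x)

        Candidate : Fin N → Set
        Candidate y = R y ≡ true × S y ≡ false × Γ v y ≡ true

        candidate? : ∀ y → Dec (Candidate y)
        candidate? y = (R y Boolₚ.≟ true) ×-dec (S y Boolₚ.≟ false) ×-dec (Γ v y Boolₚ.≟ true)

        weight-gain : ∀ {d d′ : Fin N → ℕ} {X Y : Fin N → Bool} →
          (∀ x → ⟦ X x ⟧ * d x + ⟦ v == x ⟧ ≤ ⟦ Y x ⟧ * d′ x) → weight d X < weight d′ Y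
        weight-gain {d} {d′} {X} {Y} h = begin
          suc (weight d X)           ≡⟨ +-comm 1 _ ⟩
          weight d X + 1             ≡⟨ cong (weight d X +_) (sym (#-δ v)) ⟩
          weight d X + # (v ==_)     ≡⟨ sym (Σl-+ (allFin N) _ _) ⟩
          ∑ (λ x → ⟦ X x ⟧ * d x + ⟦ v == x ⟧) ≤⟨ ∑-mono h ⟩
          weight d′ Y                ∎
          where open ≤-Reasoning

        -- Using `y` costs `X` at most one free neighbour, so a violation leaves no slack: `X` was
        -- tight and `y` was among its neighbours. If `v` were in `X`, the lowered demand at `v`
        -- would have made up for the loss.
        blocking : ∀ {y X} → Candidate y → X ⊆ᵇ R → # X ≤ 2 * n → free (S⁺ y) X < weight dem⁻ X →
                   Tight X × X v ≡ false × Nb X y ≡ true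
        blocking {y} {X} (Ry , Sy , Γvy) p q lt = (p , q , tight) , v∉X , y∈Nb
          where
          open ≤-Reasoning
          pt : ∀ x → ⟦ Nb X x ∧ not (S x) ⟧ ≤ ⟦ Nb X x ∧ not (S⁺ y x) ⟧ + ⟦ y == x ⟧
          pt x with Nb X x | S x | y == x
          ... | false | _     | _     = z≤n
          ... | true  | true  | _     = z≤n
          ... | true  | false | true  = ≤-refl
          ... | true  | false | false = ≤-refl
          free≤ : free S X ≤ suc (free (S⁺ y) X)
          free≤ = begin
            free S X                          ≤⟨ ∑-mono pt ⟩
            ∑ (λ x → ⟦ Nb X x ∧ not (S⁺ y x) ⟧ + ⟦ y == x ⟧) ≡⟨ Σl-+ (allFin N) _ _ ⟩
            free (S⁺ y) X + # (y ==_)         ≡⟨ cong (free (S⁺ y) X +_) (#-δ y) ⟩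
            free (S⁺ y) X + 1                 ≡⟨ +-comm _ 1 ⟩
            suc (free (S⁺ y) X)               ∎
          w≤ : weight dem⁻ X ≤ weight dem X
          w≤ = weight-mono X (λ x → m∸n≤m (dem x) ⟦ v == x ⟧)
          tight : free S X ≤ weight dem X
          tight = ≤-trans free≤ (≤-trans lt w≤)
          v∉X : X v ≡ false
          v∉X with X v in Xv
          ... | false = refl
          ... | true  = ⊥-elim (<-irrefl refl (begin-strict
                weight dem⁻ X <⟨ weight-gain {X = X} {Y = X} gain ⟩
                weight dem X  ≤⟨ inv X p q ⟩
                free S X      ≤⟨ free≤ ⟩
                suc (free (S⁺ y) X) ≤⟨ lt ⟩
                weight dem⁻ X ∎))
            where
            gain : ∀ x → ⟦ X x ⟧ * dem⁻ x + ⟦ v == x ⟧ ≤ ⟦ X x ⟧ * dem x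
            gain x with v ≟ x
            ... | no _     = ≤-reflexive (+-identityʳ _)
            ... | yes refl rewrite Xv = ≤-reflexive (trans (cong (_+ 1) (+-identityʳ _)) (trans (m∸n+n≡m 1≤dem) (sym (+-identityʳ _))))
          y∈Nb : Nb X y ≡ true
          y∈Nb with Nb X y in eq
          ... | true  = refl
          ... | false = ⊥-elim (<-irrefl refl (begin-strict
                free S X            ≤⟨ #-mono stays ⟩
                free (S⁺ y) X       <⟨ lt ⟩
                weight dem⁻ X       ≤⟨ w≤ ⟩
                weight dem X        ≤⟨ inv X p q ⟩
                free S X            ∎))
            where
            stays : ∀ x → Nb X x ∧ not (S x) ≡ true → Nb X x ∧ not (S⁺ y x) ≡ true
            stays x h with y ≟ x
            ... | yes refl = ⊥-elim (true≢false (∧-fst h) eq)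
            ... | no _ with S x
            ...   | false = h
            ...   | true  = h

        -- If every candidate is blocked, the blocking sets unite by `tight-∪` to one tight set that
        -- misses `v` but has all candidates as neighbours.
        cover : ∀ ys → (∃[ y ] (Candidate y × Extendable (S⁺ y) dem⁻)) ⊎
                       (∃[ X ] (Tight X × X v ≡ false × (∀ {y} → y ∈ ys → Candidate y → Nb X y ≡ true)))
        cover [] = inj₂ ((λ _ → false) , tight-∅ , refl , λ ())
        cover (y ∷ ys) with cover ys
        ... | inj₁ r = inj₁ r
        ... | inj₂ (X , tX , Xv , cov) with candidate? y
        ...   | no ¬c = inj₂ (X , tX , Xv , λ { (here refl) c → ⊥-elim (¬c c) ; (there i) c → cov i c })
        ...   | yes c with extendable? (S⁺ y) dem⁻
        ...     | inj₂ e = inj₁ (y , c , e)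
        ...     | inj₁ (Y , p , q , lt) with blocking c p q lt
        ...       | tY , Yv , nY =
          inj₂ ((λ x → X x ∨ Y x) , tight-∪ tX tY , trans (cong (_∨ Y v) Xv) Yv ,
                λ { (here refl) _ → Nb-mono (λ x → ∨-introʳ (X x)) y nY
                  ; (there i) c′ → Nb-mono (λ x → ∨-introˡ (Y x)) _ (cov i c′) })

        -- Adding `v` to the tight set of `cover` yields no new free neighbour, since all candidates
        -- are neighbours already, yet it adds `dem v ≥ 1` to the weight. This contradicts the
        -- invariant at the enlarged set.
        extend : ∃[ y ] (Candidate y × Extendable (S⁺ y) dem⁻)
        extend with cover (allFin N)
        ... | inj₁ r = r
        ... | inj₂ (X , tX@(p , q , tight) , Xv , cov) = ⊥-elim (<-irrefl refl (begin-strict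
            weight dem X   <⟨ weight-gain {X = X} {Y = X⁺} gain ⟩
            weight dem X⁺  ≤⟨ inv X⁺ X⁺⊆R (≤-trans (#-insert X v) (≤-trans (s≤s (tight-small tX)) (≤-trans S<n (m≤m+n n _)))) ⟩
            free S X⁺      ≤⟨ #-mono back ⟩
            free S X       ≤⟨ tight ⟩
            weight dem X   ∎))
          where
          open ≤-Reasoning
          X⁺ : Fin N → Bool
          X⁺ x = X x ∨ (v == x)
          X⁺⊆R : X⁺ ⊆ᵇ R
          X⁺⊆R x h with ∨-elim {X x} h
          ... | inj₁ Xx = p x Xx
          ... | inj₂ e  = subst (λ z → R z ≡ true) (==⇒≡ e) Rv
          gain : ∀ x → ⟦ X x ⟧ * dem x + ⟦ v == x ⟧ ≤ ⟦ X⁺ x ⟧ * dem x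
          gain x with v ≟ x
          ... | yes refl rewrite Xv = ≤-trans 1≤dem (m≤m+n _ 0)
          ... | no _ with X x
          ...   | true  = ≤-reflexive (+-identityʳ _)
          ...   | false = z≤n
          back : ∀ y → Nb X⁺ y ∧ not (S y) ≡ true → Nb X y ∧ not (S y) ≡ true
          back y h with Nb-elim X⁺ (∧-fst h)
          ... | x , X⁺x , Γxy with ∨-elim {X x} X⁺x
          ...   | inj₁ Xx = ∧-intro (Nb-intro X (∧-fst (∧-fst h)) Xx Γxy) (∧-snd {Nb X⁺ y} h)
          ...   | inj₂ e  = ∧-intro (cov (∈-allFin y) (∧-fst (∧-fst h) , not-true (∧-snd {Nb X⁺ y} h) ,
                                       subst (λ z → Γ z y ≡ true) (sym (==⇒≡ e)) Γxy)) (∧-snd {Nb X⁺ y} h)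

if-true : ∀ {A : Set} {b} {x y : A} → b ≡ true → (if b then x else y) ≡ x
if-true refl = refl

if-false : ∀ {A : Set} {b} {x y : A} → b ≡ false → (if b then x else y) ≡ y
if-false refl = refl

module Embedding {N : ℕ} (Γ : Fin N → Fin N → Bool) (R : Fin N → Bool) (D n : ℕ)
                 (expanding : ∀ X → ¬ Expander.NonExpanding Γ R D n X) (T : RootedTree n D) where

  open Expander Γ R D n
  open RootedTree T

  child : Fin n → Fin n → Bool
  child w v = not (root == v) ∧ (par v == w)

  record Partial (E : Fin n → Bool) : Set where
    field
      f       : Fin n → Fin N
      S       : Fin N → Bool
      dem     : Fin N → ℕ
      root∈   : E root ≡ true
      inj     : ∀ {u v} → E u ≡ true → E v ≡ true → f u ≡ f v → u ≡ v
      f∈R     : ∀ {v} → E v ≡ true → R (f v) ≡ true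
      f∈S     : ∀ {v} → E v ≡ true → S (f v) ≡ true
      S≤E     : # S ≤ # E
      inv     : Extendable S dem
      dem≤D   : ∀ x → dem x ≤ D
      D≤dem   : ∀ {x} → S x ≡ false → D ≤ dem x
      pending : ∀ {v} → E v ≡ true → # (λ u → child v u ∧ not (E u)) ≤ dem (f v)
      edge    : ∀ {u} → E u ≡ true → u ≢ root → E (par u) ≡ true × Γ (f (par u)) (f u) ≡ true

  start : (x₀ : Fin N) → R x₀ ≡ true → Partial (root ==_)
  start x₀ Rx₀ = record
    { f       = λ _ → x₀
    ; S       = x₀ ==_
    ; dem     = λ _ → D
    ; root∈   = ==-refl root
    ; inj     = λ p q _ → trans (sym (==⇒≡ {x = root} p)) (==⇒≡ {x = root} q)
    ; f∈R     = λ _ → Rx₀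
    ; f∈S     = λ _ → ==-refl x₀
    ; S≤E     = ≤-reflexive (trans (#-δ x₀) (sym (#-δ root)))
    ; inv     = inv₀
    ; dem≤D   = λ _ → ≤-refl
    ; D≤dem   = λ _ → ≤-refl
    ; pending = λ {v} _ → ≤-trans (#-mono {P = λ u → child v u ∧ not (root == u)} {Q = child v} (λ x → ∧-fst {child v x})) (children v)
    ; edge    = λ p q → ⊥-elim (q (sym (==⇒≡ p)))
    }
    where
    open ≤-Reasoning
    inv₀ : Extendable (x₀ ==_) (λ _ → D)
    inv₀ X p q = ≤-trans (≤-reflexive (trans (Σl-* (allFin N) (λ x → ⟦ X x ⟧) D) (*-comm (# X) D))) (bound (# X) refl)
      where
      bound : ∀ k → # X ≡ k → D * # X ≤ free (x₀ ==_) X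
      bound zero    eq = ≤-trans (≤-reflexive (trans (cong (D *_) eq) (*-zeroʳ D))) z≤n
      -- The surplus `# X` of the expansion over `D * # X` pays for the one used vertex `x₀`; the
      -- empty set has no surplus and is treated apart.
      bound (suc k) eq = +-cancelˡ-≤ 1 _ _ (begin
        1 + D * # X                                   ≤⟨ +-monoˡ-≤ (D * # X) (subst (1 ≤_) (sym eq) (s≤s z≤n)) ⟩
        # X + D * # X                                 ≤⟨ expand expanding X p (subst (0 <_) (sym eq) z<s) q ⟩
        # (Nb X)                                      ≡⟨ #-split (Nb X) (x₀ ==_) ⟩
        # (λ y → Nb X y ∧ (x₀ == y)) + free (x₀ ==_) X ≤⟨ +-monoˡ-≤ _ (#-mono {Q = x₀ ==_} (λ y → ∧-snd {Nb X y})) ⟩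
        # (x₀ ==_) + free (x₀ ==_) X                  ≡⟨ cong (_+ free (x₀ ==_) X) (#-δ x₀) ⟩
        1 + free (x₀ ==_) X                           ∎)

  attach : ∀ {E} (P : Partial E) (u : Fin n) → E u ≡ false → E (par u) ≡ true → child (par u) u ≡ true →
           (y : Fin N) → R y ≡ true → Partial.S P y ≡ false → Γ (Partial.f P (par u)) y ≡ true →
           Extendable (λ x → Partial.S P x ∨ (y == x)) (λ x → Partial.dem P x ∸ ⟦ Partial.f P (par u) == x ⟧) →
           Partial (λ x → E x ∨ (u == x))
  attach {E} P u Eu Ep u-child y Ry Sy Γy inv⁺ = record
    { f       = f⁺
    ; S       = S′
    ; dem     = dem′
    ; root∈   = ∨-introˡ _ root∈
    ; inj     = inj⁺
    ; f∈R     = f∈R⁺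
    ; f∈S     = f∈S⁺
    ; S≤E     = ≤-trans (#-insert S y) (≤-trans (s≤s S≤E) (#-insert-new E Eu))
    ; inv     = inv⁺
    ; dem≤D   = λ x → ≤-trans (m∸n≤m (dem x) ⟦ p == x ⟧) (dem≤D x)
    ; D≤dem   = D≤dem⁺
    ; pending = pending⁺
    ; edge    = edge⁺
    }
    where
    open Partial P
    p : Fin N
    p = f (par u)
    S′ : Fin N → Bool
    S′ x = S x ∨ (y == x)
    dem′ : Fin N → ℕ
    dem′ x = dem x ∸ ⟦ p == x ⟧
    f⁺ : Fin n → Fin N
    f⁺ x = if u == x then y else f x
    f⁺-new : f⁺ u ≡ y
    f⁺-new = if-true (==-refl u)
    f⁺-old : ∀ {v} → E v ≡ true → f⁺ v ≡ f v
    f⁺-old Ev = if-false (≢⇒== {x = u} (λ { refl → true≢false Ev Eu }))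
    cases : ∀ {v} → E v ∨ (u == v) ≡ true → (E v ≡ true) ⊎ (u ≡ v)
    cases {v} h with ∨-elim {E v} h
    ... | inj₁ Ev = inj₁ Ev
    ... | inj₂ e  = inj₂ (==⇒≡ e)
    f≢y : ∀ {v} → E v ≡ true → f v ≢ y
    f≢y Ev e = true≢false (f∈S Ev) (subst (λ z → S z ≡ false) (sym e) Sy)
    inj⁺ : ∀ {v w} → E v ∨ (u == v) ≡ true → E w ∨ (u == w) ≡ true → f⁺ v ≡ f⁺ w → v ≡ w
    inj⁺ hv hw e with cases hv | cases hw
    ... | inj₁ Ev   | inj₁ Ew   = inj Ev Ew (trans (sym (f⁺-old Ev)) (trans e (f⁺-old Ew)))
    ... | inj₂ refl | inj₂ refl = refl
    ... | inj₁ Ev   | inj₂ refl = ⊥-elim (f≢y Ev (trans (sym (f⁺-old Ev)) (trans e f⁺-new)))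
    ... | inj₂ refl | inj₁ Ew   = ⊥-elim (f≢y Ew (trans (sym (f⁺-old Ew)) (trans (sym e) f⁺-new)))
    f∈R⁺ : ∀ {v} → E v ∨ (u == v) ≡ true → R (f⁺ v) ≡ true
    f∈R⁺ h with cases h
    ... | inj₁ Ev   = subst (λ z → R z ≡ true) (sym (f⁺-old Ev)) (f∈R Ev)
    ... | inj₂ refl = subst (λ z → R z ≡ true) (sym f⁺-new) Ry
    f∈S⁺ : ∀ {v} → E v ∨ (u == v) ≡ true → S′ (f⁺ v) ≡ true
    f∈S⁺ h with cases h
    ... | inj₁ Ev   = subst (λ z → S′ z ≡ true) (sym (f⁺-old Ev)) (∨-introˡ _ (f∈S Ev))
    ... | inj₂ refl = subst (λ z → S′ z ≡ true) (sym f⁺-new) (∨-introʳ (S y) (==-refl y))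
    dem′-≢ : ∀ {x} → p ≢ x → dem′ x ≡ dem x
    dem′-≢ {x} ne = cong (λ b → dem x ∸ ⟦ b ⟧) (≢⇒== ne)
    D≤dem⁺ : ∀ {x} → S′ x ≡ false → D ≤ dem′ x
    D≤dem⁺ {x} h = ≤-trans (D≤dem Sx) (≤-reflexive (sym (dem′-≢ (λ e → true≢false (f∈S Ep) (subst (λ z → S z ≡ false) (sym e) Sx)))))
      where
      Sx : S x ≡ false
      Sx with S x
      ... | false = refl
      Sx | true = h
    pending⁺ : ∀ {v} → E v ∨ (u == v) ≡ true → # (λ x → child v x ∧ not (E x ∨ (u == x))) ≤ dem′ (f⁺ v)
    pending⁺ {v} h with cases h
    ... | inj₂ refl = subst (λ z → _ ≤ dem′ z) (sym f⁺-new)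
          (≤-trans (#-mono {Q = child u} (λ x → ∧-fst)) (≤-trans (children u)
            (≤-trans (D≤dem Sy) (≤-reflexive (sym (dem′-≢ (λ e → f≢y Ep e)))))))
    ... | inj₁ Ev with v ≟ par u
    ...   | no ne = subst (λ z → _ ≤ dem′ z) (sym (f⁺-old Ev))
          (≤-trans (#-mono mono) (≤-trans (pending Ev) (≤-reflexive (sym (dem′-≢ (λ e → ne (inj Ev Ep (sym e))))))))
      where
      mono : ∀ x → child v x ∧ not (E x ∨ (u == x)) ≡ true → child v x ∧ not (E x) ≡ true
      mono x q with E x
      ... | false = ∧-intro (∧-fst q) refl
      ... | true  = q
    ...   | yes refl = subst (λ z → _ ≤ dem′ z) (sym (f⁺-old Ev))
          (subst (λ b → _ ≤ dem p ∸ ⟦ b ⟧) (sym (==-refl p)) (m+n≤o⇒m≤o∸n _ spent))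
      where
      open ≤-Reasoning
      pt : ∀ x → ⟦ child v x ∧ not (E x ∨ (u == x)) ⟧ + ⟦ u == x ⟧ ≤ ⟦ child v x ∧ not (E x) ⟧
      pt x with u ≟ x
      ... | yes refl rewrite Eu | u-child = ≤-refl
      ... | no _ with E x
      ...   | true  = ≤-reflexive (+-identityʳ _)
      ...   | false = ≤-reflexive (+-identityʳ _)
      spent : # (λ x → child v x ∧ not (E x ∨ (u == x))) + 1 ≤ dem p
      spent = begin
        # (λ x → child v x ∧ not (E x ∨ (u == x))) + 1          ≡⟨ cong (# (λ x → child v x ∧ not (E x ∨ (u == x))) +_) (sym (#-δ u)) ⟩
        # (λ x → child v x ∧ not (E x ∨ (u == x))) + # (u ==_)  ≡⟨ sym (Σl-+ (allFin n) _ _) ⟩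
        ∑ (λ x → ⟦ child v x ∧ not (E x ∨ (u == x)) ⟧ + ⟦ u == x ⟧) ≤⟨ ∑-mono pt ⟩
        # (λ x → child v x ∧ not (E x))                         ≤⟨ pending Ev ⟩
        dem p                                                   ∎
    edge⁺ : ∀ {v} → E v ∨ (u == v) ≡ true → v ≢ root →
            (E (par v) ∨ (u == par v) ≡ true) × (Γ (f⁺ (par v)) (f⁺ v) ≡ true)
    edge⁺ h ne with cases h
    ... | inj₁ Ev = let (q , r) = edge Ev ne in ∨-introˡ _ q , subst₂ (λ a b → Γ a b ≡ true) (sym (f⁺-old q)) (sym (f⁺-old Ev)) r
    ... | inj₂ refl = ∨-introˡ _ Ep , subst₂ (λ a b → Γ a b ≡ true) (sym (f⁺-old Ep)) (sym f⁺-new) Γy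

  grow : ∀ {E} → Partial E → (u : Fin n) → E u ≡ false → E (par u) ≡ true → Partial (λ x → E x ∨ (u == x))
  grow {E} P u Eu Ep =
    let (y , (Ry , Sy , Γy) , inv⁺) =
          Step.extend expanding S dem inv dem≤D (≤-<-trans S≤E (#-missing E Eu)) (f (par u)) (f∈R Ep)
            (≤-trans (#-∈ (λ x → child (par u) x ∧ not (E x)) (∧-intro u-child (cong not Eu))) (pending Ep))
    in attach P u Eu Ep u-child y Ry Sy Γy inv⁺
    where
    open Partial P
    u-child : child (par u) u ≡ true
    u-child = ∧-intro (cong not (≢⇒== {x = root} {u} (λ { refl → true≢false root∈ Eu }))) (==-refl (par u))

  -- Climbing from `u` towards the embedded root must enter `E`; the last vertex before that is the
  -- one sought. The bound `k` on the depth makes the climb terminate.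
  frontier : ∀ {E : Fin n → Bool} → E root ≡ true → ∀ k u → dep u ≤ k → E u ≡ false → ∃[ w ] (E w ≡ false × E (par w) ≡ true)
  frontier {E} Er k u d Eu with u ≟ root
  ... | yes refl = ⊥-elim (true≢false Er Eu)
  frontier {E} Er k u d Eu | no ne with E (par u) in eq
  ... | true = u , Eu , eq
  frontier {E} Er zero    u d Eu | no ne | false = ⊥-elim (n≮0 (<-≤-trans (dep-par ne) d))
  frontier {E} Er (suc k) u d Eu | no ne | false = frontier Er k (par u) (s≤s⁻¹ (≤-trans (dep-par ne) d)) eq

  complete : ∀ k {E} → Partial E → n ≤ # E + k → ∃[ E′ ] (Partial E′ × (∀ v → E′ v ≡ true))
  complete k {E} P h with bool? (some (λ v → not (E v)))
  ... | inj₂ full = E , P , λ v → not-injective (none (λ v → not (E v)) full v)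
  complete zero {E} P h | inj₁ miss =
    ⊥-elim (<-irrefl refl (≤-trans (#-missing E (not-true (proj₂ (some-elim (λ v → not (E v)) miss)))) (≤-trans h (≤-reflexive (+-identityʳ _)))))
  complete (suc k) {E} P h | inj₁ miss =
    let (u , Eu) = some-elim (λ v → not (E v)) miss
        (w , Ew , Epw) = frontier (Partial.root∈ P) (dep u) u ≤-refl (not-true Eu)
    in complete k (grow P w Ew Epw)
         (≤-trans h (≤-trans (≤-reflexive (+-suc (# E) k)) (+-monoˡ-≤ k (#-insert-new E Ew))))

  embed : (x₀ : Fin N) → R x₀ ≡ true →
          Σ (Fin n → Fin N) (λ f → (∀ {u v : Fin n} → f u ≡ f v → u ≡ v) × (∀ v → R (f v) ≡ true) ×
                  (∀ {v} → v ≢ root → Γ (f (par v)) (f v) ≡ true))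
  embed x₀ Rx₀ =
    let (E , P , all) = complete n (start x₀ Rx₀) (m≤n+m n _)
        open Partial P
    in f , (λ {u} {v} → inj (all u) (all v)) , (λ v → f∈R (all v)) , (λ {v} ne → proj₂ (edge (all v) ne))

-- Peeling off non-expanding sets

TreeIn : ∀ {N} → (Fin N → Fin N → Bool) → (Fin N → Bool) → ∀ {n D} → RootedTree n D → Set
TreeIn {N} Γ W {n} T =
  Σ (Fin n → Fin N) (λ f → (∀ {u v : Fin n} → f u ≡ f v → u ≡ v) × (∀ v → W (f v) ≡ true) ×
          (∀ {v} → v ≢ RootedTree.root T → Γ (f (RootedTree.par T v)) (f v) ≡ true))

module Peeling {N : ℕ} (Γ : Fin N → Fin N → Bool) {n D : ℕ} (T : RootedTree n D) where

  Separated : (Fin N → Bool) → (Fin N → Bool) → Set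
  Separated X Y = ∀ {x y} → X x ≡ true → Y y ≡ true → Γ x y ≡ false

  -- `X` collects non-expanding sets, and `R` is what remains when these and their neighbours are
  -- deleted. Moving `Y` to `X` deletes at most `(2 + D) * # Y` vertices, namely `Y` and fewer than
  -- `suc D * # Y` neighbours, and it overshoots `b` by at most `2 * n`. If at some stage all sets
  -- expand, `R` is nonempty by the size of `W`, and the tree embeds into it.
  peelOff : ∀ (W : Fin N → Bool) b → (2 + D) * b < # W → ∀ k X R → R ⊆ᵇ W → X ⊆ᵇ W → Separated X R → (∀ {x} → X x ≡ true → R x ≡ false) →
            # W ≤ # R + (2 + D) * # X → # X ≤ b + 2 * n → b ≤ # X + k →
            TreeIn Γ W T ⊎
            (Σ (Fin N → Bool) (λ X′ → Σ (Fin N → Bool) λ R′ → X′ ⊆ᵇ W × R′ ⊆ᵇ W × Separated X′ R′ × b ≤ # X′ × # W ≤ # R′ + (2 + D) * (b + 2 * n)))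
  peelOff W b big k X R R⊆W X⊆W sep disj cover small h with b ≤? # X
  ... | yes b≤X = inj₂ (X , R , X⊆W , R⊆W , sep , b≤X , ≤-trans cover (+-monoʳ-≤ (# R) (*-monoʳ-≤ (2 + D) small)))
  peelOff W b big zero    X R R⊆W X⊆W sep disj cover small h | no b≰X = ⊥-elim (b≰X (≤-trans h (≤-reflexive (+-identityʳ _))))
  peelOff W b big (suc k) X R R⊆W X⊆W sep disj cover small h | no b≰X with Expander.nonExpanding? Γ R D n
  ... | inj₂ expanding =
    let (x₀ , Rx₀) = #-pos R (+-cancelʳ-< ((2 + D) * # X) 0 (# R)
                        (≤-<-trans (*-monoʳ-≤ (2 + D) (<⇒≤ (≰⇒> b≰X))) (<-≤-trans big cover)))
        (f , inj , f∈ , edge) = Embedding.embed Γ R D n expanding T x₀ Rx₀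
    in inj₁ (f , inj , (λ v → R⊆W (f v) (f∈ v)) , edge)
  ... | inj₁ (Y , Y⊆R , 0<Y , Y≤2n , Nb<) =
    peelOff W b big k X⁺ R⁻ (λ x p → R⊆W x (∧-fst p)) X⁺⊆W sep⁺ disj⁺ cover⁺
      (≤-trans (#-∨ X Y) (+-mono-≤ (<⇒≤ (≰⇒> b≰X)) Y≤2n))
      (≤-trans h (≤-trans (≤-reflexive (+-suc (# X) k)) (+-monoˡ-≤ k X<X⁺)))
    where
    open ≤-Reasoning
    open Expander Γ R D n using (Nb; Nb-intro)
    X⁺ R⁻ : Fin N → Bool
    X⁺ x = X x ∨ Y x
    R⁻ x = R x ∧ not (Y x ∨ Nb Y x)
    X⁺⊆W : X⁺ ⊆ᵇ W
    X⁺⊆W x p with ∨-elim {X x} p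
    ... | inj₁ q = X⊆W x q
    ... | inj₂ q = R⊆W x (Y⊆R x q)
    sep⁺ : Separated X⁺ R⁻
    sep⁺ {x} {y} p q with ∨-elim {X x} p
    ... | inj₁ Xx = sep Xx (∧-fst q)
    ... | inj₂ Yx with Γ x y in eq
    ...   | false = refl
    ...   | true  = ⊥-elim (true≢false (∨-introʳ (Y y) (Nb-intro Y (∧-fst q) Yx eq)) (not-true (∧-snd {R y} q)))
    X∧Y : ∀ x → X x ≡ true → Y x ≡ false
    X∧Y x p with Y x in eq
    ... | false = refl
    ... | true  = ⊥-elim (true≢false (Y⊆R x eq) (disj p))
    #X⁺ : # X⁺ ≡ # X + # Y
    #X⁺ = trans (Σl-cong (allFin N) (λ x → aux (X x) (Y x) (X∧Y x))) (Σl-+ (allFin N) _ _)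
      where
      aux : ∀ p q → (p ≡ true → q ≡ false) → ⟦ p ∨ q ⟧ ≡ ⟦ p ⟧ + ⟦ q ⟧
      aux true  q h rewrite h refl = refl
      aux false q _ = refl
    disj⁺ : ∀ {x} → X⁺ x ≡ true → R⁻ x ≡ false
    disj⁺ {x} p with ∨-elim {X x} p
    ... | inj₁ Xx rewrite disj Xx = refl
    ... | inj₂ Yx rewrite Yx = Boolₚ.∧-zeroʳ (R x)
    X<X⁺ : suc (# X) ≤ # X⁺
    X<X⁺ = ≤-trans (≤-reflexive (+-comm 1 (# X))) (≤-trans (+-monoʳ-≤ (# X) 0<Y) (≤-reflexive (sym #X⁺)))
    cover⁺ : # W ≤ # R⁻ + (2 + D) * # X⁺
    cover⁺ = begin
      # W                                                          ≤⟨ cover ⟩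
      # R + (2 + D) * # X                                          ≡⟨ cong (_+ (2 + D) * # X) (#-split R (λ x → Y x ∨ Nb Y x)) ⟩
      # (λ x → R x ∧ (Y x ∨ Nb Y x)) + # R⁻ + (2 + D) * # X        ≤⟨ +-monoˡ-≤ _ (+-monoˡ-≤ (# R⁻) (≤-trans (#-mono {Q = λ x → Y x ∨ Nb Y x} (λ x → ∧-snd {R x})) (≤-trans (#-∨ Y (Nb Y)) (+-monoʳ-≤ (# Y) (<⇒≤ Nb<))))) ⟩
      (2 + D) * # Y + # R⁻ + (2 + D) * # X                         ≡⟨ rearrange (2 + D) (# Y) (# R⁻) (# X) ⟩
      # R⁻ + (2 + D) * (# X + # Y)                                 ≡⟨ cong (λ k → # R⁻ + (2 + D) * k) (sym #X⁺) ⟩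
      # R⁻ + (2 + D) * # X⁺                                        ∎
      where
      rearrange : ∀ d y r x → d * y + r + d * x ≡ r + d * (x + y)
      rearrange = solve-∀

  peelOne : ∀ (W : Fin N → Bool) b → (2 + D) * b < # W → TreeIn Γ W T ⊎
            (Σ (Fin N → Bool) (λ X → Σ (Fin N → Bool) λ R → X ⊆ᵇ W × R ⊆ᵇ W × Separated X R × b ≤ # X × # W ≤ # R + (2 + D) * (b + 2 * n)))
  peelOne W b big = peelOff W b big b (λ _ → false) W (λ _ p → p) (λ _ ()) (λ ()) (λ ())
    (≤-reflexive (trans (sym (+-identityʳ (# W))) (cong (# W +_) (sym (trans (cong ((2 + D) *_) (Σl-0 (allFin N))) (*-zeroʳ (2 + D)))))))
    (≤-trans (≤-reflexive (Σl-0 (allFin N))) z≤n) (m≤n+m b _)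

  -- Later sets are taken from the remainder of earlier ones. `Separated` excludes edges from the
  -- earlier set to the later one, and the order of `i` and `j` is open; hence the disjunction.
  peel : ∀ q (W : Fin N → Bool) b → q * ((2 + D) * (b + 2 * n)) < # W → TreeIn Γ W T ⊎
         (Σ (Fin q → Fin N → Bool) (λ X → (∀ (i : Fin q) → X i ⊆ᵇ W) × (∀ i → b ≤ # (X i)) ×
                  (∀ {i j} → i ≢ j → ∀ {x y} → X i x ≡ true → X j y ≡ true → Γ x y ≡ false ⊎ Γ y x ≡ false)))
  peel zero    W b big = inj₂ ((λ ()) , (λ ()) , (λ ()) , (λ { {()} }))
  peel (suc q) W b big with peelOne W b (≤-<-trans (≤-trans (*-monoʳ-≤ (2 + D) (m≤m+n b (2 * n))) (m≤m+n _ (q * ((2 + D) * (b + 2 * n))))) big)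
  ... | inj₁ t = inj₁ t
  ... | inj₂ (X , R , X⊆ , R⊆ , sep , b≤ , W≤) with peel q R b (+-cancelˡ-< c _ _ (<-≤-trans big (≤-trans W≤ (≤-reflexive (+-comm (# R) c)))))
    where c = (2 + D) * (b + 2 * n)
  ...   | inj₁ (f , inj , f∈ , edge) = inj₁ (f , inj , (λ v → R⊆ (f v) (f∈ v)) , edge)
  ...   | inj₂ (Xs , Xs⊆ , b≤s , seps) = inj₂ (Xs⁺ , sub , size , sep⁺)
    where
    Xs⁺ : Fin (suc q) → Fin N → Bool
    Xs⁺ zero    = X
    Xs⁺ (suc i) = Xs i
    sub : ∀ i → Xs⁺ i ⊆ᵇ W
    sub zero    = X⊆
    sub (suc i) x p = R⊆ x (Xs⊆ i x p)
    size : ∀ i → b ≤ # (Xs⁺ i)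
    size zero    = b≤
    size (suc i) = b≤s i
    sep⁺ : ∀ {i j} → i ≢ j → ∀ {x y} → Xs⁺ i x ≡ true → Xs⁺ j y ≡ true → Γ x y ≡ false ⊎ Γ y x ≡ false
    sep⁺ {zero}  {zero}  ne _ _ = ⊥-elim (ne refl)
    sep⁺ {zero}  {suc j} _ {y = y} p q = inj₁ (sep p (Xs⊆ j y q))
    sep⁺ {suc i} {zero}  _ {x = x} p q = inj₂ (sep q (Xs⊆ i x p))
    sep⁺ {suc i} {suc j} ne p q = seps (λ e → ne (cong suc e)) p q

AllPairs-resp-⊆ : ∀ {R : A → A → Set} {xs ys : List A} → xs ⊆ ys → AllPairs R ys → AllPairs R xs
AllPairs-resp-⊆ []        _        = []
AllPairs-resp-⊆ (y ∷ʳ s)  (_ ∷ ps) = AllPairs-resp-⊆ s ps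
AllPairs-resp-⊆ (refl ∷ s) (p ∷ ps) = All-resp-⊆ s p ∷ AllPairs-resp-⊆ s ps

[]⊆ : (xs : List A) → [] ⊆ xs
[]⊆ []       = []
[]⊆ (x ∷ xs) = x ∷ʳ []⊆ xs

sublist-of-length : ∀ k (xs : List A) → k ≤ length xs → ∃[ ys ] (ys ⊆ xs × length ys ≡ k)
sublist-of-length zero    xs       _ = [] , []⊆ xs , refl
sublist-of-length (suc k) (x ∷ xs) h =
  let (ys , s , e) = sublist-of-length k xs (s≤s⁻¹ h) in x ∷ ys , refl ∷ s , cong suc e

-- Ramsey-type statements for lists

bisect : ∀ {P Q : A → Set} {xs : List A} → All (λ x → P x ⊎ Q x) xs →
         ∃[ ys ] ∃[ zs ] (ys ⊆ xs × zs ⊆ xs × All P ys × All Q zs × length xs ≤ length ys + length zs)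
bisect [] = [] , [] , [] , [] , [] , [] , z≤n
bisect (_∷_ {x} d ds) with bisect ds
... | ys , zs , s , t , ps , qs , h with d
...   | inj₁ p = x ∷ ys , zs , refl ∷ s , x ∷ʳ t , p ∷ ps , qs , s≤s h
...   | inj₂ q = ys , x ∷ zs , x ∷ʳ s , refl ∷ t , ps , q ∷ qs , ≤-trans (s≤s h) (≤-reflexive (sym (+-suc (length ys) (length zs))))

half : ∀ x {p q} → 2 * x ≤ p + q → x ≤ p ⊎ x ≤ q
half x {p} {q} h with x ≤? p
... | yes a = inj₁ a
... | no ¬a with x ≤? q
...   | yes b = inj₂ b
...   | no ¬b = ⊥-elim (<-irrefl refl (<-≤-trans (+-mono-< (≰⇒> ¬a) (≰⇒> ¬b)) (≤-trans (≤-reflexive (cong (x +_) (sym (+-identityʳ x)))) h)))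

majority : ∀ {Q : Bool → A → Set} {xs : List A} x → All (λ a → ∃[ t ] Q t a) xs → 2 * x ≤ length xs →
           ∃[ t ] ∃[ ys ] (ys ⊆ xs × x ≤ length ys × All (Q t) ys)
majority {Q = Q} x h le with bisect (All.map sides h)
  where
  sides : ∀ {a} → ∃[ t ] Q t a → Q true a ⊎ Q false a
  sides (true  , q) = inj₁ q
  sides (false , q) = inj₂ q
... | ys , zs , s , t , ps , qs , len with half x (≤-trans le len)
...   | inj₁ p = true  , ys , s , p , ps
...   | inj₂ p = false , zs , t , p , qs

pigeonhole : ∀ {s} (f : A → Fin s) a (cs : List (Fin s)) {xs : List A} → All (λ x → f x ∈ cs) xs →
             length cs * a < length xs →
             ∃[ i ] (i ∈ cs × ∃[ ys ] (ys ⊆ xs × a < length ys × All (λ y → f y ≡ i) ys))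
pigeonhole f a []       {x ∷ xs} (() ∷ _) _
pigeonhole f a (i ∷ cs) {xs} h lt with bisect {P = λ x → f x ≡ i} {Q = λ x → f x ∈ cs} (All.map (λ { (here e) → inj₁ e ; (there p) → inj₂ p }) h)
... | ys , zs , s , t , ps , qs , len with suc a ≤? length ys
...   | yes p = i , here refl , ys , s , p , ps
...   | no ¬p =
  let (j , j∈ , ws , u , k , rs) = pigeonhole f a cs qs
        (+-cancelˡ-< a _ _ (<-≤-trans lt (≤-trans len (+-monoˡ-≤ (length zs) (s≤s⁻¹ (≰⇒> ¬p))))))
  in j , there j∈ , ws , ⊆-trans u t , k , rs

-- One entry starts the chain, and `ℓ * chainLength ℓ m + 1` further entries make `pigeonhole` leave
-- more than `chainLength ℓ m` of a single colour.
chainLength : ℕ → ℕ → ℕ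
chainLength ℓ zero    = 0
chainLength ℓ (suc m) = 2 + ℓ * chainLength ℓ m

module _ {A : Set} {s : ℕ} (c : A → A → Fin s) (cs : List (Fin s)) (ℓ : ℕ) (cs≤ : length cs ≤ ℓ) where

  -- The colour of a pair in the chain depends only on its first element, which carries it.
  chain : ∀ m {xs} → AllPairs (λ x y → c x y ∈ cs) xs → chainLength ℓ m ≤ length xs →
          Σ (List (A × Fin s)) λ zs → length zs ≡ m × map proj₁ zs ⊆ xs × All (λ z → proj₂ z ∈ cs) zs ×
            AllPairs (λ p q → c (proj₁ p) (proj₁ q) ≡ proj₂ p) zs
  chain zero    {xs}     _        _ = [] , refl , []⊆ xs , [] , []
  chain (suc m) {x ∷ xs} (px ∷ ps) h =
    let (i , i∈ , ys , s , k , rs) = pigeonhole (c x) (chainLength ℓ m) cs px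
                                       (≤-trans (s≤s (*-monoˡ-≤ (chainLength ℓ m) cs≤)) (s≤s⁻¹ h))
        (zs , e , t , ms , qs) = chain m (AllPairs-resp-⊆ s ps) (<⇒≤ k)
    in (x , i) ∷ zs , cong suc e , refl ∷ ⊆-trans t s , i∈ ∷ ms , Allₚ.map⁻ (All-resp-⊆ t rs) ∷ qs

  -- More than `g` of the `ℓ * g + 1` entries of a chain carry the same colour, and every pair among
  -- them has the colour carried by its first element.
  ramsey : ∀ g {xs} → AllPairs (λ x y → c x y ∈ cs) xs → chainLength ℓ (suc (ℓ * g)) ≤ length xs →
           ∃[ i ] (i ∈ cs × ∃[ ks ] (ks ⊆ xs × g ≤ length ks × AllPairs (λ x y → c x y ≡ i) ks))
  ramsey g ps h =
    let (zs , e , s , ms , qs) = chain (suc (ℓ * g)) ps h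
        (i , i∈ , ws , t , k , rs) = pigeonhole proj₂ g cs ms
                                       (≤-trans (s≤s (*-monoˡ-≤ g cs≤)) (≤-reflexive (sym e)))
    in i , i∈ , map proj₁ ws , ⊆-trans (⊆-map proj₁ t) s ,
       ≤-trans (<⇒≤ k) (≤-reflexive (sym (length-map proj₁ ws))) ,
       AllPairsₚ.map⁺ (mono rs (AllPairs-resp-⊆ t qs))
    where
    mono : ∀ {i ws} → All (λ w → proj₂ w ≡ i) ws → AllPairs (λ p q → c (proj₁ p) (proj₁ q) ≡ proj₂ p) ws →
           AllPairs (λ p q → c (proj₁ p) (proj₁ q) ≡ i) ws
    mono []       []       = []
    mono (e ∷ es) (q ∷ qs) = All.map (λ p → trans p e) q ∷ mono es qs

module _ {A : Set} (P : A → A → Bool) where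

  -- Each row in turn keeps the majority half of `bs`, hence the factor `2 ^ length as`.
  constantRows : ∀ as {bs} y → 2 ^ length as * y ≤ length bs →
    ∃[ bs′ ] (bs′ ⊆ bs × y ≤ length bs′ × All (λ a → ∃[ t ] All (λ b → P a b ≡ t) bs′) as)
  constantRows []       {bs} y h = bs , ⊆-refl , ≤-trans (≤-reflexive (sym (+-identityʳ y))) h , []
  constantRows (a ∷ as) {bs} y h =
    let (t , bs₁ , s , k , ps) = majority {Q = λ t b → P a b ≡ t} (2 ^ length as * y)
                                   (All.universal (λ b → P a b , refl) bs)
                                   (≤-trans (≤-reflexive (sym (*-assoc 2 (2 ^ length as) y))) h)
        (bs₂ , s′ , k′ , qs) = constantRows as y k
    in bs₂ , ⊆-trans s′ s , k′ , (t , All-resp-⊆ s′ ps) ∷ qs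

  -- Cutting `as` to exactly `2 * x` rows bounds the exponent; once the rows are constant, half of
  -- them share their value.
  bipartite : ∀ {as bs} x y → 2 * x ≤ length as → 2 ^ (2 * x) * y ≤ length bs →
    ∃[ as′ ] ∃[ bs′ ] (as′ ⊆ as × bs′ ⊆ bs × x ≤ length as′ × y ≤ length bs′ ×
                       ∃[ t ] All (λ a → All (λ b → P a b ≡ t) bs′) as′)
  bipartite {as} {bs} x y ha hb =
    let (as₀ , s₀ , e) = sublist-of-length (2 * x) as ha
        (bs′ , s , k , rows) = constantRows as₀ y (≤-trans (≤-reflexive (cong (λ z → 2 ^ z * y) e)) hb)
        (t , as′ , s′ , k′ , ps) = majority x rows (≤-reflexive (sym e))
    in as′ , bs′ , ⊆-trans s′ s₀ , s , k′ , k , t , ps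

-- A list of length tower t j survives j homogenisation steps with more than t elements left.
tower : ℕ → ℕ → ℕ
tower t zero    = suc t
tower t (suc j) = 2 ^ (2 * tower t j) * tower t j

1≤tower : ∀ t j → 1 ≤ tower t j
1≤tower t zero    = s≤s z≤n
1≤tower t (suc j) = *-mono-≤ (m^n>0 2 (2 * tower t j)) (1≤tower t j)

tower-double : ∀ t j → 2 * tower t j ≤ tower t (suc j)
tower-double t j = *-monoˡ-≤ (tower t j) (^-monoʳ-≤ 2 {1} (≤-trans (1≤tower t j) (m≤m+n _ _)))

tower-mono : ∀ t {i j} → i ≤ j → tower t i ≤ tower t j
tower-mono t {i} i≤j = go (≤⇒≤′ i≤j)
  where
  go : ∀ {j} → i ≤′ j → tower t i ≤ tower t j
  go ≤′-refl           = ≤-refl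
  go (≤′-step {j} i≤j) = ≤-trans (go i≤j) (≤-trans (m≤m+n _ _) (tower-double t j))

module _ {A : Set} (P : A → A → Bool) (t : ℕ) where

  Homogeneous : List A → List A → Set
  Homogeneous as bs = ∃[ b ] (∀ {x y} → x ∈ as → y ∈ bs → P x y ≡ b)

  -- The list on the lower level supplies the rows, so the exponential loss in the number of rows is
  -- covered by one level of the other list.
  homogenise : ∀ i j {as bs} → tower t (suc i) ≤ length as → tower t (suc j) ≤ length bs →
    ∃[ as′ ] ∃[ bs′ ] (as′ ⊆ as × bs′ ⊆ bs × tower t i ≤ length as′ × tower t j ≤ length bs′ × Homogeneous as′ bs′)
  homogenise i j ha hb with ≤-total i j
  ... | inj₁ i≤j =
    let (as′ , bs′ , s , s′ , k , k′ , b , h) = bipartite P (tower t i) (tower t j)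
          (≤-trans (tower-double t i) ha)
          (≤-trans (*-monoˡ-≤ (tower t j) (^-monoʳ-≤ 2 (*-monoʳ-≤ 2 (tower-mono t i≤j)))) hb)
    in as′ , bs′ , s , s′ , k , k′ , b , λ x∈ y∈ → All.lookup (All.lookup h x∈) y∈
  ... | inj₂ j≤i =
    let (bs′ , as′ , s , s′ , k , k′ , b , h) = bipartite (λ y x → P x y) (tower t j) (tower t i)
          (≤-trans (tower-double t j) hb)
          (≤-trans (*-monoˡ-≤ (tower t i) (^-monoʳ-≤ 2 (*-monoʳ-≤ 2 (tower-mono t j≤i)))) ha)
    in as′ , bs′ , s′ , s , k′ , k , b , λ x∈ y∈ → All.lookup (All.lookup h y∈) x∈

  module _ {N : ℕ} (W : Fin N → Bool) where

    touches : Fin N → Fin N × Fin N → ℕ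
    touches v (u , w) = ⟦ u == v ⟧ + ⟦ w == v ⟧

    Proper : Fin N × Fin N → Set
    Proper (u , w) = u ≢ w × W u ≡ true × W w ≡ true

    -- A pair costs its two lists one level of `tower` each and the other lists nothing, so a list
    -- needs only as many levels as pairs touch its vertex. Homogeneity already achieved survives
    -- the later shrinking.
    clean : ∀ es (K : Fin N → List A) → All Proper es →
            (∀ {v} → W v ≡ true → tower t (Σl es (touches v)) ≤ length (K v)) →
            Σ (Fin N → List A) λ K′ → (∀ v → K′ v ⊆ K v) × (∀ {v} → W v ≡ true → suc t ≤ length (K′ v)) ×
              All (λ (u , w) → Homogeneous (K′ u) (K′ w)) es
    clean []             K _                      big = K , (λ v → ⊆-refl) , big , []
    clean ((u , w) ∷ es) K ((u≢w , Wu , Ww) ∷ pr) big =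
      let (ku , kw , su , sw , lu , lw , b , hom) =
            homogenise (Σl es (touches u)) (Σl es (touches w))
              (≤-trans (≤-reflexive (cong (tower t) (sym (occᵘ (Σl es (touches u)))))) (big Wu))
              (≤-trans (≤-reflexive (cong (tower t) (sym (occʷ (Σl es (touches w)))))) (big Ww))
          K₁ = upd ku kw
          (K₂ , s , l , h) = clean es K₁ pr (λ {v} Wv → big₁ lu lw v Wv)
      in K₂ , (λ v → ⊆-trans (s v) (sub su sw v)) , l ,
         (b , λ x∈ y∈ → hom (⊆-lookup (subst (K₂ u ⊆_) (updᵘ ku kw) (s u)) x∈)
                            (⊆-lookup (subst (K₂ w ⊆_) (updʷ ku kw) (s w)) y∈)) ∷ h
      where
      occᵘ : ∀ k → touches u (u , w) + k ≡ suc k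
      occᵘ k = cong (_+ k) (cong₂ (λ p q → ⟦ p ⟧ + ⟦ q ⟧) (==-refl u) (≢⇒== (u≢w ∘ sym)))
      occʷ : ∀ k → touches w (u , w) + k ≡ suc k
      occʷ k = cong (_+ k) (cong₂ (λ p q → ⟦ p ⟧ + ⟦ q ⟧) (≢⇒== u≢w) (==-refl w))
      upd : List A → List A → Fin N → List A
      upd ku kw v = if u == v then ku else (if w == v then kw else K v)
      updᵘ : ∀ ku kw → upd ku kw u ≡ ku
      updᵘ ku kw = if-true (==-refl u)
      updʷ : ∀ ku kw → upd ku kw w ≡ kw
      updʷ ku kw = trans (if-false {b = u == w} (≢⇒== u≢w)) (if-true {b = w == w} (==-refl w))
      sub : ∀ {ku kw} → ku ⊆ K u → kw ⊆ K w → ∀ v → upd ku kw v ⊆ K v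
      sub su sw v with u ≟ v
      ... | yes refl = su
      ... | no _ with w ≟ v
      ...   | yes refl = sw
      ...   | no _     = ⊆-refl
      big₁ : ∀ {ku kw} → tower t (Σl es (touches u)) ≤ length ku → tower t (Σl es (touches w)) ≤ length kw →
             ∀ v → W v ≡ true → tower t (Σl es (touches v)) ≤ length (upd ku kw v)
      big₁ lu lw v Wv with u ≟ v
      ... | yes refl = lu
      ... | no _ with w ≟ v
      ...   | yes refl = lw
      ...   | no _     = ≤-trans (tower-mono t (m≤n+m _ (touches v (u , w)))) (big Wv)

-- Sparse bipartite graphs meeting every large rectangle

length-cartesianProduct : (xs : List A) (ys : List B) → length (cartesianProduct xs ys) ≡ length xs * length ys
length-cartesianProduct []       ys = refl
length-cartesianProduct (x ∷ xs) ys = trans (length-++ (map (x ,_) ys))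
  (cong₂ _+_ (length-map (x ,_) ys) (length-cartesianProduct xs ys))

module Greedy {Point Event : Set} (hit : Event → Point → Bool) (Ω : List Point) (0<Ω : 0 < length Ω) (r : ℕ) where

  Dense : Event → Set
  Dense e = length Ω ≤ suc r * Σl Ω (λ p → ⟦ hit e p ⟧)

  cover : List Event → Point → ℕ
  cover es p = Σl es (λ e → ⟦ hit e p ⟧)

  unhit : List Event → Point → List Event
  unhit es p = filter (λ e → hit e p Boolₚ.≟ false) es

  unhit-length : ∀ es p → cover es p + length (unhit es p) ≡ length es
  unhit-length []       p = refl
  unhit-length (e ∷ es) p with hit e p
  ... | true  = cong suc (unhit-length es p)
  ... | false = trans (+-suc _ _) (cong suc (unhit-length es p))

  -- Double counting of the pairs of an event and a point that hits it.
  popular : ∀ es → All Dense es → ∃[ p ] (length es ≤ suc r * cover es p)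
  popular es ds = let (p , _ , h) = Σl-average Ω (λ p → suc r * cover es p) (length es) 0<Ω total in p , h
    where
    open ≤-Reasoning
    sum-dense : ∀ {es} → All Dense es → length es * length Ω ≤ Σl es (λ e → suc r * Σl Ω (λ p → ⟦ hit e p ⟧))
    sum-dense []       = z≤n
    sum-dense (d ∷ ds) = +-mono-≤ d (sum-dense ds)
    total : length Ω * length es ≤ Σl Ω (λ p → suc r * cover es p)
    total = begin
      length Ω * length es                                 ≡⟨ *-comm (length Ω) _ ⟩
      length es * length Ω                                 ≤⟨ sum-dense ds ⟩
      Σl es (λ e → suc r * Σl Ω (λ p → ⟦ hit e p ⟧))       ≡⟨ Σl-cong es (λ e → *-comm (suc r) _) ⟩
      Σl es (λ e → Σl Ω (λ p → ⟦ hit e p ⟧) * suc r)       ≡⟨ Σl-* es _ (suc r) ⟩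
      Σl es (λ e → Σl Ω (λ p → ⟦ hit e p ⟧)) * suc r       ≡⟨ cong (_* suc r) (Σl-swap es Ω (λ e p → ⟦ hit e p ⟧)) ⟩
      Σl Ω (cover es) * suc r                              ≡⟨ sym (Σl-* Ω (cover es) (suc r)) ⟩
      Σl Ω (λ p → cover es p * suc r)                      ≡⟨ Σl-cong Ω (λ p → *-comm (cover es p) (suc r)) ⟩
      Σl Ω (λ p → suc r * cover es p)                      ∎

  shrink : ∀ {E} u c → c + u ≡ E → E ≤ suc r * c → suc r * u ≤ E * r
  shrink u c refl h = +-cancelˡ-≤ (c + u) _ _ (begin
    c + u + suc r * u          ≤⟨ +-monoˡ-≤ (suc r * u) h ⟩
    suc r * c + suc r * u      ≡⟨ alg r c u ⟩
    c + u + (c + u) * r        ∎)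
    where
    open ≤-Reasoning
    alg : ∀ r c u → suc r * c + suc r * u ≡ c + u + (c + u) * r
    alg = solve-∀

  -- A popular point leaves at most the fraction `r / suc r` of the events, so after `k` choices
  -- fewer than one event remains.
  hitAll : ∀ k es → All Dense es → length es * r ^ k < suc r ^ k →
           ∃[ ps ] (length ps ≤ k × All (λ e → ∃[ p ] (p ∈ ps × hit e p ≡ true)) es)
  hitAll k       []       _  _ = [] , z≤n , []
  hitAll zero    (e ∷ es) _  h = ⊥-elim (n≮0 (s≤s⁻¹ h))
  hitAll (suc k) es@(_ ∷ _) ds h =
    let (p , pop) = popular es ds
        rest = unhit es p
        (ps , len , hs) = hitAll k rest (Allₚ.filter⁺ (λ e → hit e p Boolₚ.≟ false) ds) (few (length rest) (shrink (length rest) (cover es p) (unhit-length es p) pop))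
    in p ∷ ps , s≤s len , allHit es p hs
    where
    open ≤-Reasoning
    few : ∀ u → suc r * u ≤ length es * r → u * r ^ k < suc r ^ k
    few u q = *-cancelˡ-< (suc r) (u * r ^ k) (suc r ^ k) (begin-strict
      suc r * (u * r ^ k)            ≡⟨ sym (*-assoc (suc r) u (r ^ k)) ⟩
      suc r * u * r ^ k              ≤⟨ *-monoˡ-≤ (r ^ k) q ⟩
      length es * r * r ^ k          ≡⟨ *-assoc (length es) r (r ^ k) ⟩
      length es * r ^ suc k          <⟨ h ⟩
      suc r ^ suc k                  ∎)
    allHit : ∀ es p {ps} → All (λ e → ∃[ p′ ] (p′ ∈ ps × hit e p′ ≡ true)) (unhit es p) →
              All (λ e → ∃[ p′ ] (p′ ∈ (p ∷ ps) × hit e p′ ≡ true)) es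
    allHit []       p hs = []
    allHit (e ∷ es) p hs with hit e p in eq
    allHit (e ∷ es) p hs       | true  = (p , here refl , eq) ∷ allHit es p hs
    allHit (e ∷ es) p ((p′ , i , h) ∷ hs) | false = (p′ , there i , h) ∷ allHit es p hs

allVecs : ∀ N → List (Vec Bool N)
allVecs zero    = [] ∷ []
allVecs (suc N) = map (true ∷_) (allVecs N) ++ map (false ∷_) (allVecs N)

length-allVecs : ∀ N → length (allVecs N) ≡ 2 ^ N
length-allVecs zero    = refl
length-allVecs (suc N) = trans (length-++ (map (true ∷_) (allVecs N)))
  (cong₂ _+_ (trans (length-map _ (allVecs N)) (length-allVecs N))
             (trans (trans (length-map _ (allVecs N)) (length-allVecs N)) (sym (+-identityʳ _))))

∈-allVecs : ∀ (v : Vec Bool N) → v ∈ allVecs N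
∈-allVecs []          = here refl
∈-allVecs {suc N} (true ∷ v)  = ∈-++⁺ˡ (∈-map⁺ (true ∷_) (∈-allVecs v))
∈-allVecs {suc N} (false ∷ v) = ∈-++⁺ʳ (map (true ∷_) (allVecs N)) (∈-map⁺ (false ∷_) (∈-allVecs v))

^-distrib-* : ∀ x y m → (x * y) ^ m ≡ x ^ m * y ^ m
^-distrib-* x y zero    = refl
^-distrib-* x y (suc m) = trans (cong (x * y *_) (^-distrib-* x y m)) (alg x y (x ^ m) (y ^ m))
  where
  alg : ∀ x y p q → x * y * (p * q) ≡ x * p * (y * q)
  alg = solve-∀

bernoulli : ∀ x m → x ^ suc m + suc m * x ^ m ≤ suc x ^ suc m
bernoulli x zero    = ≤-reflexive (alg x)
  where
  alg : ∀ x → x * 1 + 1 ≡ suc x * 1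
  alg = solve-∀
bernoulli x (suc m) = begin
  x ^ suc (suc m) + suc (suc m) * x ^ suc m                  ≤⟨ m≤m+n _ (suc m * x ^ m) ⟩
  x * (x * x ^ m) + suc (suc m) * (x * x ^ m) + suc m * x ^ m ≡⟨ alg x m (x ^ m) ⟩
  suc x * (x ^ suc m + suc m * x ^ m)                        ≤⟨ *-monoʳ-≤ (suc x) (bernoulli x m) ⟩
  suc x ^ suc (suc m)                                        ∎
  where
  open ≤-Reasoning
  alg : ∀ x m y → x * (x * y) + suc (suc m) * (x * y) + suc m * y ≡ suc x * (x * y + suc m * y)
  alg = solve-∀

pow-double : ∀ x → 2 * x ^ suc x ≤ suc x ^ suc x
pow-double x = begin
  2 * (x * x ^ x)              ≡⟨ alg x (x ^ x) ⟩
  x * x ^ x + x * x ^ x        ≤⟨ +-monoʳ-≤ (x * x ^ x) (m≤n+m _ (x ^ x)) ⟩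
  x * x ^ x + suc x * x ^ x    ≤⟨ bernoulli x x ⟩
  suc x ^ suc x                ∎
  where
  open ≤-Reasoning
  alg : ∀ x y → 2 * (x * y) ≡ x * y + x * y
  alg = solve-∀

-- By Bernoulli's inequality `(suc x / x) ^ suc x` is at least `2`; its power with exponent `suc m`
-- therefore exceeds `2 ^ m`.
pow-beats : ∀ x m → 0 < x → 2 ^ m * x ^ (suc x * suc m) < suc x ^ (suc x * suc m)
pow-beats x m 0<x = begin-strict
  2 ^ m * x ^ (suc x * suc m)          ≡⟨ cong (2 ^ m *_) (sym (^-*-assoc x (suc x) (suc m))) ⟩
  2 ^ m * (x ^ suc x) ^ suc m          <⟨ *-monoˡ-< ((x ^ suc x) ^ suc m) {{>-nonZero (m^n>0 (x ^ suc x) {{>-nonZero (m^n>0 x {{>-nonZero 0<x}} (suc x))}} (suc m))}} (^-monoʳ-< 2 (s≤s (s≤s z≤n)) (n<1+n m)) ⟩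
  2 ^ suc m * (x ^ suc x) ^ suc m      ≡⟨ sym (^-distrib-* 2 (x ^ suc x) (suc m)) ⟩
  (2 * x ^ suc x) ^ suc m              ≤⟨ ^-monoˡ-≤ (suc m) (pow-double x) ⟩
  (suc x ^ suc x) ^ suc m              ≡⟨ ^-*-assoc (suc x) (suc x) (suc m) ⟩
  suc x ^ (suc x * suc m)              ∎
  where open ≤-Reasoning

∑-rectangle : ∀ {N M} (X : Fin N → Bool) (Y : Fin M → Bool) → ∑ (λ x → # (λ y → X x ∧ Y y)) ≡ # X * # Y
∑-rectangle {N} {M} X Y = trans (Σl-cong (allFin N) (λ x → row (X x))) (Σl-* (allFin N) (λ x → ⟦ X x ⟧) (# Y))
  where
  row : ∀ b → # (λ y → b ∧ Y y) ≡ ⟦ b ⟧ * # Y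
  row true  = sym (+-identityʳ _)
  row false = Σl-0 (allFin M)

module Sparse (n N M α β r : ℕ) (0<r : 0 < r) (0<NM : 0 < N * M)
              (dense : ∀ {x y} → n ≤ α * x → n ≤ β * y → N * M ≤ suc r * (x * y)) where

  private
    Event = Vec Bool N × Vec Bool M
    Ω = cartesianProduct (allFin N) (allFin M)

    hit : Event → Fin N × Fin M → Bool
    hit (X , Y) (x , y) = Vec.lookup X x ∧ Vec.lookup Y y

    big? : ∀ (e : Event) → Dec (n ≤ α * # (Vec.lookup (proj₁ e)) × n ≤ β * # (Vec.lookup (proj₂ e)))
    big? (X , Y) = (n ≤? α * # (Vec.lookup X)) ×-dec (n ≤? β * # (Vec.lookup Y))

    events : List Event
    events = filter big? (cartesianProduct (allVecs N) (allVecs M))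

    length-Ω : length Ω ≡ N * M
    length-Ω = trans (length-cartesianProduct (allFin N) (allFin M)) (cong₂ _*_ (length-allFin N) (length-allFin M))

    open Greedy hit Ω (subst (0 <_) (sym length-Ω) 0<NM) r

    events-dense : All Dense events
    events-dense = All.map (λ {(X , Y)} (p , q) → subst₂ _≤_ (sym length-Ω)
        (cong (suc r *_) (sym (trans (Σl-cartesianProduct (allFin N) (allFin M) _) (∑-rectangle (Vec.lookup X) (Vec.lookup Y)))))
        (dense {# (Vec.lookup X)} {# (Vec.lookup Y)} p q))
      (Allₚ.all-filter big? (cartesianProduct (allVecs N) (allVecs M)))

    few-events : length events ≤ 2 ^ (N + M)
    few-events = ≤-trans (Listₚ.length-filter big? (cartesianProduct (allVecs N) (allVecs M)))
      (≤-reflexive (trans (length-cartesianProduct (allVecs N) (allVecs M))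
        (trans (cong₂ _*_ (length-allVecs N) (length-allVecs M)) (sym (^-distribˡ-+-* 2 N M)))))

  -- By `pow-beats`, so many greedy choices suffice for `2 ^ (N + M)` rectangles, each filling at
  -- least one `suc r`-th of the grid.
  size : ℕ
  size = suc r * suc (N + M)

  Meets : (Fin N → Fin M → Bool) → (Fin N → Bool) → (Fin M → Bool) → Set
  Meets B X Y = ∃[ x ] ∃[ y ] (X x ≡ true × Y y ≡ true × B x y ≡ true)

  sparse : ∃[ B ] (∑ (λ x → # (B x)) ≤ size × (∀ X Y → n ≤ α * # X → n ≤ β * # Y → Meets B X Y))
  sparse = E , total , meets
    where
    open ≤-Reasoning
    hitting = hitAll size events events-dense (≤-<-trans (*-monoˡ-≤ (r ^ size) few-events) (pow-beats r (N + M) 0<r))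
    ps : List (Fin N × Fin M)
    ps = proj₁ hitting
    at : Fin N × Fin M → Fin N → Fin M → Bool
    at (x′ , y′) x y = (x′ == x) ∧ (y′ == y)
    any-at : List (Fin N × Fin M) → Fin N → Fin M → Bool
    any-at []       x y = false
    any-at (p ∷ ps) x y = at p x y ∨ any-at ps x y
    E : Fin N → Fin M → Bool
    E = any-at ps
    single : ∀ p → ∑ (λ x → # (at p x)) ≤ 1
    single (x′ , y′) = ≤-reflexive (trans (∑-rectangle (x′ ==_) (y′ ==_)) (cong₂ _*_ (#-δ x′) (#-δ y′)))
    count : ∀ ps → ∑ (λ x → # (any-at ps x)) ≤ length ps
    count []       = ≤-reflexive (trans (Σl-cong (allFin N) (λ x → Σl-0 (allFin M))) (Σl-0 (allFin N)))
    count (p ∷ ps) = begin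
      ∑ (λ x → # (any-at (p ∷ ps) x))             ≤⟨ ∑-mono (λ x → #-∨ (at p x) (any-at ps x)) ⟩
      ∑ (λ x → # (at p x) + # (any-at ps x))      ≡⟨ Σl-+ (allFin N) _ _ ⟩
      ∑ (λ x → # (at p x)) + ∑ (λ x → # (any-at ps x)) ≤⟨ +-mono-≤ (single p) (count ps) ⟩
      suc (length ps)                             ∎
    total : ∑ (λ x → # (E x)) ≤ size
    total = ≤-trans (count ps) (proj₁ (proj₂ hitting))
    any-at-∈ : ∀ {x y ps} → (x , y) ∈ ps → any-at ps x y ≡ true
    any-at-∈ {x} {y} {p ∷ ps} (here refl) = ∨-introˡ _ (∧-intro (==-refl x) (==-refl y))
    any-at-∈ {x} {y} {p ∷ ps} (there i)   = ∨-introʳ (at p x y) (any-at-∈ i)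
    meets : ∀ X Y → n ≤ α * # X → n ≤ β * # Y → Meets E X Y
    meets X Y p q =
      let ((x , y) , i , h) = All.lookup (proj₂ (proj₂ hitting))
            (∈-filter⁺ big? (∈-cartesianProduct⁺ (∈-allVecs (tabulate X)) (∈-allVecs (tabulate Y)))
              (subst (λ k → n ≤ α * k) (#-cong (λ x → sym (lookup∘tabulate X x))) p ,
               subst (λ k → n ≤ β * k) (#-cong (λ y → sym (lookup∘tabulate Y y))) q))
      in x , y , trans (sym (lookup∘tabulate X x)) (∧-fst h) ,
         trans (sym (lookup∘tabulate Y y)) (∧-snd {Vec.lookup (tabulate X) x} h) , any-at-∈ i

≤ᵇ-cases : ∀ m n → ((m ≤ᵇ n) ≡ true × m ≤ n) ⊎ ((m ≤ᵇ n) ≡ false × n < m)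
≤ᵇ-cases m n with m ≤? n
... | yes p = inj₁ (Equivalence.to T-≡ (≤⇒≤ᵇ p) , p)
... | no ¬p = inj₂ (not-true (not-intro (λ e → ¬p (≤ᵇ⇒≤ m n (Equivalence.from T-≡ e)))) , ≰⇒> ¬p)

#-heavy : ∀ {N τ} (d : Fin N → ℕ) → # (λ x → not (d x ≤ᵇ τ)) * τ ≤ ∑ d
#-heavy {N} {τ} d = ≤-trans (≤-reflexive (sym (Σl-* (allFin N) _ τ))) (∑-mono pt)
  where
  pt : ∀ x → ⟦ not (d x ≤ᵇ τ) ⟧ * τ ≤ d x
  pt x with ≤ᵇ-cases (d x) τ
  ... | inj₁ (e , _) rewrite e = z≤n
  ... | inj₂ (e , p) rewrite e = ≤-trans (≤-reflexive (+-identityʳ τ)) (<⇒≤ p)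

#-light : ∀ {τ} (P : Fin N → Bool) → # (λ x → (# P ≤ᵇ τ) ∧ P x) ≤ τ
#-light {N} {τ} P = by (≤ᵇ-cases (# P) τ)
  where
  by : ∀ {b} → (b ≡ true × # P ≤ τ) ⊎ (b ≡ false × τ < # P) → # (λ x → b ∧ P x) ≤ τ
  by (inj₁ (refl , p)) = p
  by (inj₂ (refl , _)) = ≤-trans (≤-reflexive (Σl-0 (allFin N))) z≤n

module _ (q C L : ℕ) where

  private
    -- Trimming may halve the sets to be met, so the untrimmed graph has to meet sets with
    -- `n ≤ α * # X` and `n ≤ 2 * # Y`. A product of two such sets fills at least one `suc r`-th of
    -- the grid, and the untrimmed graph has at most `κ * n` edges.
    α r κ : ℕ
    α = 4 * suc q
    r = suc (C * L * (α * 2))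
    κ = suc r * suc (C + L)

  -- By Markov's inequality at most `n / α` vertices on either side of a graph with `κ * n` edges
  -- have degree above `α * κ`.
  meetBound : ℕ
  meetBound = α * κ

  -- Few vertices exceed the degree bound, so the sparse graph can be trimmed without losing large rectangles.
  bipartiteExpander : ∀ {n N M} → 0 < n → 0 < N * M → N ≤ C * n → M ≤ L * n →
    Σ (Fin N → Fin M → Bool) λ E →
      (∀ x → # (E x) ≤ meetBound) × (∀ y → # (λ x → E x y) ≤ meetBound) ×
      (∀ X Y → n ≤ 2 * suc q * # X → n ≤ # Y → ∃[ x ] ∃[ y ] (X x ≡ true × Y y ≡ true × E x y ≡ true))
  bipartiteExpander {n} {N} {M} 0<n 0<NM N≤ M≤ = E , rows , cols , meets
    where
    open ≤-Reasoning
    dense : ∀ {x y} → n ≤ α * x → n ≤ 2 * y → N * M ≤ suc r * (x * y)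
    dense {x} {y} p q = begin
      N * M                          ≤⟨ *-mono-≤ N≤ M≤ ⟩
      C * n * (L * n)                ≤⟨ *-mono-≤ (*-monoʳ-≤ C p) (*-monoʳ-≤ L q) ⟩
      C * (α * x) * (L * (2 * y))    ≡⟨ alg C L α x y ⟩
      C * L * (α * 2) * (x * y)      ≤⟨ *-monoˡ-≤ (x * y) {C * L * (α * 2)} {suc r} (≤-trans (n≤1+n _) (n≤1+n _)) ⟩
      suc r * (x * y)                ∎
      where
      alg : ∀ C L α x y → C * (α * x) * (L * (2 * y)) ≡ C * L * (α * 2) * (x * y)
      alg = solve-∀
    open Sparse n N M α 2 r (s≤s z≤n) 0<NM dense
    τ = meetBound
    B₀ : Fin N → Fin M → Bool
    B₀ = proj₁ sparse
    total : ∑ (λ x → # (B₀ x)) ≤ κ * n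
    total = begin
      ∑ (λ x → # (B₀ x))              ≤⟨ proj₁ (proj₂ sparse) ⟩
      suc r * suc (N + M)             ≤⟨ *-monoʳ-≤ (suc r) (+-mono-≤ 0<n (+-mono-≤ N≤ M≤)) ⟩
      suc r * (n + (C * n + L * n))   ≡⟨ alg (suc r) n C L ⟩
      κ * n                           ∎
      where
      alg : ∀ s n C L → s * (n + (C * n + L * n)) ≡ s * suc (C + L) * n
      alg = solve-∀
    lowˣ : Fin N → Bool
    lowˣ x = # (B₀ x) ≤ᵇ τ
    lowʸ : Fin M → Bool
    lowʸ y = # (λ x → B₀ x y) ≤ᵇ τ
    few : ∀ h → h * τ ≤ κ * n → α * h ≤ n
    few h le = *-cancelˡ-≤ κ (begin
      κ * (α * h)     ≡⟨ alg κ α h ⟩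
      h * τ           ≤⟨ le ⟩
      κ * n           ∎)
      where
      alg : ∀ κ α h → κ * (α * h) ≡ h * (α * κ)
      alg = solve-∀
    fewˣ : α * # (λ x → not (lowˣ x)) ≤ n
    fewˣ = few _ (≤-trans (#-heavy (λ x → # (B₀ x))) total)
    fewʸ : α * # (λ y → not (lowʸ y)) ≤ n
    fewʸ = few _ (≤-trans (#-heavy (λ y → # (λ x → B₀ x y)))
             (≤-trans (≤-reflexive (Σl-swap (allFin M) (allFin N) (λ y x → ⟦ B₀ x y ⟧))) total))
    E : Fin N → Fin M → Bool
    E x y = lowʸ y ∧ (lowˣ x ∧ B₀ x y)
    rows : ∀ x → # (E x) ≤ τ
    rows x = ≤-trans (#-mono {Q = λ y → lowˣ x ∧ B₀ x y} (λ y → ∧-snd {lowʸ y})) (#-light (B₀ x))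
    cols : ∀ y → # (λ x → E x y) ≤ τ
    cols y = ≤-trans (#-mono {Q = λ x → lowʸ y ∧ B₀ x y} (λ x h → ∧-intro (∧-fst h) (∧-snd {lowˣ x} (∧-snd {lowʸ y} h)))) (#-light (λ x → B₀ x y))
    drop : ∀ {K} (a : ℕ) (X low : Fin K → Bool) → 2 * n ≤ a * # X → a * # (λ x → not (low x)) ≤ n → n ≤ a * # (λ x → X x ∧ low x)
    drop a X low h f = +-cancelʳ-≤ n _ _ (begin
      n + n                                              ≡⟨ cong (n +_) (sym (+-identityʳ n)) ⟩
      2 * n                                              ≤⟨ h ⟩
      a * # X                                            ≡⟨ cong (a *_) (#-split X low) ⟩
      a * (# (λ x → X x ∧ low x) + # (λ x → X x ∧ not (low x))) ≡⟨ *-distribˡ-+ a _ _ ⟩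
      a * # (λ x → X x ∧ low x) + a * # (λ x → X x ∧ not (low x))
        ≤⟨ +-monoʳ-≤ _ (≤-trans (*-monoʳ-≤ a (#-mono {Q = λ x → not (low x)} (λ x → ∧-snd {X x}))) f) ⟩
      a * # (λ x → X x ∧ low x) + n                      ∎)
    meets : ∀ X Y → n ≤ 2 * suc q * # X → n ≤ # Y → ∃[ x ] ∃[ y ] (X x ≡ true × Y y ≡ true × E x y ≡ true)
    meets X Y p p′ =
      let (x , y , hx , hy , h) = proj₂ (proj₂ sparse) (λ x → X x ∧ lowˣ x) (λ y → Y y ∧ lowʸ y)
            (drop α X lowˣ (≤-trans (*-monoʳ-≤ 2 p) (≤-reflexive (alg (suc q) (# X)))) fewˣ)
            (drop 2 Y lowʸ (*-monoʳ-≤ 2 p′) (≤-trans (*-monoˡ-≤ _ {2} {α} (≤-trans (s≤s (s≤s z≤n)) (m≤m*n 4 (suc q)))) fewʸ))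
      in x , y , ∧-fst hx , ∧-fst hy , ∧-intro (∧-snd {Y y} hy) (∧-intro (∧-snd {X x} hx) h)
      where
      alg : ∀ q x → 2 * (2 * q * x) ≡ 4 * q * x
      alg = solve-∀

-- Greedy colourings and matchings

module _ {N R : ℕ} (F : Fin N → Fin N → Bool) (F-sym : ∀ {x y} → F x y ≡ true → F y x ≡ true)
         (F-irr : ∀ {x} → F x x ≡ false) (deg : ∀ x → # (F x) ≤ R) where

  freeColour : (χ : Fin N → Fin (suc R)) (x : Fin N) → ∃[ i ] (∀ {y} → F x y ≡ true → χ y ≢ i)
  freeColour χ x =
    let (i , _ , z) = Σl-zero (allFin (suc R)) (λ i → # (λ y → F x y ∧ (χ y == i)))
                        (≤-trans (s≤s few) (≤-reflexive (sym (length-allFin (suc R)))))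
    in i , λ {y} Fxy e → <-irrefl (sym z) (#-∈ (λ y → F x y ∧ (χ y == i)) {y} (∧-intro Fxy (subst (λ j → (χ y == j) ≡ true) e (==-refl (χ y)))))
    where
    open ≤-Reasoning
    row : ∀ b c → # (λ (i : Fin (suc R)) → b ∧ (c == i)) ≤ ⟦ b ⟧
    row true  c = ≤-reflexive (#-δ c)
    row false c = ≤-reflexive (Σl-0 (allFin (suc R)))
    few : ∑ (λ i → # (λ y → F x y ∧ (χ y == i))) ≤ R
    few = begin
      ∑ (λ i → # (λ y → F x y ∧ (χ y == i)))  ≡⟨ Σl-swap (allFin (suc R)) (allFin N) (λ i y → ⟦ F x y ∧ (χ y == i) ⟧) ⟩
      ∑ (λ y → # (λ i → F x y ∧ (χ y == i)))  ≤⟨ ∑-mono (λ y → row (F x y) (χ y)) ⟩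
      # (F x)                                 ≤⟨ deg x ⟩
      R                                       ∎

  colourList : ∀ xs → Σ (Fin N → Fin (suc R)) λ χ → ∀ {x y} → x ∈ xs → y ∈ xs → F x y ≡ true → χ x ≢ χ y
  colourList []       = (λ _ → zero) , λ ()
  colourList (x ∷ xs) =
    let (χ , ok) = colourList xs
        (i , free) = freeColour χ x
    in (λ y → if x == y then i else χ y) , extend χ ok i free
    where
    extend : ∀ χ → (∀ {x y} → x ∈ xs → y ∈ xs → F x y ≡ true → χ x ≢ χ y) → ∀ i → (∀ {y} → F x y ≡ true → χ y ≢ i) →
             ∀ {y z} → y ∈ (x ∷ xs) → z ∈ (x ∷ xs) → F y z ≡ true → (if x == y then i else χ y) ≢ (if x == z then i else χ z)
    extend χ ok i free {y} {z} y∈ z∈ Fyz with x ≟ y | x ≟ z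
    ... | yes refl | yes refl = λ _ → true≢false Fyz F-irr
    ... | yes refl | no _     = λ e → free Fyz (sym e)
    ... | no _     | yes refl = λ e → free (F-sym Fyz) e
    ... | no x≢y   | no x≢z   = ok (tail x≢y y∈) (tail x≢z z∈) Fyz
      where
      tail : ∀ {w} → x ≢ w → w ∈ (x ∷ xs) → w ∈ xs
      tail ne (here e)  = ⊥-elim (ne (sym e))
      tail ne (there p) = p

  properColouring : Σ (Fin N → Fin (suc R)) λ χ → ∀ {x y} → F x y ≡ true → χ x ≢ χ y
  properColouring = let (χ , ok) = colourList (allFin N) in χ , λ {x} {y} → ok (∈-allFin x) (∈-allFin y)

record Matching {N M : ℕ} (E : Fin N → Fin M → Bool) (xs : List (Fin N)) : Set where
  field
    matched : Fin N → Bool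
    φ       : Fin N → Fin M
    used    : Fin M → Bool
    φ-edge  : ∀ {x} → matched x ≡ true → E x (φ x) ≡ true
    φ-used  : ∀ {x} → matched x ≡ true → used (φ x) ≡ true
    φ-inj   : ∀ {x y} → matched x ≡ true → matched y ≡ true → φ x ≡ φ y → x ≡ y
    used≤   : # used ≤ length xs
    maximal : ∀ {x y} → x ∈ xs → matched x ≡ false → E x y ≡ true → used y ≡ true

greedyMatching : ∀ {N M} (E : Fin N → Fin M → Bool) → Fin M → ∀ xs → Matching E xs
greedyMatching {N} {M} E y₀ [] = record
  { matched = λ _ → false ; φ = λ _ → y₀ ; used = λ _ → false
  ; φ-edge = λ () ; φ-used = λ () ; φ-inj = λ () ; used≤ = ≤-reflexive (Σl-0 (allFin M)) ; maximal = λ () }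
greedyMatching {N} {M} E y₀ (x ∷ xs) = step (bool? (matched x)) (bool? (some new))
  where
  rest = greedyMatching E y₀ xs
  open Matching rest
  new : Fin M → Bool
  new y = E x y ∧ not (used y)
  keep : (matched x ≡ false → ∀ {y} → E x y ≡ true → used y ≡ true) → Matching E (x ∷ xs)
  keep blocked = record
    { matched = matched ; φ = φ ; used = used ; φ-edge = φ-edge ; φ-used = φ-used ; φ-inj = φ-inj
    ; used≤ = ≤-trans used≤ (n≤1+n _)
    ; maximal = λ { (here refl) h → blocked h ; (there i) → maximal i } }
  add : matched x ≡ false → ∀ y → E x y ≡ true → used y ≡ false → Matching E (x ∷ xs)
  add x∉ y Exy y∉ = record
    { matched = λ z → matched z ∨ (x == z) ; φ = φ⁺ ; used = λ z → used z ∨ (y == z)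
    ; φ-edge = edge ; φ-used = use ; φ-inj = inj
    ; used≤ = ≤-trans (#-insert used y) (s≤s used≤)
    ; maximal = λ { (here refl) h → ⊥-elim (true≢false (∨-introʳ (matched x) (==-refl x)) h)
                  ; (there i) h Ezy → ∨-introˡ _ (maximal i (out h) Ezy) } }
    where
    φ⁺ : Fin N → Fin M
    φ⁺ z = if x == z then y else φ z
    out : ∀ {z} → matched z ∨ (x == z) ≡ false → matched z ≡ false
    out {z} h with matched z
    ... | false = refl
    out {z} () | true
    new≡ : φ⁺ x ≡ y
    new≡ = if-true (==-refl x)
    old≡ : ∀ {z} → matched z ≡ true → φ⁺ z ≡ φ z
    old≡ h = if-false (≢⇒== {x = x} (λ { refl → true≢false h x∉ }))
    cases : ∀ {z} → matched z ∨ (x == z) ≡ true → (matched z ≡ true) ⊎ (x ≡ z)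
    cases {z} h with ∨-elim {matched z} h
    ... | inj₁ p = inj₁ p
    ... | inj₂ e = inj₂ (==⇒≡ e)
    edge : ∀ {z} → matched z ∨ (x == z) ≡ true → E z (φ⁺ z) ≡ true
    edge {z} h with cases h
    ... | inj₁ p    = subst (λ w → E z w ≡ true) (sym (old≡ p)) (φ-edge p)
    ... | inj₂ refl = subst (λ w → E z w ≡ true) (sym new≡) Exy
    use : ∀ {z} → matched z ∨ (x == z) ≡ true → used (φ⁺ z) ∨ (y == φ⁺ z) ≡ true
    use {z} h with cases h
    ... | inj₁ p    = ∨-introˡ _ (subst (λ w → used w ≡ true) (sym (old≡ p)) (φ-used p))
    ... | inj₂ refl = ∨-introʳ (used (φ⁺ x)) (subst (λ w → (y == w) ≡ true) (sym new≡) (==-refl y))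
    φ≢y : ∀ {z} → matched z ≡ true → φ z ≢ y
    φ≢y p e = true≢false (φ-used p) (subst (λ w → used w ≡ false) (sym e) y∉)
    inj : ∀ {z w} → matched z ∨ (x == z) ≡ true → matched w ∨ (x == w) ≡ true → φ⁺ z ≡ φ⁺ w → z ≡ w
    inj hz hw e with cases hz | cases hw
    ... | inj₁ p    | inj₁ q    = φ-inj p q (trans (sym (old≡ p)) (trans e (old≡ q)))
    ... | inj₂ refl | inj₂ refl = refl
    ... | inj₁ p    | inj₂ refl = ⊥-elim (φ≢y p (trans (sym (old≡ p)) (trans e new≡)))
    ... | inj₂ refl | inj₁ q    = ⊥-elim (φ≢y q (trans (sym (old≡ q)) (trans (sym e) new≡)))
  step : (matched x ≡ true) ⊎ (matched x ≡ false) → (some new ≡ true) ⊎ (some new ≡ false) → Matching E (x ∷ xs)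
  step (inj₁ p) _        = keep (λ q → ⊥-elim (true≢false p q))
  step (inj₂ q) (inj₁ s) = let (y , h) = some-elim new s in add q y (∧-fst h) (not-true (∧-snd {E x y} h))
  step (inj₂ q) (inj₂ s) = keep (λ _ {y} Exy → not-injective (subst (λ b → b ∧ not (used y) ≡ false) Exy (none new s y)))

==-sym : (x y : Fin N) → (x == y) ≡ (y == x)
==-sym x y = bool-≡ (flip x y) (flip y x)
  where
  flip : ∀ x y → (x == y) ≡ true → (y == x) ≡ true
  flip x y h = subst (λ z → (z == x) ≡ true) (==⇒≡ {x = x} {y} h) (==-refl x)

#-δʳ : (x : Fin N) → # (_== x) ≡ 1
#-δʳ x = trans (#-cong (λ y → ==-sym y x)) (#-δ x)

Σl-exceeds : ∀ (xs : List A) (f : A → ℕ) c → length xs * c < Σl xs f → ∃[ x ] (x ∈ xs × c < f x)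
Σl-exceeds (x ∷ xs) f c h with suc c ≤? f x
... | yes p = x , here refl , p
... | no ¬p = let (y , i , q) = Σl-exceeds xs f c (+-cancelˡ-< c _ _ (<-≤-trans h (+-monoˡ-≤ _ (s≤s⁻¹ (≰⇒> ¬p))))) in y , there i , q

#-fibres : ∀ {N M} (P : Fin N → Bool) (f : Fin N → Fin M) → ∑ (λ v → # (λ x → P x ∧ (f x == v))) ≡ # P
#-fibres {N} {M} P f = trans (Σl-swap (allFin M) (allFin N) (λ v x → ⟦ P x ∧ (f x == v) ⟧))
                         (Σl-cong (allFin N) (λ x → row (P x) (f x)))
  where
  row : ∀ b c → # (λ (v : Fin M) → b ∧ (c == v)) ≡ ⟦ b ⟧
  row true  c = #-δ c
  row false c = Σl-0 (allFin M)

#-pigeonhole : ∀ {s} (f : Fin N → Fin s) a (cs : List (Fin s)) (P : Fin N → Bool) →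
               (∀ {x} → P x ≡ true → f x ∈ cs) → length cs * a < # P →
               ∃[ i ] (i ∈ cs × a < # (λ x → P x ∧ (f x == i)))
#-pigeonhole f a []       P h lt = case h (proj₂ (#-pos P lt)) of λ ()
#-pigeonhole f a (i ∷ cs) P h lt with suc a ≤? # (λ x → P x ∧ (f x == i))
... | yes p = i , here refl , p
... | no ¬p =
  let (j , j∈ , k) = #-pigeonhole f a cs (λ x → P x ∧ not (f x == i)) h′
        (+-cancelˡ-< a _ _ (<-≤-trans lt (≤-trans (≤-reflexive (#-split P (λ x → f x == i))) (+-monoˡ-≤ _ (s≤s⁻¹ (≰⇒> ¬p))))))
  in j , there j∈ , <-≤-trans k (#-mono (λ x p → ∧-intro (∧-fst (∧-fst p)) (∧-snd {P x ∧ not (f x == i)} p)))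
  where
  h′ : ∀ {x} → P x ∧ not (f x == i) ≡ true → f x ∈ cs
  h′ {x} p with h (∧-fst p)
  ... | there q = q
  ... | here e  = ⊥-elim (true≢false (trans (cong (_== i) e) (==-refl i)) (not-true (∧-snd {P x} p)))

cell : ∀ N M → Fin (N * M) → Fin N
cell N M x = proj₁ (remQuot M x)

#-cell : ∀ {N} M (v : Fin N) → # (λ x → cell N M x == v) ≤ M
#-cell {N} M v = begin
  # (λ x → cell N M x == v)                          ≤⟨ #-mono inCell ⟩
  # (λ x → some (λ j → combine v j == x))          ≤⟨ #-some {M} {N * M} (λ j x → combine v j == x) ⟩
  ∑ {M} (λ j → # (combine v j ==_))                ≤⟨ ∑-bound {M} (λ j → ≤-reflexive (#-δ (combine v j))) ⟩
  M * 1                                            ≡⟨ *-identityʳ M ⟩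
  M                                                ∎
  where
  open ≤-Reasoning
  inCell : ∀ x → (cell N M x == v) ≡ true → some (λ j → combine v j == x) ≡ true
  inCell x h = some-intro (λ j → combine v j == x) {proj₂ (remQuot {N} M x)}
    (subst (λ y → (y == x) ≡ true) (trans (sym (combine-remQuot {N} M x)) (cong (λ u → combine {N} {M} u (proj₂ (remQuot {N} M x))) (==⇒≡ {x = cell N M x} {v} h))) (==-refl x))

-- Hosts

module _ (D t S : ℕ) where

  -- A copy of T ⊠ K_{t+1} inside U in colour i, given by the bag of vertices replacing each vertex of T.
  Blowup : ∀ {n N} → (Fin N → Fin N → Bool) → (Fin N → Fin N → Fin S) → (Fin N → Bool) → RootedTree n D → Fin S → Set
  Blowup {n} {N} adj c U T i =
    Σ (Fin n → List (Fin N)) λ K →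
      (∀ a → suc t ≤ length (K a)) × (∀ a → Unique (K a)) ×
      (∀ {a b x} → x ∈ K a → x ∈ K b → a ≡ b) ×
      (∀ {a x} → x ∈ K a → U x ≡ true) ×
      (∀ {a x y} → x ∈ K a → y ∈ K a → x ≢ y → adj x y ≡ true × c x y ≡ i) ×
      (∀ {a x y} → a ≢ root → x ∈ K (par a) → y ∈ K a → adj x y ≡ true × c x y ≡ i)
    where open RootedTree T

  -- The palette `Fin S` is fixed throughout and only the list `cs` of permitted colours shrinks, so
  -- that dropping a colour involves no renaming. The tree is quantified last: one host serves all
  -- trees with `n` vertices.
  record HostAt (C R s n : ℕ) : Set where
    field
      order   : ℕ
      n≤order : n ≤ order
      order≤  : order ≤ C * n
      adj     : Fin order → Fin order → Bool
      adj-sym : ∀ {x y} → adj x y ≡ true → adj y x ≡ true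
      adj-irr : ∀ {x} → adj x x ≡ false
      deg     : ∀ x → # (adj x) ≤ R
      -- Only half of the vertices need survive, because the matching of the inductive step misses some of them.
      arrows  : ∀ U (c : Fin order → Fin order → Fin S) cs → length cs ≤ s → order ≤ 2 * # U →
                (∀ {x y} → U x ≡ true → U y ≡ true → adj x y ≡ true → c x y ≡ c y x × c x y ∈ cs) →
                (T : RootedTree n D) → ∃[ i ] Blowup adj c U T i

  Host : ℕ → Set
  Host s = ∃[ C ] ∃[ R ] (∀ n → 0 < n → HostAt C R s n)

  #-two : (P : Fin N → Bool) → 1 < # P → ∃[ x ] ∃[ y ] (x ≢ y × P x ≡ true × P y ≡ true)
  #-two P h =
    let (x , Px) = #-pos P (<⇒≤ h)
        (y , q) = #-pos (λ y → P y ∧ not (x == y)) (+-cancelˡ-< 1 _ _ (<-≤-trans h (≤-trans (≤-reflexive (#-split P (x ==_)))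
                    (+-monoˡ-≤ _ (≤-trans (#-mono {Q = x ==_} (λ y → ∧-snd {P y})) (≤-reflexive (#-δ x)))))))
    in x , y , (λ e → true≢false (trans (cong (x ==_) (sym e)) (==-refl x)) (not-true (∧-snd {P y} q))) , Px , ∧-fst q

  -- With no colours at all, any graph with an edge inside each half of its vertices will do: n disjoint triangles.
  host₀ : Host 0
  host₀ = 3 , 3 , λ n 0<n → record
    { order   = n * 3
    ; n≤order = m≤m*n n 3
    ; order≤  = ≤-reflexive (*-comm n 3)
    ; adj     = triangle n
    ; adj-sym = λ {x} {y} h → ∧-intro (trans (cong not (==-sym y x)) (∧-fst h)) (trans (==-sym (cell n 3 x) (cell n 3 y)) (∧-snd {not (x == y)} h))
    ; adj-irr = λ {x} → cong (λ b → not b ∧ (cell n 3 x == cell n 3 x)) (==-refl x)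
    ; deg     = λ x → ≤-trans (#-mono {Q = λ y → cell n 3 y == cell n 3 x} (λ y → ∧-snd {not (x == y)})) (#-cell 3 (cell n 3 x))
    ; arrows  = λ { U c [] _ half ok T → ⊥-elim (noColour 0<n U half (λ p q r → case proj₂ (ok p q r) of λ ())) }
    }
    where
    triangle : ∀ n → Fin (n * 3) → Fin (n * 3) → Bool
    triangle n x y = not (x == y) ∧ (cell n 3 y == cell n 3 x)
    noColour : ∀ {n} → 0 < n → ∀ U → n * 3 ≤ 2 * # U → (∀ {x y} → U x ≡ true → U y ≡ true → triangle n x y ≡ true → ⊥) → ⊥
    noColour {n} 0<n U half none =
      let (v , _ , h) = Σl-exceeds (allFin n) (λ v → # (λ x → U x ∧ (cell n 3 x == v))) 1
                          (subst₂ _<_ (sym (trans (*-identityʳ _) (length-allFin n))) (sym (#-fibres U (cell n 3))) n<U)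
          (x , y , x≢y , p , q) = #-two (λ x → U x ∧ (cell n 3 x == v)) h
      in none (∧-fst p) (∧-fst q) (∧-intro (cong not (≢⇒== x≢y))
           (subst (λ w → (cell n 3 y == w) ≡ true) (sym (==⇒≡ {x = cell n 3 x} {v} (∧-snd {U x} p))) (∧-snd {U y} q)))
      where
      n<U : n < # U
      n<U = ≰⇒> (λ U≤n → <-irrefl refl (begin-strict
        2 * # U          ≤⟨ *-monoʳ-≤ 2 U≤n ⟩
        2 * n            ≡⟨ *-comm 2 n ⟩
        n * 2            <⟨ *-monoʳ-< n {{>-nonZero 0<n}} (n<1+n 2) ⟩
        n * 3            ≤⟨ half ⟩
        2 * # U          ∎))
        where open ≤-Reasoning

-- Vertex sets as lists without repetition

members : (Fin N → Bool) → List (Fin N)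
members {N} P = filter (λ x → P x Boolₚ.≟ true) (allFin N)

∈-members⁻ : (P : Fin N → Bool) {x : Fin N} → x ∈ members P → P x ≡ true
∈-members⁻ {N} P i = proj₂ (∈-filter⁻ (λ x → P x Boolₚ.≟ true) {xs = allFin N} i)

members-unique : (P : Fin N → Bool) → Unique (members P)
members-unique {N} P = Uniq.filter⁺ (λ x → P x Boolₚ.≟ true) (Uniq.allFin⁺ N)

length-members : (P : Fin N → Bool) → length (members P) ≡ # P
length-members {N} P = trans (length-filter (λ x → P x Boolₚ.≟ true) (allFin N)) (Σl-cong (allFin N) (λ x → cong ⟦_⟧ (same (P x))))
  where
  same : ∀ b → does (b Boolₚ.≟ true) ≡ b
  same true  = refl
  same false = refl

Unique⇒AllPairs : ∀ {A : Set} {R : A → A → Set} {xs} → Unique xs → (∀ {x y} → x ∈ xs → y ∈ xs → x ≢ y → R x y) → AllPairs R xs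
Unique⇒AllPairs []       h = []
Unique⇒AllPairs (p ∷ ps) h = All.tabulate (λ i → h (here refl) (there i) (All.lookup p i)) ∷ Unique⇒AllPairs ps (λ i j → h (there i) (there j))

AllPairs⇒either : ∀ {A : Set} {R : A → A → Set} {xs} → AllPairs R xs → ∀ {x y} → x ∈ xs → y ∈ xs → x ≢ y → R x y ⊎ R y x
AllPairs⇒either (p ∷ ps) (here refl) (here refl) ne = ⊥-elim (ne refl)
AllPairs⇒either (p ∷ ps) (here refl) (there j)   ne = inj₁ (All.lookup p j)
AllPairs⇒either (p ∷ ps) (there i)   (here refl) ne = inj₂ (All.lookup p i)
AllPairs⇒either (p ∷ ps) (there i)   (there j)   ne = AllPairs⇒either ps i j ne

Unique-map : ∀ {A B : Set} (f : A → B) {xs} → Unique xs → (∀ {x y} → x ∈ xs → y ∈ xs → f x ≡ f y → x ≡ y) → Unique (map f xs)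
Unique-map f []       h = []
Unique-map f (p ∷ ps) h = Allₚ.map⁺ (All.tabulate (λ i e → All.lookup p i (h (here refl) (there i) e))) ∷ Unique-map f ps (λ i j → h (there i) (there j))

Σl-filter : ∀ {A : Set} {P : A → Set} (P? : ∀ x → Dec (P x)) xs (f : A → ℕ) → Σl (filter P? xs) f ≡ Σl xs (λ x → ⟦ does (P? x) ⟧ * f x)
Σl-filter P? []       f = refl
Σl-filter P? (x ∷ xs) f with does (P? x)
... | true  = cong₂ _+_ (sym (+-identityʳ (f x))) (Σl-filter P? xs f)
... | false = Σl-filter P? xs f

-- The joined graph on `V` and its clique blow-up

module Transfer {N₁ N : ℕ} (F : Fin N₁ → Fin N₁ → Bool) (F-sym : ∀ {x y} → F x y ≡ true → F y x ≡ true)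
                (E : Fin N₁ → Fin N → Bool) where

  link : Fin N → Fin N → Bool
  link v w = some (λ x → some (λ y → E x v ∧ (F x y ∧ E y w)))

  transfer : Fin N → Fin N → Bool
  transfer v w = not (v == w) ∧ link v w

  link-intro : ∀ {v w x y} → E x v ≡ true → F x y ≡ true → E y w ≡ true → link v w ≡ true
  link-intro {v} {w} {x} {y} p q r =
    some-intro (λ x → some (λ y → E x v ∧ (F x y ∧ E y w))) {x}
      (some-intro (λ y → E x v ∧ (F x y ∧ E y w)) {y} (∧-intro p (∧-intro q r)))

  link-sym : ∀ {v w} → link v w ≡ true → link w v ≡ true
  link-sym {v} {w} h =
    let (x , h₁) = some-elim (λ x → some (λ y → E x v ∧ (F x y ∧ E y w))) h
        (y , h₂) = some-elim (λ y → E x v ∧ (F x y ∧ E y w)) h₁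
    in link-intro (∧-snd {F x y} (∧-snd {E x v} h₂)) (F-sym (∧-fst (∧-snd {E x v} h₂))) (∧-fst h₂)

  transfer-sym : ∀ {v w} → transfer v w ≡ true → transfer w v ≡ true
  transfer-sym {v} {w} h = ∧-intro (trans (cong not (==-sym w v)) (∧-fst h)) (link-sym (∧-snd {not (v == w)} h))

  transfer-irr : ∀ {v} → transfer v v ≡ false
  transfer-irr {v} = cong (λ b → not b ∧ link v v) (==-refl v)

  -- Every neighbour `w` of `v` ends a path `v`, `x`, `y`, `w` whose steps lie in `E`, `F`, `E`.
  transfer-deg : ∀ {R τ} → (∀ x → # (F x) ≤ R) → (∀ x → # (E x) ≤ τ) → (∀ v → # (λ x → E x v) ≤ τ) →
                 ∀ v → # (transfer v) ≤ τ * (R * τ)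
  transfer-deg {R} {τ} degF rows cols v = begin
    # (transfer v)                                           ≤⟨ #-mono {Q = link v} (λ w → ∧-snd {not (v == w)}) ⟩
    # (link v)                                               ≤⟨ #-some (λ x w → some (λ y → E x v ∧ (F x y ∧ E y w))) ⟩
    ∑ (λ x → # (λ w → some (λ y → E x v ∧ (F x y ∧ E y w)))) ≤⟨ ∑-mono (λ x → #-some (λ y w → E x v ∧ (F x y ∧ E y w))) ⟩
    ∑ (λ x → ∑ (λ y → # (λ w → E x v ∧ (F x y ∧ E y w))))    ≤⟨ ∑-mono (λ x → row (E x v) x) ⟩
    ∑ (λ x → ⟦ E x v ⟧ * (R * τ))                            ≡⟨ Σl-* (allFin N₁) (λ x → ⟦ E x v ⟧) (R * τ) ⟩
    # (λ x → E x v) * (R * τ)                                ≤⟨ *-monoˡ-≤ (R * τ) (cols v) ⟩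
    τ * (R * τ)                                              ∎
    where
    open ≤-Reasoning
    entry : ∀ b y → # (λ w → b ∧ E y w) ≤ ⟦ b ⟧ * τ
    entry true  y = ≤-trans (rows y) (≤-reflexive (sym (+-identityʳ τ)))
    entry false y = ≤-reflexive (Σl-0 (allFin N))
    row : ∀ b x → ∑ (λ y → # (λ w → b ∧ (F x y ∧ E y w))) ≤ ⟦ b ⟧ * (R * τ)
    row true  x = begin
      ∑ (λ y → # (λ w → F x y ∧ E y w))  ≤⟨ ∑-mono (λ y → entry (F x y) y) ⟩
      ∑ (λ y → ⟦ F x y ⟧ * τ)            ≡⟨ Σl-* (allFin N₁) (λ y → ⟦ F x y ⟧) τ ⟩
      # (F x) * τ                        ≤⟨ *-monoˡ-≤ τ (degF x) ⟩
      R * τ                              ≡⟨ sym (+-identityʳ _) ⟩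
      R * τ + 0                          ∎
    row false x = ≤-reflexive (trans (Σl-cong (allFin N₁) (λ y → Σl-0 (allFin N))) (Σl-0 (allFin N₁)))

module CliqueBlowup {N : ℕ} (M : ℕ) (G : Fin N → Fin N → Bool) where

  blow : Fin (N * M) → Fin (N * M) → Bool
  blow x y = not (x == y) ∧ ((cell N M y == cell N M x) ∨ G (cell N M x) (cell N M y))

  blow-sym : (∀ {v w} → G v w ≡ true → G w v ≡ true) → ∀ {x y} → blow x y ≡ true → blow y x ≡ true
  blow-sym G-sym {x} {y} h with ∨-elim {cell N M y == cell N M x} (∧-snd {not (x == y)} h)
  ... | inj₁ e = ∧-intro (trans (cong not (==-sym y x)) (∧-fst h)) (∨-introˡ _ (trans (==-sym (cell N M x) (cell N M y)) e))
  ... | inj₂ e = ∧-intro (trans (cong not (==-sym y x)) (∧-fst h)) (∨-introʳ (cell N M x == cell N M y) (G-sym e))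

  blow-irr : ∀ {x} → blow x x ≡ false
  blow-irr {x} = cong (λ b → not b ∧ ((cell N M x == cell N M x) ∨ G (cell N M x) (cell N M x))) (==-refl x)

  blow-inner : ∀ {x y} → x ≢ y → cell N M x ≡ cell N M y → blow x y ≡ true
  blow-inner {x} {y} ne e = ∧-intro (cong not (≢⇒== ne)) (∨-introˡ _ (subst (λ v → (cell N M y == v) ≡ true) (sym e) (==-refl (cell N M y))))

  blow-outer : ∀ {x y} → x ≢ y → G (cell N M x) (cell N M y) ≡ true → blow x y ≡ true
  blow-outer {x} {y} ne e = ∧-intro (cong not (≢⇒== ne)) (∨-introʳ (cell N M y == cell N M x) e)

  blow-deg : ∀ {R} → (∀ v → # (G v) ≤ R) → ∀ x → # (blow x) ≤ M + R * M
  blow-deg {R} deg x = begin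
    # (blow x)                                       ≤⟨ #-mono {Q = λ y → (cell N M y == v) ∨ G v (cell N M y)} (λ y → ∧-snd {not (x == y)}) ⟩
    # (λ y → (cell N M y == v) ∨ G v (cell N M y))   ≤⟨ #-∨ (λ y → cell N M y == v) (λ y → G v (cell N M y)) ⟩
    # (λ y → cell N M y == v) + # (λ y → G v (cell N M y)) ≤⟨ +-mono-≤ (#-cell M v) outer ⟩
    M + R * M                                        ∎
    where
    open ≤-Reasoning
    v = cell N M x
    row : ∀ b w → # (λ y → b ∧ (cell N M y == w)) ≤ ⟦ b ⟧ * M
    row true  w = ≤-trans (#-cell M w) (≤-reflexive (sym (+-identityʳ M)))
    row false w = ≤-reflexive (Σl-0 (allFin (N * M)))
    outer : # (λ y → G v (cell N M y)) ≤ R * M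
    outer = begin
      # (λ y → G v (cell N M y))                         ≤⟨ #-mono (λ y h → some-intro (λ w → G v w ∧ (cell N M y == w)) {cell N M y} (∧-intro h (==-refl (cell N M y)))) ⟩
      # (λ y → some (λ w → G v w ∧ (cell N M y == w)))   ≤⟨ #-some (λ w y → G v w ∧ (cell N M y == w)) ⟩
      ∑ (λ w → # (λ y → G v w ∧ (cell N M y == w)))      ≤⟨ ∑-mono (λ w → row (G v w) w) ⟩
      ∑ (λ w → ⟦ G v w ⟧ * M)                            ≡⟨ Σl-* (allFin N) (λ w → ⟦ G v w ⟧) M ⟩
      # (G v) * M                                        ≤⟨ *-monoˡ-≤ M (deg v) ⟩
      R * M                                              ∎

  bagOf : (Fin (N * M) → Bool) → Fin N → Fin (N * M) → Bool
  bagOf U v x = U x ∧ (cell N M x == v)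

  good : (Fin (N * M) → Bool) → Fin N → Bool
  good U v = M ≤ᵇ 4 * # (bagOf U v)

  -- A good cell has at most `M` vertices in `U` and any other cell fewer than `M / 4`, while half
  -- of all vertices lie in `U`.
  many-good : 0 < M → ∀ U → N * M ≤ 2 * # U → N ≤ 4 * # (good U)
  many-good 0<M U half = *-cancelʳ-≤ N (4 * # (good U)) M {{>-nonZero 0<M}} (+-cancelʳ-≤ (N * M) _ _ (begin
    N * M + N * M                                ≤⟨ +-mono-≤ half half ⟩
    2 * # U + 2 * # U                            ≡⟨ alg (# U) ⟩
    # U * 4                                      ≡⟨ cong (_* 4) (sym (#-fibres U (cell N M))) ⟩
    ∑ (λ v → # (bagOf U v)) * 4                  ≡⟨ sym (Σl-* (allFin N) (λ v → # (bagOf U v)) 4) ⟩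
    ∑ (λ v → # (bagOf U v) * 4)                  ≤⟨ ∑-mono pt ⟩
    ∑ (λ v → ⟦ good U v ⟧ * (4 * M) + M)         ≡⟨ Σl-+ (allFin N) _ _ ⟩
    ∑ (λ v → ⟦ good U v ⟧ * (4 * M)) + ∑ {N} (λ _ → M) ≡⟨ cong₂ _+_ (trans (Σl-* (allFin N) (λ v → ⟦ good U v ⟧) (4 * M)) (alg′ (# (good U)) M)) (∑-const {N} M) ⟩
    4 * # (good U) * M + N * M                   ∎))
    where
    open ≤-Reasoning
    alg : ∀ u → 2 * u + 2 * u ≡ u * 4
    alg = solve-∀
    alg′ : ∀ g M → g * (4 * M) ≡ 4 * g * M
    alg′ = solve-∀
    pt : ∀ v → # (bagOf U v) * 4 ≤ ⟦ good U v ⟧ * (4 * M) + M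
    pt v with ≤ᵇ-cases M (4 * # (bagOf U v))
    ... | inj₁ (e , p) rewrite e = ≤-trans (≤-reflexive (*-comm (# (bagOf U v)) 4)) (≤-trans (*-monoʳ-≤ 4 (≤-trans (#-mono {Q = λ x → cell N M x == v} (λ x → ∧-snd {U x})) (#-cell M v)))
                                     (≤-trans (≤-reflexive (sym (+-identityʳ _))) (m≤m+n _ M)))
    ... | inj₂ (e , p) rewrite e = ≤-trans (≤-reflexive (*-comm (# (bagOf U v)) 4)) (<⇒≤ p)

-- The list holds both orientations of each edge, so every neighbour of `v` accounts for one pair
-- that starts and one that ends in `v`.
Σl-touches : ∀ {N R} (G : Fin N → Fin N → Bool) → (∀ {v w} → G v w ≡ true → G w v ≡ true) → (∀ v → # (G v) ≤ R) →
             (es : List (Fin N × Fin N)) (P? : ∀ e → Dec (G (proj₁ e) (proj₂ e) ≡ true)) →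
             es ≡ filter P? (cartesianProduct (allFin N) (allFin N)) →
             ∀ v → Σl es (λ (u , w) → ⟦ u == v ⟧ + ⟦ w == v ⟧) ≤ R + R
Σl-touches {N} {R} G G-sym deg es P? refl v = begin
  Σl es (λ (u , w) → ⟦ u == v ⟧ + ⟦ w == v ⟧)
    ≡⟨ trans (Σl-filter P? all _) (Σl-cartesianProduct (allFin N) (allFin N) _) ⟩
  ∑ (λ u → ∑ (λ w → ⟦ does (P? (u , w)) ⟧ * (⟦ u == v ⟧ + ⟦ w == v ⟧)))
    ≤⟨ ∑-mono (λ u → ∑-mono (λ w → pt u w)) ⟩
  ∑ (λ u → ∑ (λ w → ⟦ (u == v) ∧ G v w ⟧ + ⟦ G v u ∧ (w == v) ⟧))
    ≡⟨ trans (Σl-cong (allFin N) (λ u → Σl-+ (allFin N) _ _)) (Σl-+ (allFin N) _ _) ⟩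
  ∑ (λ u → # (λ w → (u == v) ∧ G v w)) + ∑ (λ u → # (λ w → G v u ∧ (w == v)))
    ≡⟨ cong₂ _+_ (∑-rectangle (_== v) (G v)) (∑-rectangle (G v) (_== v)) ⟩
  # (_== v) * # (G v) + # (G v) * # (_== v)
    ≡⟨ cong (λ k → k * # (G v) + # (G v) * k) (#-δʳ v) ⟩
  1 * # (G v) + # (G v) * 1
    ≡⟨ cong₂ _+_ (*-identityˡ (# (G v))) (*-identityʳ (# (G v))) ⟩
  # (G v) + # (G v) ≤⟨ +-mono-≤ (deg v) (deg v) ⟩
  R + R ∎
  where
  open ≤-Reasoning
  all = cartesianProduct (allFin N) (allFin N)
  pt : ∀ u w → ⟦ does (P? (u , w)) ⟧ * (⟦ u == v ⟧ + ⟦ w == v ⟧) ≤ ⟦ (u == v) ∧ G v w ⟧ + ⟦ G v u ∧ (w == v) ⟧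
  pt u w with P? (u , w)
  ... | no _  = z≤n
  ... | yes p = ≤-trans (≤-reflexive (+-identityʳ _)) (+-mono-≤
          (⟦⟧-mono (λ e → ∧-intro e (subst (λ z → G z w ≡ true) (==⇒≡ {x = u} {v} e) p)))
          (⟦⟧-mono (λ e → ∧-intro (subst (λ z → G z u ≡ true) (==⇒≡ {x = w} {v} e) (G-sym p)) e)))

-- Monochromatic and pairwise homogeneous bags

record Cleaned (t : ℕ) {S N V : ℕ} (cellOf : Fin V → Fin N) (U : Fin V → Bool) (c : Fin V → Fin V → Fin S)
               (G : Fin N → Fin N → Bool) (cs : List (Fin S)) (w : ℕ) : Set where
  field
    blue   : Fin S
    blue∈  : blue ∈ cs
    W      : Fin N → Bool
    w<W    : w < # W
    K      : Fin N → List (Fin V)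
    K-size : ∀ {v} → W v ≡ true → suc t ≤ length (K v)
    K-uniq : ∀ {v} → W v ≡ true → Unique (K v)
    K⊆     : ∀ {v x} → W v ≡ true → x ∈ K v → U x ≡ true × cellOf x ≡ v
    -- Ramsey's theorem fixes the colour of a pair in list order only, so either orientation may be
    -- the known one. Symmetry of `c` enters in `blueTree`.
    K-mono : ∀ {v x y} → W v ≡ true → x ∈ K v → y ∈ K v → x ≢ y → c x y ≡ blue ⊎ c y x ≡ blue
    K-hom  : ∀ {u v} → W u ≡ true → W v ≡ true → G u v ≡ true →
             ∃[ b ] (∀ {x y} → x ∈ K u → y ∈ K v → (c x y == blue) ≡ b)

module Cleaning {N : ℕ} (G : Fin N → Fin N → Bool) (G-sym : ∀ {v w} → G v w ≡ true → G w v ≡ true)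
                (G-irr : ∀ {v} → G v v ≡ false) {R : ℕ} (deg : ∀ v → # (G v) ≤ R) (t ℓ : ℕ) where

  -- After Ramsey's theorem `tower t (R + R)` vertices must be left, because cleaning costs a bag
  -- one level for each of the up to `R + R` pairs that touch it.
  bagLength : ℕ
  bagLength = chainLength ℓ (suc (ℓ * tower t (R + R)))

  M : ℕ
  M = 4 * bagLength

  open CliqueBlowup M G

  module _ {S : ℕ} (U : Fin (N * M) → Bool) (c : Fin (N * M) → Fin (N * M) → Fin S) (cs : List (Fin S))
           (cs≤ : length cs ≤ ℓ) (half : N * M ≤ 2 * # U)
           (ok : ∀ {x y} → U x ≡ true → U y ≡ true → blow x y ≡ true → c x y ∈ cs) where

    MonoBag : Fin N → Fin S → List (Fin (N * M)) → Set
    MonoBag v i ks = i ∈ cs × ks ⊆ members (bagOf U v) × tower t (R + R) ≤ length ks × AllPairs (λ x y → c x y ≡ i) ks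

    bag∈ : ∀ {v x} → x ∈ members (bagOf U v) → U x ≡ true × cell N M x ≡ v
    bag∈ {v} {x} i = let h = ∈-members⁻ (bagOf U v) i in ∧-fst h , ==⇒≡ {x = cell N M x} {v} (∧-snd {U x} h)

    monoBag : ∀ v → good U v ≡ true → ∃[ i ] ∃[ ks ] MonoBag v i ks
    monoBag v gv =
      let (i , i∈ , ks , s , k , ps) = ramsey c cs ℓ cs≤ (tower t (R + R)) pairs long
      in i , ks , i∈ , s , k , ps
      where
      pairs : AllPairs (λ x y → c x y ∈ cs) (members (bagOf U v))
      pairs = Unique⇒AllPairs (members-unique (bagOf U v)) λ p q ne →
        let (Ux , ex) = bag∈ p ; (Uy , ey) = bag∈ q in ok Ux Uy (blow-inner ne (trans ex (sym ey)))
      long : bagLength ≤ length (members (bagOf U v))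
      long = subst (bagLength ≤_) (sym (length-members (bagOf U v)))
               (*-cancelˡ-≤ 4 (≤ᵇ⇒≤ M (4 * # (bagOf U v)) (Equivalence.from T-≡ gv)))

    -- Cells that are not good receive dummy values; `i₀` is later the colour of some good cell, as
    -- `Fin S` could be empty.
    totalBag : Fin S → ∀ v → ∃[ i ] ∃[ ks ] (good U v ≡ true → MonoBag v i ks)
    totalBag i₀ v with bool? (good U v)
    ... | inj₁ g = let (i , ks , h) = monoBag v g in i , ks , λ _ → h
    ... | inj₂ b = i₀ , [] , λ g → ⊥-elim (true≢false g b)

    cleaned : ∀ w → ℓ * w < # (good U) → Cleaned t (cell N M) U c G cs w
    cleaned w lt = finish (#-pigeonhole κ w cs (good U) (λ {v} g → proj₁ (proj₂ (proj₂ (bags v)) g)) (≤-<-trans (*-monoˡ-≤ w cs≤) lt))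
      where
      v₀ = #-pos (good U) (≤-<-trans z≤n lt)
      bags = totalBag (proj₁ (monoBag (proj₁ v₀) (proj₂ v₀)))
      κ : Fin N → Fin S
      κ v = proj₁ (bags v)
      K₀ : Fin N → List (Fin (N * M))
      K₀ v = proj₁ (proj₂ (bags v))
      finish : ∃[ i ] (i ∈ cs × w < # (λ v → good U v ∧ (κ v == i))) → Cleaned t (cell N M) U c G cs w
      finish (blue , blue∈ , w<W) = record
        { blue = blue ; blue∈ = blue∈ ; W = W ; w<W = w<W ; K = K
        ; K-size = K-size
        ; K-uniq = λ {v} Wv → AllPairs-resp-⊆ (⊆-trans (K⊆K₀ v) (proj₁ (proj₂ (bag Wv)))) (members-unique (bagOf U v))
        ; K⊆ = λ {v} Wv i → bag∈ (⊆-lookup (⊆-trans (K⊆K₀ v) (proj₁ (proj₂ (bag Wv)))) i)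
        ; K-mono = λ {v} Wv i j ne → AllPairs⇒either (AllPairs-resp-⊆ (K⊆K₀ v) (blueBag Wv)) i j ne
        ; K-hom = λ {u} {v} Wu Wv Guv → All.lookup homs (∈-filter⁺ P? (∈-cartesianProduct⁺ (∈-allFin u) (∈-allFin v)) (∧-intro Wu (∧-intro Wv Guv)))
        }
        where
        W : Fin N → Bool
        W v = good U v ∧ (κ v == blue)
        bag : ∀ {v} → W v ≡ true → MonoBag v (κ v) (K₀ v)
        bag {v} Wv = proj₂ (proj₂ (bags v)) (∧-fst {good U v} Wv)
        blueBag : ∀ {v} → W v ≡ true → AllPairs (λ x y → c x y ≡ blue) (K₀ v)
        blueBag {v} Wv = subst (λ i → AllPairs (λ x y → c x y ≡ i) (K₀ v)) (==⇒≡ {x = κ v} (∧-snd {good U v} Wv)) (proj₂ (proj₂ (proj₂ (bag Wv))))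
        -- Cleaning is confined to edges inside `W`, since elsewhere a bag may be a dummy or of
        -- another colour.
        GW : Fin N → Fin N → Bool
        GW u v = W u ∧ (W v ∧ G u v)
        GW-sym : ∀ {u v} → GW u v ≡ true → GW v u ≡ true
        GW-sym {u} {v} h = ∧-intro (∧-fst {W v} (∧-snd {W u} h)) (∧-intro (∧-fst {W u} h) (G-sym (∧-snd {W v} (∧-snd {W u} h))))
        P? : ∀ e → Dec (GW (proj₁ e) (proj₂ e) ≡ true)
        P? e = GW (proj₁ e) (proj₂ e) Boolₚ.≟ true
        es = filter P? (cartesianProduct (allFin N) (allFin N))
        isProper : All (Proper (λ x y → c x y == blue) t W) es
        isProper = All.map (λ {(u , v)} h →
            (λ { refl → true≢false (∧-snd {W u} (∧-snd {W u} h)) G-irr }) , ∧-fst {W u} h , ∧-fst {W v} (∧-snd {W u} h))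
          (Allₚ.all-filter P? (cartesianProduct (allFin N) (allFin N)))
        result = clean (λ x y → c x y == blue) t W es K₀ isProper
          (λ {v} Wv → ≤-trans (tower-mono t (Σl-touches GW GW-sym (λ v → ≤-trans (#-mono (λ u h → ∧-snd {W u} (∧-snd {W v} h))) (deg v)) es P? refl v))
                        (proj₁ (proj₂ (proj₂ (bag Wv)))))
        K : Fin N → List (Fin (N * M))
        K = proj₁ result
        K⊆K₀ : ∀ v → K v ⊆ K₀ v
        K⊆K₀ = proj₁ (proj₂ result)
        K-size : ∀ {v} → W v ≡ true → suc t ≤ length (K v)
        K-size = proj₁ (proj₂ (proj₂ result))
        homs = proj₂ (proj₂ (proj₂ result))

-- The induction step: a blue tree or a copy without blue

headOr : A → List A → A
headOr d []      = d
headOr d (x ∷ _) = x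

headOr-∈ : ∀ (d : A) {xs} → 0 < length xs → headOr d xs ∈ xs
headOr-∈ d {x ∷ xs} _ = here refl

element : ∀ {xs : List A} → 0 < length xs → ∃[ x ] (x ∈ xs)
element {xs = x ∷ xs} _ = x , here refl

module Arrow (D t S s C₁ R₁ : ℕ) {n : ℕ} (host : HostAt D t S C₁ R₁ s n)
  {N V : ℕ} (cellOf : Fin V → Fin N) (E : Fin (HostAt.order host) → Fin N → Bool)
  (meets : ∀ X Y → n ≤ 2 * suc R₁ * # X → n ≤ # Y → ∃[ x ] ∃[ y ] (X x ≡ true × Y y ≡ true × E x y ≡ true))
  (adj : Fin V → Fin V → Bool)
  (inner : ∀ {x y} → x ≢ y → cellOf x ≡ cellOf y → adj x y ≡ true)
  (outer : ∀ {x y} → x ≢ y → Transfer.transfer (HostAt.adj host) (HostAt.adj-sym host) E (cellOf x) (cellOf y) ≡ true → adj x y ≡ true)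
  (U : Fin V → Bool) (c : Fin V → Fin V → Fin S) (cs : List (Fin S)) (cs≤ : length cs ≤ suc s)
  (ok : ∀ {x y} → U x ≡ true → U y ≡ true → adj x y ≡ true → c x y ≡ c y x × c x y ∈ cs)
  (cl : Cleaned t cellOf U c (Transfer.transfer (HostAt.adj host) (HostAt.adj-sym host) E) cs (suc R₁ * ((2 + D) * (C₁ * n + n + 2 * n))))
  (T : RootedTree n D) where

  open HostAt host using () renaming (order to N₁; adj to F; adj-sym to F-sym; adj-irr to F-irr; deg to F-deg; n≤order to n≤N₁; order≤ to N₁≤; arrows to F-arrows)
  open Transfer F F-sym E
  open Cleaned cl
  open RootedTree T

  private
    v₁ = #-pos W (≤-<-trans z≤n w<W)
    x₀ : Fin V
    x₀ = proj₁ (element {xs = K (proj₁ v₁)} (≤-trans (s≤s z≤n) (K-size (proj₂ v₁))))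

  rep : Fin N → Fin V
  rep v = headOr x₀ (K v)

  rep∈ : ∀ {v} → W v ≡ true → rep v ∈ K v
  rep∈ {v} Wv = headOr-∈ x₀ {K v} (≤-trans (s≤s z≤n) (K-size Wv))

  -- By `K-hom` one pair of representatives decides whether all pairs between two joined bags are
  -- blue.
  Γ : Fin N → Fin N → Bool
  Γ v w = W v ∧ (W w ∧ (transfer v w ∧ (c (rep v) (rep w) == blue)))

  disjoint : ∀ {v w x y} → W v ≡ true → W w ≡ true → v ≢ w → x ∈ K v → y ∈ K w → x ≢ y
  disjoint Wv Ww ne i j refl = ne (trans (sym (proj₂ (K⊆ Wv i))) (proj₂ (K⊆ Ww j)))

  adj-outer : ∀ {v w x y} → W v ≡ true → W w ≡ true → transfer v w ≡ true → x ∈ K v → y ∈ K w → adj x y ≡ true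
  adj-outer {v} {w} Wv Ww h i j = outer
    (disjoint Wv Ww (λ { refl → true≢false h (transfer-irr {v}) }) i j)
    (subst₂ (λ a b → transfer a b ≡ true) (sym (proj₂ (K⊆ Wv i))) (sym (proj₂ (K⊆ Ww j))) h)

  blueTree : TreeIn Γ W T → ∃[ i ] Blowup D t S adj c U T i
  blueTree (f , inj , f∈ , edge) = blue , (λ a → K (f a)) , (λ a → K-size (f∈ a)) , (λ a → K-uniq (f∈ a)) ,
    (λ {a} {b} i j → inj (trans (sym (proj₂ (K⊆ (f∈ a) i))) (proj₂ (K⊆ (f∈ b) j)))) ,
    (λ {a} i → proj₁ (K⊆ (f∈ a) i)) , same , up
    where
    same : ∀ {a x y} → x ∈ K (f a) → y ∈ K (f a) → x ≢ y → adj x y ≡ true × c x y ≡ blue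
    same {a} {x} {y} i j ne with K-mono (f∈ a) i j ne
    ... | inj₁ e = adjxy , e
      where adjxy = inner ne (trans (proj₂ (K⊆ (f∈ a) i)) (sym (proj₂ (K⊆ (f∈ a) j))))
    ... | inj₂ e = adjxy , trans (proj₁ (ok (proj₁ (K⊆ (f∈ a) i)) (proj₁ (K⊆ (f∈ a) j)) adjxy)) e
      where adjxy = inner ne (trans (proj₂ (K⊆ (f∈ a) i)) (sym (proj₂ (K⊆ (f∈ a) j))))
    up : ∀ {a x y} → a ≢ root → x ∈ K (f (par a)) → y ∈ K (f a) → adj x y ≡ true × c x y ≡ blue
    up {a} {x} {y} ne i j = adj-outer Wv Ww G i j ,
      ==⇒≡ {x = c x y} (trans (proj₂ hom i j) (trans (sym (proj₂ hom (rep∈ Wv) (rep∈ Ww))) (∧-snd {transfer v w} h₃)))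
      where
      v = f (par a)
      w = f a
      Wv = f∈ (par a)
      Ww = f∈ a
      h₃ : transfer v w ∧ (c (rep v) (rep w) == blue) ≡ true
      h₃ = ∧-snd {W w} (∧-snd {W v} (edge ne))
      G : transfer v w ≡ true
      G = ∧-fst h₃
      hom = K-hom Wv Ww G

  module Avoiding (X : Fin (suc R₁) → Fin N → Bool) (X⊆W : ∀ i → X i ⊆ᵇ W) (large : ∀ i → C₁ * n + n ≤ # (X i))
    (sep : ∀ {i j} → i ≢ j → ∀ {x y} → X i x ≡ true → X j y ≡ true → Γ x y ≡ false ⊎ Γ y x ≡ false) where

    private
      colouring = properColouring F F-sym (λ {x} → F-irr {x}) F-deg
    χ : Fin N₁ → Fin (suc R₁)
    χ = proj₁ colouring

    E′ : Fin N₁ → Fin N → Bool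
    E′ x y = E x y ∧ X (χ x) y

    open Matching (greedyMatching E′ (proj₁ v₁) (allFin N₁))

    unmatched-class : ∀ i → 2 * suc R₁ * # (λ x → not (matched x) ∧ (χ x == i)) ≤ n
    unmatched-class i = ≮⇒≥ (λ lt → clash (meets (λ x → not (matched x) ∧ (χ x == i)) (λ y → X i y ∧ not (used y)) (<⇒≤ lt) free))
      where
      open ≤-Reasoning
      free : n ≤ # (λ y → X i y ∧ not (used y))
      free = +-cancelˡ-≤ (C₁ * n) _ _ (begin
        C₁ * n + n                                              ≤⟨ large i ⟩
        # (X i)                                                 ≡⟨ #-split (X i) used ⟩
        # (λ y → X i y ∧ used y) + # (λ y → X i y ∧ not (used y)) ≤⟨ +-monoˡ-≤ _ (≤-trans (#-mono {Q = used} (λ y → ∧-snd {X i y})) (≤-trans used≤ (≤-trans (≤-reflexive (length-allFin N₁)) N₁≤))) ⟩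
        C₁ * n + # (λ y → X i y ∧ not (used y))                 ∎)
      clash : ∃[ x ] ∃[ y ] ((not (matched x) ∧ (χ x == i)) ≡ true × (X i y ∧ not (used y)) ≡ true × E x y ≡ true) → ⊥
      clash (x , y , p , q , e) = true≢false
        (maximal (∈-allFin x) (not-true (∧-fst p)) (∧-intro e (subst (λ j → X j y ≡ true) (sym (==⇒≡ {x = χ x} {i} (∧-snd {not (matched x)} p))) (∧-fst q))))
        (not-true (∧-snd {X i y} q))

    unmatched-few : 2 * # (λ x → not (matched x)) ≤ n
    unmatched-few = *-cancelˡ-≤ (suc R₁) (begin
      suc R₁ * (2 * # (λ x → not (matched x)))          ≡⟨ alg (suc R₁) (# (λ x → not (matched x))) ⟩
      # (λ x → not (matched x)) * (2 * suc R₁)          ≡⟨ cong (_* (2 * suc R₁)) (sym (#-fibres (λ x → not (matched x)) χ)) ⟩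
      ∑ (λ i → # (λ x → not (matched x) ∧ (χ x == i))) * (2 * suc R₁) ≡⟨ sym (Σl-* (allFin (suc R₁)) (λ i → # (λ x → not (matched x) ∧ (χ x == i))) (2 * suc R₁)) ⟩
      ∑ (λ i → # (λ x → not (matched x) ∧ (χ x == i)) * (2 * suc R₁)) ≤⟨ ∑-bound {suc R₁} (λ i → ≤-trans (≤-reflexive (*-comm (# (λ x → not (matched x) ∧ (χ x == i))) (2 * suc R₁))) (unmatched-class i)) ⟩
      suc R₁ * n                                        ∎)
      where
      open ≤-Reasoning
      alg : ∀ r m → r * (2 * m) ≡ m * (2 * r)
      alg = solve-∀

    half-matched : N₁ ≤ 2 * # matched
    half-matched = +-cancelʳ-≤ N₁ _ _ (begin
      N₁ + N₁                                           ≡⟨ cong (N₁ +_) (sym (+-identityʳ N₁)) ⟩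
      2 * N₁                                            ≡⟨ cong (2 *_) (trans (sym (#-true {N₁})) (#-split (λ _ → true) matched)) ⟩
      2 * (# matched + # (λ x → not (matched x)))       ≡⟨ *-distribˡ-+ 2 (# matched) _ ⟩
      2 * # matched + 2 * # (λ x → not (matched x))     ≤⟨ +-monoʳ-≤ (2 * # matched) (≤-trans unmatched-few n≤N₁) ⟩
      2 * # matched + N₁                                ∎)
      where open ≤-Reasoning

    ψ : Fin N₁ → Fin V
    ψ x = rep (φ x)

    φ∈X : ∀ {x} → matched x ≡ true → X (χ x) (φ x) ≡ true
    φ∈X {x} h = ∧-snd {E x (φ x)} (φ-edge h)

    Wφ : ∀ {x} → matched x ≡ true → W (φ x) ≡ true
    Wφ {x} h = X⊆W (χ x) (φ x) (φ∈X h)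

    ψ∈ : ∀ {x} → matched x ≡ true → ψ x ∈ K (φ x)
    ψ∈ h = rep∈ (Wφ h)

    ψ-inj : ∀ {x y} → matched x ≡ true → matched y ≡ true → ψ x ≡ ψ y → x ≡ y
    ψ-inj hx hy e = φ-inj hx hy (trans (sym (proj₂ (K⊆ (Wφ hx) (ψ∈ hx)))) (trans (cong cellOf e) (proj₂ (K⊆ (Wφ hy) (ψ∈ hy)))))

    ψU : ∀ {x} → matched x ≡ true → U (ψ x) ≡ true
    ψU h = proj₁ (K⊆ (Wφ h) (ψ∈ h))

    φ-transfer : ∀ {x y} → matched x ≡ true → matched y ≡ true → F x y ≡ true → transfer (φ x) (φ y) ≡ true
    φ-transfer {x} {y} hx hy Fxy = ∧-intro
      (cong not (≢⇒== (λ e → true≢false (subst (λ z → F x z ≡ true) (sym (φ-inj hx hy e)) Fxy) F-irr)))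
      (link-intro (∧-fst (φ-edge hx)) Fxy (∧-fst (φ-edge hy)))

    ψ-adj : ∀ {x y} → matched x ≡ true → matched y ≡ true → F x y ≡ true → adj (ψ x) (ψ y) ≡ true
    ψ-adj hx hy Fxy = adj-outer (Wφ hx) (Wφ hy) (φ-transfer hx hy Fxy) (ψ∈ hx) (ψ∈ hy)

    ψ-sym : ∀ {x y} → matched x ≡ true → matched y ≡ true → F x y ≡ true → c (ψ x) (ψ y) ≡ c (ψ y) (ψ x)
    ψ-sym hx hy Fxy = proj₁ (ok (ψU hx) (ψU hy) (ψ-adj hx hy Fxy))

    notΓ : ∀ {x y} → matched x ≡ true → matched y ≡ true → F x y ≡ true → Γ (φ x) (φ y) ≡ false → c (ψ x) (ψ y) ≢ blue
    notΓ {x} {y} hx hy Fxy h e = true≢false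
      (∧-intro (Wφ hx) (∧-intro (Wφ hy) (∧-intro (φ-transfer hx hy Fxy) (subst (λ i → (c (ψ x) (ψ y) == i) ≡ true) e (==-refl (c (ψ x) (ψ y))))))) h

    -- Adjacent vertices of `F` have different colours under `χ` and are matched into different sets
    -- of the family. `Γ` lacks the edge between their images in one direction, which suffices by
    -- the symmetry of `c`.
    not-blue : ∀ {x y} → matched x ≡ true → matched y ≡ true → F x y ≡ true → c (ψ x) (ψ y) ≢ blue
    not-blue {x} {y} hx hy Fxy with sep (proj₂ colouring Fxy) (φ∈X hx) (φ∈X hy)
    ... | inj₁ h = notΓ hx hy Fxy h
    ... | inj₂ h = λ e → notΓ hy hx (F-sym Fxy) h (trans (sym (ψ-sym hx hy Fxy)) e)

    cs′ : List (Fin S)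
    cs′ = filter (λ i → ¬? (i ≟ blue)) cs

    cs′≤ : length cs′ ≤ s
    cs′≤ = s≤s⁻¹ (≤-trans (filter-notAll (λ i → ¬? (i ≟ blue)) cs (Any.map (λ e ne → ne (sym e)) blue∈)) cs≤)

    -- The colouring pulled back along `ψ` avoids blue on the matched vertices, which are at least
    -- half of `F`. The copy found there is carried back by the injectivity of `ψ`.
    fewerColours : ∃[ i ] Blowup D t S adj c U T i
    fewerColours =
      let (i , K₁ , size , uniq , disj , K₁∈ , same , up) =
            F-arrows matched (λ x y → c (ψ x) (ψ y)) cs′ cs′≤ half-matched
              (λ hx hy Fxy → ψ-sym hx hy Fxy ,
                ∈-filter⁺ (λ i → ¬? (i ≟ blue)) (proj₂ (ok (ψU hx) (ψU hy) (ψ-adj hx hy Fxy))) (not-blue hx hy Fxy)) T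
      in i , (λ a → map ψ (K₁ a)) ,
         (λ a → ≤-trans (size a) (≤-reflexive (sym (length-map ψ (K₁ a))))) ,
         (λ a → Unique-map ψ (uniq a) (λ p q → ψ-inj (K₁∈ p) (K₁∈ q))) ,
         (λ {a} {b} p q → let (x , x∈ , e) = ∈-map⁻ ψ p ; (y , y∈ , e′) = ∈-map⁻ ψ q
                  in disj x∈ (subst (_∈ K₁ b) (ψ-inj (K₁∈ y∈) (K₁∈ x∈) (trans (sym e′) e)) y∈)) ,
         (λ p → let (x , x∈ , e) = ∈-map⁻ ψ p in subst (λ z → U z ≡ true) (sym e) (ψU (K₁∈ x∈))) ,
         (λ p q ne → let (x , x∈ , e) = ∈-map⁻ ψ p ; (y , y∈ , e′) = ∈-map⁻ ψ q
                         (Fxy , col) = same x∈ y∈ (λ x≡y → ne (trans e (trans (cong ψ x≡y) (sym e′))))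
                     in subst₂ (λ z w → adj z w ≡ true × c z w ≡ i) (sym e) (sym e′) (ψ-adj (K₁∈ x∈) (K₁∈ y∈) Fxy , col)) ,
         (λ ne p q → let (x , x∈ , e) = ∈-map⁻ ψ p ; (y , y∈ , e′) = ∈-map⁻ ψ q
                         (Fxy , col) = up ne x∈ y∈
                     in subst₂ (λ z w → adj z w ≡ true × c z w ≡ i) (sym e) (sym e′) (ψ-adj (K₁∈ x∈) (K₁∈ y∈) Fxy , col))

  monochromatic : ∃[ i ] Blowup D t S adj c U T i
  -- There is one set for each colour of `χ`. Of the size `C₁ * n + n`, the part `C₁ * n` may be
  -- used up by the matching and the rest remains for `meets`.
  monochromatic with Peeling.peel Γ T (suc R₁) W (C₁ * n + n) w<W
  ... | inj₁ tree = blueTree tree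
  ... | inj₂ (X , X⊆W , large , sep) = Avoiding.fewerColours X X⊆W large sep

hostStep : ∀ {D t S s} → Host D t S s → Host D t S (suc s)
hostStep {D} {t} {S} {s} (C₁ , R₁ , hosts) = L * M , M + Rg * M , λ n 0<n → at n 0<n (hosts n 0<n)
  where
  -- Peeling needs more than ω n blue bags, and at least one in 4 (s + 1) of the L n bags is blue.
  ω L τ Rg M : ℕ
  ω  = suc R₁ * ((2 + D) * (C₁ + 3))
  L  = 4 * suc (suc s * ω)
  τ  = meetBound R₁ C₁ L
  Rg = τ * (R₁ * τ)
  -- This is `Cleaning.M` for the degree `Rg` and `suc s` colours; the factor `4` is there because a
  -- good cell keeps only a quarter of its vertices.
  M  = 4 * chainLength (suc s) (suc (suc s * tower t (Rg + Rg)))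
  at : ∀ n → 0 < n → HostAt D t S C₁ R₁ s n → HostAt D t S (L * M) (M + Rg * M) (suc s) n
  at n 0<n host = record
    { order   = N₂ * M
    ; n≤order = ≤-trans (m≤n*m n L) (m≤m*n N₂ M)
    ; order≤  = ≤-reflexive (alg L n M)
    ; adj     = blow
    ; adj-sym = blow-sym transfer-sym
    ; adj-irr = blow-irr
    ; deg     = blow-deg g-deg
    ; arrows  = λ U c cs cs≤ half ok T → Arrow.monochromatic D t S s C₁ R₁ host (cell N₂ M) E meets blow
                  blow-inner blow-outer U c cs cs≤ ok
                  (Cleaning.cleaned transfer transfer-sym (λ {v} → transfer-irr {v}) g-deg t (suc s) U c cs cs≤ half (λ p q r → proj₂ (ok p q r))
                    (suc R₁ * ((2 + D) * (C₁ * n + n + 2 * n))) (enough (many-good (s≤s z≤n) U half)))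
                  T
    }
    where
    N₂ : ℕ
    N₂ = L * n
    open HostAt host using () renaming (order to N₁; adj to F; adj-sym to F-sym; deg to F-deg; n≤order to n≤N₁; order≤ to N₁≤)
    expander = bipartiteExpander R₁ C₁ L {n} {N₁} {N₂} 0<n
      (*-mono-≤ (≤-trans 0<n n≤N₁) (≤-trans 0<n (m≤n*m n L))) N₁≤ ≤-refl
    E : Fin N₁ → Fin N₂ → Bool
    E = proj₁ expander
    meets = proj₂ (proj₂ (proj₂ expander))
    open Transfer F F-sym E
    g-deg : ∀ v → # (transfer v) ≤ Rg
    g-deg = transfer-deg F-deg (proj₁ (proj₂ expander)) (proj₁ (proj₂ (proj₂ expander)))
    open CliqueBlowup M transfer
    alg : ∀ L n M → L * n * M ≡ L * M * n
    alg = solve-∀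
    enough : ∀ {g} → N₂ ≤ 4 * g → suc s * (suc R₁ * ((2 + D) * (C₁ * n + n + 2 * n))) < g
    enough {g} h = *-cancelˡ-≤ 4 (begin
      4 * suc (suc s * (suc R₁ * ((2 + D) * (C₁ * n + n + 2 * n))))  ≤⟨ *-monoʳ-≤ 4 (+-monoˡ-≤ _ 0<n) ⟩
      4 * (n + suc s * (suc R₁ * ((2 + D) * (C₁ * n + n + 2 * n))))  ≡⟨ alg′ n (suc s) (suc R₁) (2 + D) C₁ ⟩
      N₂                                                              ≤⟨ h ⟩
      4 * g                                                          ∎)
      where
      open ≤-Reasoning
      alg′ : ∀ n s R D C → 4 * (n + s * (R * (D * (C * n + n + 2 * n)))) ≡ 4 * suc (s * (R * (D * (C + 3)))) * n
      alg′ = solve-∀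

hostFor : ∀ D t S s → Host D t S s
hostFor D t S zero    = host₀ D t S
hostFor D t S (suc s) = hostStep (hostFor D t S s)

lookup-injective : ∀ {A : Set} {xs : List A} → Unique xs → ∀ {i j} → lookup xs i ≡ lookup xs j → i ≡ j
lookup-injective (p ∷ u) {zero}  {zero}  e = refl
lookup-injective {xs = x ∷ xs} (p ∷ u) {zero}  {suc j} e = ⊥-elim (All.lookup p (∈-lookup {xs = xs} j) e)
lookup-injective {xs = x ∷ xs} (p ∷ u) {suc i} {zero}  e = ⊥-elim (All.lookup p (∈-lookup {xs = xs} i) (sym e))
lookup-injective (p ∷ u) {suc i} {suc j} e = cong suc (lookup-injective u e)

-- Simple paths

module Trails {n : ℕ} (A : Fin n → Fin n → Set) where

  open DecMembership (_≟_ {n}) using (_∈?_)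

  data Trail : Fin n → Fin n → List (Fin n) → Set where
    stop : ∀ {x} → Trail x x (x ∷ [])
    step : ∀ {x y z ys} → A x y → Trail y z ys → Trail x z (x ∷ ys)

  suffix : ∀ {x y z zs} → x ∈ zs → Trail y z zs → Unique zs → ∃[ ws ] (Unique ws × Trail x z ws)
  suffix (here refl) stop       u       = _ , u , stop
  suffix (here refl) (step a t) u       = _ , u , step a t
  suffix (there i)   (step a t) (_ ∷ u) = suffix i t u

  -- Loop erasure: if the start recurs in the simplified rest, the trail is cut down to the suffix
  -- that begins there.
  simple : ∀ {x z ys} → Trail x z ys → ∃[ zs ] (Unique zs × Trail x z zs)
  simple stop = _ , [] ∷ [] , stop
  simple (step {x} a t) with simple t
  ... | zs , u , t′ with x ∈? zs
  ...   | yes i = suffix i t′ u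
  ...   | no ni = x ∷ zs , All.tabulate (λ j e → ni (subst (_∈ zs) (sym e) j)) ∷ u , step a t′

  append : ∀ {x y z ys zs} → Trail x y ys → Trail y z zs → ∃[ ws ] Trail x z ws
  append stop       t′ = _ , t′
  append (step a t) t′ = _ , step a (proj₂ (append t t′))

  snoc : ∀ {x y z ys} → Trail x y ys → A y z → ∃[ ws ] Trail x z ws
  snoc t a = append t (step a stop)

  trail-edge : ∀ {x z ys} → Trail x z (x ∷ ys) → ∀ (i : Fin (length ys)) →
               A (lookup (x ∷ ys) (inject₁ i)) (lookup (x ∷ ys) (suc i))
  trail-edge {ys = y ∷ ys} (step a stop)       zero    = a
  trail-edge {ys = y ∷ ys} (step a (step b t)) zero    = a
  trail-edge {ys = y ∷ ys} (step a (step b t)) (suc i) = trail-edge (step b t) i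

  trail-last : ∀ {x z ys} → Trail x z (x ∷ ys) → lookup (x ∷ ys) (fromℕ (length ys)) ≡ z
  trail-last stop                = refl
  trail-last (step a stop)       = refl
  trail-last (step a (step b t)) = trail-last (step b t)

-- Rooted trees

module Rooting {n : ℕ} (T : SimpleGraph n) (tree : IsTree T) (r : Fin n) where

  -- `par-r` lets iterated parents rest at `r`, so that ancestors exist at every height.
  record Spanning (E : Fin n → Bool) : Set where
    field
      par  : Fin n → Fin n
      dep  : Fin n → ℕ
      r∈   : E r ≡ true
      par-r : par r ≡ r
      up   : ∀ {v} → E v ≡ true → v ≢ r → E (par v) ≡ true × Adj T v (par v) × dep v ≡ suc (dep (par v))

  crossing : ∀ (E : Fin n → Bool) ℓ (p : Fin (suc ℓ) → Fin n) → E (p zero) ≡ true → E (p (fromℕ ℓ)) ≡ false →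
             (∀ i → Adj T (p (inject₁ i)) (p (suc i))) → ∃[ w ] ∃[ u ] (E w ≡ true × E u ≡ false × Adj T w u)
  crossing E zero    p h₀ h₁ a = ⊥-elim (true≢false h₀ h₁)
  crossing E (suc ℓ) p h₀ h₁ a with bool? (E (p (suc zero)))
  ... | inj₁ h = crossing E ℓ (p ∘ suc) h h₁ (a ∘ suc)
  ... | inj₂ h = p zero , p (suc zero) , h₀ , h , a zero

  hang : ∀ {E} → Spanning E → ∀ {w u} → E w ≡ true → E u ≡ false → Adj T w u → Spanning (λ v → E v ∨ (u == v))
  hang {E} sp {w} {u} Ew Eu a = record
    { par = par⁺ ; dep = dep⁺ ; r∈ = ∨-introˡ _ r∈
    ; par-r = trans (old-par r∈) par-r
    ; up = up⁺ }
    where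
    open Spanning sp
    par⁺ : Fin n → Fin n
    par⁺ v = if u == v then w else par v
    dep⁺ : Fin n → ℕ
    dep⁺ v = if u == v then suc (dep w) else dep v
    u≢ : ∀ {v} → E v ≡ true → u ≢ v
    u≢ Ev refl = true≢false Ev Eu
    old-par : ∀ {v} → E v ≡ true → par⁺ v ≡ par v
    old-par Ev = if-false (≢⇒== (u≢ Ev))
    old-dep : ∀ {v} → E v ≡ true → dep⁺ v ≡ dep v
    old-dep Ev = if-false (≢⇒== (u≢ Ev))
    up⁺ : ∀ {v} → E v ∨ (u == v) ≡ true → v ≢ r →
          (E (par⁺ v) ∨ (u == par⁺ v)) ≡ true × Adj T v (par⁺ v) × dep⁺ v ≡ suc (dep⁺ (par⁺ v))
    up⁺ {v} h ne with ∨-elim {E v} h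
    ... | inj₁ Ev = let (p , q , d) = up Ev ne in
          ∨-introˡ _ (trans (cong E (old-par Ev)) p) , subst (Adj T v) (sym (old-par Ev)) q ,
          trans (old-dep Ev) (trans d (cong suc (trans (sym (old-dep p)) (cong dep⁺ (sym (old-par Ev))))))
    ... | inj₂ e with ==⇒≡ {x = u} {v} e
    ...   | refl = ∨-introˡ _ (trans (cong E new-par) Ew) , subst (Adj T u) (sym new-par) (SimpleGraph.sym T a) ,
                   trans (if-true (==-refl u)) (cong suc (trans (sym (old-dep Ew)) (cong dep⁺ (sym new-par))))
      where
      new-par : par⁺ u ≡ w
      new-par = if-true (==-refl u)

  -- While a vertex is missing, the walk from `r` to it leaves `E` along some edge, and the far end
  -- of that edge is hung below the near one. `k` bounds the number of missing vertices.
  span : ∀ k {E} → Spanning E → n ≤ # E + k → ∃[ E′ ] (Spanning E′ × (∀ v → E′ v ≡ true))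
  span k {E} sp h with bool? (some (λ v → not (E v)))
  ... | inj₂ full = E , sp , λ v → not-injective (none (λ v → not (E v)) full v)
  span zero {E} sp h | inj₁ miss =
    ⊥-elim (<-irrefl refl (≤-trans (#-missing E (not-true (proj₂ (some-elim (λ v → not (E v)) miss)))) (≤-trans h (≤-reflexive (+-identityʳ _)))))
  span (suc k) {E} sp h | inj₁ miss with some-elim (λ v → not (E v)) miss
  ... | u , Eu with proj₁ tree r u
  ...   | ℓ , p , p₀ , p₁ , a with crossing E ℓ p (trans (cong E p₀) (Spanning.r∈ sp)) (trans (cong E p₁) (not-true Eu)) a
  ...     | w , u′ , Ew , Eu′ , b = span k (hang sp Ew Eu′ b) (≤-trans h (≤-trans (≤-reflexive (+-suc (# E) k)) (+-monoˡ-≤ k (#-insert-new E Eu′))))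

  private
    initial : Spanning (r ==_)
    initial = record { par = λ v → v ; dep = λ _ → 0 ; r∈ = ==-refl r ; par-r = refl
                     ; up = λ {v} e ne → ⊥-elim (ne (sym (==⇒≡ {x = r} {v} e))) }
    spanned = span n initial (m≤n+m n _)
    open Spanning (proj₁ (proj₂ spanned)) public using (par; dep; par-r)

  par-adj : ∀ {v} → v ≢ r → Adj T v (par v)
  par-adj {v} ne = proj₁ (proj₂ (Spanning.up (proj₁ (proj₂ spanned)) (proj₂ (proj₂ spanned) v) ne))

  dep-par : ∀ {v} → v ≢ r → dep v ≡ suc (dep (par v))
  dep-par {v} ne = proj₂ (proj₂ (Spanning.up (proj₁ (proj₂ spanned)) (proj₂ (proj₂ spanned) v) ne))

  TreeEdge : Fin n → Fin n → Set
  TreeEdge x y = (x ≢ r × par x ≡ y) ⊎ (y ≢ r × par y ≡ x)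

  treeEdge? : ∀ x y → Dec (TreeEdge x y)
  treeEdge? x y = (¬? (x ≟ r) ×-dec (par x ≟ y)) ⊎-dec (¬? (y ≟ r) ×-dec (par y ≟ x))

  treeEdge-adj : ∀ {x y} → TreeEdge x y → Adj T x y
  treeEdge-adj (inj₁ (ne , refl)) = par-adj ne
  treeEdge-adj (inj₂ (ne , refl)) = SimpleGraph.sym T (par-adj ne)

  open Trails TreeEdge

  toRoot : ∀ k v → dep v ≤ k → (∃[ ys ] Trail v r ys) × (∃[ ys ] Trail r v ys)
  toRoot k v d with v ≟ r
  ... | yes refl = (_ , stop) , (_ , stop)
  toRoot zero    v d | no ne = ⊥-elim (n≮0 (≤-trans (≤-reflexive (sym (dep-par ne))) d))
  toRoot (suc k) v d | no ne =
    let ((_ , t) , (_ , t′)) = toRoot k (par v) (s≤s⁻¹ (≤-trans (≤-reflexive (sym (dep-par ne))) d))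
    in (_ , step (inj₁ (ne , refl)) t) , snoc t′ (inj₂ (ne , refl))

  -- An edge outside the spanning tree closes a cycle with the tree path joining its ends.
  adj-treeEdge : ∀ {x y} → Adj T x y → TreeEdge x y
  adj-treeEdge {x} {y} a with treeEdge? x y
  ... | yes e = e
  ... | no ne with simple (proj₂ (append (proj₂ (proj₁ (toRoot (dep x) x ≤-refl))) (proj₂ (proj₂ (toRoot (dep y) y ≤-refl)))))
  -- A simple path with one vertex would make the edge a loop, one with two vertices is itself a
  -- tree edge, and a longer one closes a cycle.
  ...   | _ , u , stop                         = ⊥-elim (SimpleGraph.irr T a)
  ...   | _ , u , step e stop                  = ⊥-elim (ne e)
  ...   | _ , u , step {ys = ys} e (step {ys = []} e′ ())
  ...   | zs , u , t@(step e (step {ys = w ∷ ws} e′ t′)) =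
    ⊥-elim (proj₂ tree (length ws , lookup zs , lookup-injective u ,
      (λ i → treeEdge-adj (trail-edge t i)) ,
      subst (λ z → Adj T z x) (sym (trail-last t)) (SimpleGraph.sym T a)))

  -- Ancestors and the reduction from the power to bags

  anc : ℕ → Fin n → Fin n
  anc zero    v = v
  anc (suc h) v = anc h (par v)

  anc-+ : ∀ i j v → anc (i + j) v ≡ anc j (anc i v)
  anc-+ zero    j v = refl
  anc-+ (suc i) j v = anc-+ i j (par v)

  anc-suc : ∀ h v → anc (suc h) v ≡ par (anc h v)
  anc-suc zero    v = refl
  anc-suc (suc h) v = anc-suc h (par v)

  anc-root : ∀ h → anc h r ≡ r
  anc-root zero    = refl
  anc-root (suc h) = trans (cong (anc h) par-r) (anc-root h)

  dep-par≤ : ∀ v → dep (par v) ≤ dep v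
  dep-par≤ v with v ≟ r
  ... | yes refl = ≤-reflexive (cong dep par-r)
  ... | no ne    = ≤-trans (n≤1+n _) (≤-reflexive (sym (dep-par ne)))

  dep-anc≤ : ∀ h v → dep (anc h v) ≤ dep v
  dep-anc≤ zero    v = ≤-refl
  dep-anc≤ (suc h) v = ≤-trans (dep-anc≤ h (par v)) (dep-par≤ v)

  -- The depth equation rules out that the iteration has run past the root, where `anc` stays put.
  Above : ℕ → Fin n → Fin n → Set
  Above a u w = anc a u ≡ w × dep u ≡ a + dep w

  -- Walking down from the common ancestor or up towards it costs one step of the walk each.
  commonAncestor : ∀ ℓ (p : Fin (suc ℓ) → Fin n) → (∀ i → Adj T (p (inject₁ i)) (p (suc i))) →
    ∃[ w ] ∃[ a ] ∃[ b ] (a + b ≤ ℓ × Above a (p zero) w × Above b (p (fromℕ ℓ)) w)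
  commonAncestor zero    p adj = p zero , 0 , 0 , z≤n , (refl , refl) , (refl , refl)
  commonAncestor (suc ℓ) p adj with commonAncestor ℓ (p ∘ suc) (adj ∘ suc) | adj-treeEdge (adj zero)
  ... | w , a , b , le , (e , d) , up | inj₁ (ne , par≡) =
    w , suc a , b , s≤s le , (trans (cong (anc a) par≡) e , trans (dep-par ne) (cong suc (trans (cong dep par≡) d))) , up
  ... | w , suc a , b , le , (e , d) , up | inj₂ (ne , par≡) =
    w , a , b , ≤-trans (≤-trans (n≤1+n _) le) (n≤1+n _) ,
    (trans (cong (anc a) (sym par≡)) e , suc-injective (trans (trans (cong (suc ∘ dep) (sym par≡)) (sym (dep-par ne))) d)) , up
  ... | w , zero , b , le , (refl , _) , (e , d) | inj₂ (ne , par≡) =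
    p zero , 0 , suc b , s≤s le , (refl , refl) ,
    (trans (anc-suc b _) (trans (cong par e) par≡) ,
     trans d (trans (cong (b +_) (trans (dep-par ne) (cong (suc ∘ dep) par≡))) (+-suc b _)))

  module _ (k : ℕ) .{{_ : NonZero k}} where

    bag : Fin n → Fin n
    bag v = anc (k + dep v % k) v

    -- With `ρ = dep w % k` the depth of `u` modulo `k` is `a + ρ` or `a + ρ - k`, so the shift
    -- `k + dep u % k` ends `ρ + k` or `ρ` levels above `w`. Neither height depends on `u`.
    bag-above : ∀ {a u w} → a ≤ k → Above a u w → bag u ≡ anc (dep w % k) w ⊎ bag u ≡ anc k (anc (dep w % k) w)
    bag-above {a} {u} {w} a≤k (e , d) with suc (a + dep w % k) ≤? k
    ... | yes lt = inj₂ (begin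
        anc (k + dep u % k) u                ≡⟨ cong (λ z → anc (k + z) u) (trans mod (m<n⇒m%n≡m lt)) ⟩
        anc (k + (a + ρ)) u                  ≡⟨ cong (λ z → anc z u) (alg k a ρ) ⟩
        anc (a + (ρ + k)) u                  ≡⟨ anc-+ a (ρ + k) u ⟩
        anc (ρ + k) (anc a u)                ≡⟨ cong (anc (ρ + k)) e ⟩
        anc (ρ + k) w                        ≡⟨ anc-+ ρ k w ⟩
        anc k (anc ρ w)                      ∎)
      where
      open ≡-Reasoning
      ρ = dep w % k
      alg : ∀ k a ρ → k + (a + ρ) ≡ a + (ρ + k)
      alg = solve-∀
      mod : dep u % k ≡ (a + ρ) % k
      mod = trans (cong (_% k) (trans d (trans (cong (a +_) (m≡m%n+[m/n]*n (dep w) k)) (sym (+-assoc a ρ _))))) ([m+kn]%n≡m%n (a + ρ) (dep w / k) k)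
    ... | no ¬lt = inj₁ (begin
        anc (k + dep u % k) u                ≡⟨ cong (λ z → anc (k + z) u) (trans mod (trans (cong (_% k) (sym (m∸n+n≡m k≤))) (trans ([m+n]%n≡m%n ε k) (m<n⇒m%n≡m ε<k)))) ⟩
        anc (k + ε) u                        ≡⟨ cong (λ z → anc z u) (trans (+-comm k ε) (m∸n+n≡m k≤)) ⟩
        anc (a + ρ) u                        ≡⟨ anc-+ a ρ u ⟩
        anc ρ (anc a u)                      ≡⟨ cong (anc ρ) e ⟩
        anc ρ w                              ∎)
      where
      open ≡-Reasoning
      ρ = dep w % k
      k≤ : k ≤ a + ρ
      k≤ = s≤s⁻¹ (≰⇒> ¬lt)
      ε = a + ρ ∸ k
      ε<k : ε < k
      ε<k = +-cancelʳ-< k ε k (≤-<-trans (≤-reflexive (m∸n+n≡m k≤)) (<-≤-trans (+-monoʳ-< a (m%n<n (dep w) k)) (+-monoˡ-≤ k a≤k)))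
      mod : dep u % k ≡ (a + ρ) % k
      mod = trans (cong (_% k) (trans d (trans (cong (a +_) (m≡m%n+[m/n]*n (dep w) k)) (sym (+-assoc a ρ _))))) ([m+kn]%n≡m%n (a + ρ) (dep w / k) k)

    Related : Fin n → Fin n → Set
    Related a b = a ≡ b ⊎ (a ≡ anc k b ⊎ b ≡ anc k a)

    bag-related : ∀ {u v ℓ} → ℓ ≤ k → Walk (Adj T) ℓ u v → Related (bag u) (bag v)
    bag-related {ℓ = ℓ} ℓ≤k (p , refl , refl , adj) with commonAncestor ℓ p adj
    ... | w , a , b , le , up , up′ with bag-above (≤-trans (m≤m+n a b) (≤-trans le ℓ≤k)) up | bag-above (≤-trans (m≤n+m b a) (≤-trans le ℓ≤k)) up′
    ...   | inj₁ e | inj₁ e′ = inj₁ (trans e (sym e′))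
    ...   | inj₂ e | inj₂ e′ = inj₁ (trans e (sym e′))
    ...   | inj₁ e | inj₂ e′ = inj₂ (inj₂ (trans e′ (cong (anc k) (sym e))))
    ...   | inj₂ e | inj₁ e′ = inj₂ (inj₁ (trans e (cong (anc k) (sym e′))))

    module _ {Δ : ℕ} (maxdeg : MaxDegreeAtMost T Δ) where

      -- The root is its own parent without being its own neighbour, which accounts for the extra
      -- one.
      #-children : ∀ x → # (λ v → par v == x) ≤ suc Δ
      #-children x = begin
        # (λ v → par v == x)                                    ≤⟨ #-mono cover ⟩
        # (λ v → (r == v) ∨ does (SimpleGraph.dec T x v))       ≤⟨ #-∨ (r ==_) (λ v → does (SimpleGraph.dec T x v)) ⟩
        # (r ==_) + # (λ v → does (SimpleGraph.dec T x v))      ≡⟨ cong₂ _+_ (#-δ r) (sym (length-filter (SimpleGraph.dec T x) (allFin n))) ⟩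
        suc (degree T x)                                        ≤⟨ s≤s (maxdeg x) ⟩
        suc Δ                                                   ∎
        where
        open ≤-Reasoning
        cover : ∀ v → (par v == x) ≡ true → (r == v) ∨ does (SimpleGraph.dec T x v) ≡ true
        cover v h with r ≟ v
        ... | yes _ = refl
        ... | no ne = dec-true (SimpleGraph.dec T x v) (subst (λ z → Adj T z v) (==⇒≡ {x = par v} {x} h) (SimpleGraph.sym T (par-adj (ne ∘ sym))))

      #-anc : ∀ h w → # (λ v → anc h v == w) ≤ suc Δ ^ h
      #-anc zero    w = ≤-reflexive (#-δʳ w)
      #-anc (suc h) w = begin
        # (λ v → anc h (par v) == w)                                  ≤⟨ #-mono (λ v e → some-intro (λ x → (anc h x == w) ∧ (par v == x)) {par v} (∧-intro e (==-refl (par v)))) ⟩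
        # (λ v → some (λ x → (anc h x == w) ∧ (par v == x)))          ≤⟨ #-some (λ x v → (anc h x == w) ∧ (par v == x)) ⟩
        ∑ (λ x → # (λ v → (anc h x == w) ∧ (par v == x)))             ≤⟨ ∑-mono (λ x → row (anc h x == w) x) ⟩
        ∑ (λ x → ⟦ anc h x == w ⟧ * suc Δ)                            ≡⟨ Σl-* (allFin n) (λ x → ⟦ anc h x == w ⟧) (suc Δ) ⟩
        # (λ x → anc h x == w) * suc Δ                                ≤⟨ *-monoˡ-≤ (suc Δ) (#-anc h w) ⟩
        suc Δ ^ h * suc Δ                                             ≡⟨ *-comm (suc Δ ^ h) (suc Δ) ⟩
        suc Δ ^ suc h                                                 ∎
        where
        open ≤-Reasoning
        row : ∀ b x → # (λ v → b ∧ (par v == x)) ≤ ⟦ b ⟧ * suc Δ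
        row true  x = ≤-trans (#-children x) (≤-reflexive (sym (+-identityʳ (suc Δ))))
        row false x = ≤-reflexive (Σl-0 (allFin n))

      -- The shift is less than `k + k`, and `anc h` with `h < k + k` has fibres of at most
      -- `suc Δ ^ (k + k)` vertices.
      #-bag : ∀ b → # (λ v → bag v == b) ≤ (k + k) * suc Δ ^ (k + k)
      #-bag b = begin
        # (λ v → bag v == b)                                 ≤⟨ #-mono inSome ⟩
        # (λ v → some {k + k} (λ h → anc (toℕ h) v == b))            ≤⟨ #-some {k + k} (λ h v → anc (toℕ h) v == b) ⟩
        ∑ {k + k} (λ h → # (λ v → anc (toℕ h) v == b))       ≤⟨ ∑-bound {k + k} (λ h → ≤-trans (#-anc (toℕ h) b) (^-monoʳ-≤ (suc Δ) (<⇒≤ (toℕ<n h)))) ⟩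
        (k + k) * suc Δ ^ (k + k)                            ∎
        where
        open ≤-Reasoning
        inSome : ∀ v → (bag v == b) ≡ true → some {k + k} (λ h → anc (toℕ h) v == b) ≡ true
        inSome v e = some-intro (λ h → anc (toℕ h) v == b) {fromℕ< lt}
          (subst (λ h → (anc h v == b) ≡ true) (sym (toℕ-fromℕ< lt)) e)
          where
          lt : k + dep v % k < k + k
          lt = +-monoʳ-< k (m%n<n (dep v) k)

      -- Since `anc` stops at the root, all other vertices of depth at most `k` become its children,
      -- which ties the residue classes of depths into a single tree. The depth of `T` is kept;
      -- along the new parents it need only decrease.
      powerTree : RootedTree n (suc Δ ^ k)
      powerTree = record
        { root = r ; par = anc k ; dep = dep
        ; dep-par = λ {v} ne → shorter k v ne
        ; children = λ w → ≤-trans (#-mono {Q = λ v → anc k v == w} (λ v → ∧-snd {not (r == v)})) (#-anc k w) }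
        where
        shorter : ∀ h .{{_ : NonZero h}} v → v ≢ r → dep (anc h v) < dep v
        shorter (suc h) v ne = ≤-trans (s≤s (dep-anc≤ h (par v))) (≤-reflexive (sym (dep-par ne)))

-- From hosts to the size-Ramsey bound

toSimpleGraph : (adj : Fin N → Fin N → Bool) → (∀ {x y} → adj x y ≡ true → adj y x ≡ true) → (∀ {x} → adj x x ≡ false) → SimpleGraph N
toSimpleGraph adj s i = record
  { Adj = λ x y → adj x y ≡ true ; sym = s ; irr = λ h → true≢false h i ; dec = λ x y → adj x y Boolₚ.≟ true }

edges-≤ : ∀ {N R} (adj : Fin N → Fin N → Bool) (s : ∀ {x y} → adj x y ≡ true → adj y x ≡ true) (i : ∀ {x} → adj x x ≡ false) →
          (∀ x → # (adj x) ≤ R) → edges (toSimpleGraph adj s (λ {x} → i {x})) ≤ N * R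
edges-≤ {N} {R} adj s i deg = begin
  edges G                               ≡⟨ trans (length-filter edge? (cartesianProduct (allFin N) (allFin N))) (Σl-cartesianProduct (allFin N) (allFin N) _) ⟩
  ∑ (λ x → ∑ (λ y → ⟦ does (edge? (x , y)) ⟧)) ≤⟨ ∑-mono (λ x → ∑-mono (λ y → ⟦⟧-mono (λ h → isTrue (adj x y) (∧-snd {does (x <? y)} h)))) ⟩
  ∑ (λ x → # (adj x))                   ≤⟨ ∑-bound deg ⟩
  N * R                                 ∎
  where
  open ≤-Reasoning
  G = toSimpleGraph adj s (λ {x} → i {x})
  edge? : (p : Fin N × Fin N) → Dec _
  edge? p = (proj₁ p <? proj₂ p) ×-dec SimpleGraph.dec G (proj₁ p) (proj₂ p)
  isTrue : ∀ b → does (b Boolₚ.≟ true) ≡ true → b ≡ true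
  isTrue true _ = refl

module Placement {n N t : ℕ} (bag : Fin n → Fin n) (bag-size : ∀ b → # (λ v → bag v == b) ≤ suc t)
  (K : Fin n → List (Fin N)) (size : ∀ a → suc t ≤ length (K a)) (uniq : ∀ a → Unique (K a))
  (disj : ∀ {a b x} → x ∈ K a → x ∈ K b → a ≡ b) where

  inBag : Fin n → List (Fin n)
  inBag b = members (λ v → bag v == b)

  self : ∀ v → v ∈ inBag (bag v)
  self v = ∈-filter⁺ (λ u → (bag u == bag v) Boolₚ.≟ true) (∈-allFin v) (==-refl (bag v))

  -- Vertices with the same bag are told apart by their position in `inBag`; there are at most
  -- `suc t` positions, and `K` provides at least as many vertices.
  rank : Fin n → ℕ
  rank v = toℕ (index (self v))

  rank< : ∀ v → rank v < length (K (bag v))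
  rank< v = <-≤-trans (toℕ<n (index (self v)))
    (≤-trans (≤-reflexive (length-members (λ u → bag u == bag v))) (≤-trans (bag-size (bag v)) (size (bag v))))

  place : Fin n → Fin N
  place v = lookup (K (bag v)) (fromℕ< (rank< v))

  place∈ : ∀ v → place v ∈ K (bag v)
  place∈ v = ∈-lookup {xs = K (bag v)} (fromℕ< (rank< v))

  place-injective : ∀ {u v} → place u ≡ place v → u ≡ v
  place-injective {u} {v} e = sameRank same (self u) (self v) (sameIndex same (rank< u) (rank< v) e)
    where
    same : bag u ≡ bag v
    same = disj (place∈ u) (subst (_∈ K (bag v)) (sym e) (place∈ v))
    sameIndex : ∀ {a b i j} → a ≡ b → (p : i < length (K a)) (q : j < length (K b)) →
                lookup (K a) (fromℕ< p) ≡ lookup (K b) (fromℕ< q) → i ≡ j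
    sameIndex {a} refl p q e = trans (sym (toℕ-fromℕ< p)) (trans (cong toℕ (lookup-injective (uniq a) e)) (toℕ-fromℕ< q))
    sameRank : ∀ {a b u v} → a ≡ b → (p : u ∈ inBag a) (q : v ∈ inBag b) → toℕ (index p) ≡ toℕ (index q) → u ≡ v
    sameRank {a} refl p q e = trans (lookup-index p) (trans (cong (lookup (inBag a)) (toℕ-injective e)) (sym (lookup-index q)))

theorem1p1 : ∀ (k Δ s : ℕ) → NonZero k → NonZero Δ → NonZero s →
    ∃[ C ] (∀ (n : ℕ) → NonZero n → (T : SimpleGraph n) → IsTree T → MaxDegreeAtMost T Δ →
    ∃[ m ] Σ (SimpleGraph m) (λ G → Arrows G (PowerAdj T k) s × edges G ≤ C * n))
theorem1p1 k Δ s k≢0 _ _ = C * R , λ { (suc n) _ T tree maxdeg → ramseyGraph n T tree maxdeg (hosts (suc n) z<s) }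
  where
  D t : ℕ
  -- `D` bounds the number of children in `powerTree`, and `t` the number of vertices with the same
  -- bag.
  D = suc Δ ^ k
  t = (k + k) * suc Δ ^ (k + k)
  host = hostFor D t s s
  C R : ℕ
  C = proj₁ host
  R = proj₁ (proj₂ host)
  hosts = proj₂ (proj₂ host)
  alg : ∀ C n R → C * n * R ≡ C * R * n
  alg = solve-∀
  arrow : ∀ n → (T : SimpleGraph (suc n)) → IsTree T → MaxDegreeAtMost T Δ → (H : HostAt D t s C R s (suc n)) →
          Arrows (toSimpleGraph (HostAt.adj H) (HostAt.adj-sym H) (λ {x} → HostAt.adj-irr H {x})) (PowerAdj T k) s
  arrow n T tree maxdeg H (c , c-sym) =
    let (i , K , size , uniq , disj , _ , same , up) = arrows (λ _ → true) c (allFin s) (≤-reflexive (length-allFin s))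
          (≤-trans (m≤m+n order (1 * order)) (≤-reflexive (cong (2 *_) (sym (#-true {order})))))
          (λ {x} {y} _ _ a → c-sym x y a , ∈-allFin (c x y)) (powerTree k maxdeg)
        open Placement (bag k) (λ b → ≤-trans (#-bag k maxdeg b) (n≤1+n _)) K size uniq disj
    in i , place , place-injective , λ u v (u≢v , ℓ , ℓ≤k , walk) →
         joined i K place place∈ same up (u≢v ∘ place-injective) (bag-related k ℓ≤k walk)
    where
    instance
      _ : NonZero k
      _ = k≢0
    open HostAt H
    open Rooting T tree zero
    joined : ∀ i (K : Fin (suc n) → List (Fin order)) (f : Fin (suc n) → Fin order) → (∀ v → f v ∈ K (bag k v)) →
             (∀ {a x y} → x ∈ K a → y ∈ K a → x ≢ y → adj x y ≡ true × c x y ≡ i) →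
             (∀ {a x y} → a ≢ zero → x ∈ K (anc k a) → y ∈ K a → adj x y ≡ true × c x y ≡ i) →
             ∀ {u v} → f u ≢ f v → Related k (bag k u) (bag k v) → adj (f u) (f v) ≡ true × c (f u) (f v) ≡ i
    joined i K f f∈ same up {u} {v} ne rel = go rel
      where
      swap : adj (f v) (f u) ≡ true × c (f v) (f u) ≡ i → adj (f u) (f v) ≡ true × c (f u) (f v) ≡ i
      swap (a , e) = adj-sym a , trans (c-sym (f u) (f v) (adj-sym a)) e
      go : Related k (bag k u) (bag k v) → adj (f u) (f v) ≡ true × c (f u) (f v) ≡ i
      go (inj₁ e) = same (subst (λ b → f u ∈ K b) e (f∈ u)) (f∈ v) ne
      go (inj₂ (inj₁ e)) with bag k v ≟ zero
      -- The root is its own `k`-th ancestor, so here the two bags coincide; `up` speaks only of the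
      -- other vertices.
      ... | yes z = same (subst (λ b → f u ∈ K b) (trans e (trans (cong (anc k) z) (trans (anc-root k) (sym z)))) (f∈ u)) (f∈ v) ne
      ... | no nz = up nz (subst (λ b → f u ∈ K b) e (f∈ u)) (f∈ v)
      go (inj₂ (inj₂ e)) with bag k u ≟ zero
      ... | yes z = same (f∈ u) (subst (λ b → f v ∈ K b) (trans e (trans (cong (anc k) z) (trans (anc-root k) (sym z)))) (f∈ v)) ne
      ... | no nz = swap (up nz (subst (λ b → f v ∈ K b) e (f∈ v)) (f∈ u))
  ramseyGraph : ∀ n → (T : SimpleGraph (suc n)) → IsTree T → MaxDegreeAtMost T Δ → HostAt D t s C R s (suc n) →
                ∃[ m ] Σ (SimpleGraph m) (λ G → Arrows G (PowerAdj T k) s × edges G ≤ C * R * suc n)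
  ramseyGraph n T tree maxdeg H =
    order , toSimpleGraph adj adj-sym (λ {x} → adj-irr {x}) , arrow n T tree maxdeg H ,
    ≤-trans (edges-≤ adj adj-sym adj-irr deg) (≤-trans (*-monoˡ-≤ R order≤) (≤-reflexive (alg C (suc n) R)))
    where
    open HostAt H
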